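{- Let $\mu$ be a composition of $n$ and $\pi,\tau\in\mathcal{I}_\mu$ with $\pi\lessdot^\mu\tau$. Then \[ \mathcal{A}_\mu(\tau)=\{wt_{ij}: w\in\mathcal{A}_\mu(\pi),\ t^\mu_{ij}(\pi)=\tau,\ \ell(wt_{ij})=\ell(w)+1\}. \]
   Context: Permutations are in one-line notation; $\mathrm{std}$ is standardization; $t_{ij}$ is the transposition $(i,j)$. $\ell$ is Coxeter length, $s_i=(i,i{+}1)$, $e$ the identity, and the 0--Hecke product is $w\circ s_i=ws_i$ if $\ell(ws_i)>\ell(w)$, else $w$ (similarly on the left). For a composition $\mu=(\mu_1,\dots,\mu_k)$ of $n$, $\pi\in S_n$ and $m_r=\mu_1+\dots+\mu_{r-1}$, the $r$th block is $B_r=\pi(m_r{+}1)\cdots\pi(m_r{+}\mu_r)$; $\pi$ is a $\mu$--involution ($\pi\in\mathcal{I}_\mu$) if each $\mathrm{std}(B_r)$ is an involution. For $\pi\in\mathcal{I}_\mu$, $i\in[n-1]$: if values $i,i{+}1$ are in different blocks, $\pi\circ_\mu s_i=s_i\circ\pi$; if in the same block $B$, replace $B$ by the word on the same values with standardization $s_r\circ\mathrm{std}(B)\circ s_r$, where $i$ is the $r$th smallest value of $B$. This extends to a right action of the 0--Hecke monoid. A reduced $\mu$--word for $\pi$ is a shortest $(a_1,\dots,a_p)$ with $\pi=e\circ_\mu s_{a_1}\circ_\mu\cdots\circ_\mu s_{a_p}$; $\ell_\mu(\pi)=p$ and $\mathcal{R}_\mu(\pi)$ is the set of these. $\mathcal{A}_\mu(\pi)=\{w\in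 S_n:e\circ_\mu w=\pi,\ \ell(w)=\ell_\mu(\pi)\}$. $\mu$--Bruhat order on $\mathcal{I}_\mu$: $\pi\le^\mu\tau$ iff every word in $\mathcal{R}_\mu(\tau)$ has a subword in $\mathcal{R}_\mu(\pi)$; $\lessdot^\mu$ denotes its cover relation. The operator $t^\mu_{ij}$: $t^\mu_{ij}(\pi)=\tau$ if there exist $v\in\mathcal{A}_\mu(\pi)$ and $\tau\in\mathcal{I}_\mu$ with $\ell(vt_{ij})=\ell(v)+1$ and $vt_{ij}\in\mathcal{A}_\mu(\tau)$ (this is well defined); otherwise $t^\mu_{ij}(\pi)=\pi$. -}

module Defs where

-- Conventions: permutations of [n] are one-line words (List ℕ) over the
-- values 0,…,n-1 (0-based shift of the paper's 1,…,n).  The simple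
-- transposition s_k (paper's s_{k+1}) swaps k and k+1, for k < n-1.

open import Data.Nat using (ℕ; zero; suc; _+_; _<_; _≤_; _<ᵇ_; _≡ᵇ_)
open import Data.Bool using (Bool; true; false; if_then_else_; _∧_)
open import Data.List using (List; []; _∷_; length; map; foldl; take; drop; concat; upTo)
open import Data.Nat.ListAction using (sum)
open import Data.Bool.ListAction using (any)
open import Data.List.Relation.Unary.All using (All)
open import Data.List.Relation.Binary.Permutation.Propositional using (_↭_)
open import Data.List.Relation.Binary.Sublist.Propositional using (_⊆_)
open import Data.Product using (Σ; _×_; ∃)
open import Data.Sum using (_⊎_)
open import Relation.Binary.PropositionalEquality using (_≡_; _≢_)
open import Relation.Nullary using (¬_)

at : List ℕ → ℕ → ℕ
at [] _ = 0
at (x ∷ xs) zero = x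
at (x ∷ xs) (suc k) = at xs k

swapℕ : ℕ → ℕ → ℕ → ℕ
swapℕ a b k = if k ≡ᵇ a then b else (if k ≡ᵇ b then a else k)

swapPos : ℕ → ℕ → List ℕ → List ℕ
swapPos i j w = map (λ k → at w (swapℕ i j k)) (upTo (length w))

swapVal : ℕ → ℕ → List ℕ → List ℕ
swapVal a b w = map (swapℕ a b) w

IsPerm : ℕ → List ℕ → Set
IsPerm n w = w ↭ upTo n

e : ℕ → List ℕ
e n = upTo n

cntLess : ℕ → List ℕ → ℕ
cntLess x [] = 0
cntLess x (y ∷ ys) = (if y <ᵇ x then 1 else 0) + cntLess x ys

ℓ : List ℕ → ℕ
ℓ [] = 0
ℓ (x ∷ xs) = cntLess x xs + ℓ xs

heckeR : List ℕ → ℕ → List ℕ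
heckeR w k = if ℓ w <ᵇ ℓ (swapPos k (suc k) w) then swapPos k (suc k) w else w

heckeL : ℕ → List ℕ → List ℕ
heckeL k w = if ℓ w <ᵇ ℓ (swapVal k (suc k) w) then swapVal k (suc k) w else w

std : List ℕ → List ℕ
std B = map (λ x → cntLess x B) B

valOfRank : List ℕ → ℕ → List ℕ → ℕ
valOfRank B m [] = 0
valOfRank B m (x ∷ xs) = if cntLess x B ≡ᵇ m then x else valOfRank B m xs

destd : List ℕ → List ℕ → List ℕ
destd B σ = map (λ m → valOfRank B m B) σ

IsComposition : ℕ → List ℕ → Set
IsComposition n μ = All (λ k → 0 < k) μ × sum μ ≡ n

blocks : List ℕ → List ℕ → List (List ℕ)
blocks [] π = []
blocks (k ∷ μ) π = take k π ∷ blocks μ (drop k π)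

compose : List ℕ → List ℕ → List ℕ
compose w v = map (at w) v

IsInvolution : List ℕ → Set
IsInvolution σ = compose σ σ ≡ upTo (length σ)

InvolMu : ℕ → List ℕ → List ℕ → Set
InvolMu n μ π = IsPerm n π × All (λ B → IsInvolution (std B)) (blocks μ π)

elem : ℕ → List ℕ → Bool
elem x xs = any (λ y → y ≡ᵇ x) xs

bothIn : ℕ → List ℕ → Bool
bothIn i B = elem i B ∧ elem (suc i) B

blockStep : ℕ → List ℕ → List ℕ
blockStep i B = destd B (heckeR (heckeL (cntLess i B) (std B)) (cntLess i B))

actMu : List ℕ → List ℕ → ℕ → List ℕ
actMu μ π i =
  if any (bothIn i) (blocks μ π)
  then concat (map (λ B → if bothIn i B then blockStep i B else B) (blocks μ π))
  else heckeL i π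

applyMu : List ℕ → List ℕ → List ℕ → List ℕ
applyMu μ π a = foldl (actMu μ) π a

ValidWord : ℕ → List ℕ → Set
ValidWord n a = All (λ k → suc k < n) a

ReducedMu : ℕ → List ℕ → List ℕ → List ℕ → Set
ReducedMu n μ π a =
  ValidWord n a × applyMu μ (e n) a ≡ π ×
  (∀ b → ValidWord n b → applyMu μ (e n) b ≡ π → length a ≤ length b)

LenMu : ℕ → List ℕ → List ℕ → ℕ → Set
LenMu n μ π p = Σ (List ℕ) λ a → ReducedMu n μ π a × length a ≡ p

prodWord : ℕ → List ℕ → List ℕ
prodWord n a = foldl (λ w k → swapPos k (suc k) w) (e n) a

ReducedWordOf : ℕ → List ℕ → List ℕ → Set
ReducedWordOf n w a = ValidWord n a × prodWord n a ≡ w × length a ≡ ℓ w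

-- e ∘_μ w = π  (computed along a reduced word of w; independent of the choice)
HeckeActs : ℕ → List ℕ → List ℕ → List ℕ → Set
HeckeActs n μ w π = Σ (List ℕ) λ a → ReducedWordOf n w a × applyMu μ (e n) a ≡ π

InA : ℕ → List ℕ → List ℕ → List ℕ → Set
InA n μ π w = IsPerm n w × HeckeActs n μ w π × LenMu n μ π (ℓ w)

LeMu : ℕ → List ℕ → List ℕ → List ℕ → Set
LeMu n μ π τ = ∀ a → ReducedMu n μ τ a → Σ (List ℕ) λ b → b ⊆ a × ReducedMu n μ π b

CoversMu : ℕ → List ℕ → List ℕ → List ℕ → Set
CoversMu n μ π τ =
  LeMu n μ π τ × π ≢ τ ×
  (∀ σ → InvolMu n μ σ → LeMu n μ π σ → LeMu n μ σ τ → σ ≡ π ⊎ σ ≡ τ)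

THit : ℕ → List ℕ → ℕ → ℕ → List ℕ → List ℕ → Set
THit n μ i j π τ =
  InvolMu n μ τ ×
  Σ (List ℕ) λ v → InA n μ π v × ℓ (swapPos i j v) ≡ suc (ℓ v) × InA n μ τ (swapPos i j v)

TMu : ℕ → List ℕ → ℕ → ℕ → List ℕ → List ℕ → Set
TMu n μ i j π τ = THit n μ i j π τ ⊎ ((∀ τ′ → ¬ THit n μ i j π τ′) × τ ≡ π)

{-# OPTIONS --safe #-}
module Submission where

-- Read w through its inverse: f v = w(v) is the position of the value v.  A
-- μ-involution is a colouring of the values by blocks together with a
-- colour-preserving involution z, and membership in 𝒜_μ(π) amounts to conditions
-- on the positions of pairs of cycles of z (as found by Can, Joyce and Wyser for
-- one block).  Any two elements of 𝒜_μ(π) are linked by exchanges bca ↔ cab of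
-- consecutive letters of the inverse.  With the lifting property of the Bruhat
-- order of S_n this turns ≤^μ into comparability of atoms and makes the lengths
-- of π ⋖^μ τ differ by one, so a reduced word of τ yields one of π by deleting a
-- letter, which multiplies the permutation by a transposition.  Conversely,
-- whether a cover v t_ij of v ∈ 𝒜_μ(π) is again an atom, and of which τ, depends
-- on π, i and j only: if i and j lie in one block then their cycles must not be
-- nested, and the cycles of τ are read off from those of π.

open import Defs
open import Data.Nat using (ℕ; zero; suc; _+_; _*_; _∸_; _<_; _≤_; _≡ᵇ_; z≤n; s≤s; _<ᵇ_; _>_)
open import Data.Nat.Properties
open import Data.Bool using (Bool; true; false; if_then_else_; not; _∧_; _∨_; T)
open import Data.List using (List; []; _∷_; _++_; map; length; upTo; applyUpTo; concat; filter; take; drop; foldl)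
open import Data.Product using (Σ; _×_; _,_; proj₁; proj₂; ∃)
open import Data.Sum using (_⊎_; inj₁; inj₂)
open import Data.Empty using (⊥; ⊥-elim)
open import Data.Unit using (⊤; tt)
open import Relation.Nullary using (¬_; Dec; yes; no)
open import Relation.Binary.PropositionalEquality
open import Function.Bundles using (_⇔_; mk⇔)
open import Data.Nat.Induction using (<-rec)
open import Relation.Binary.Definitions using (tri<; tri≈; tri>)
open import Relation.Binary.Structures using (IsStrictTotalOrder)
open import Data.List.Properties using (map-upTo; length-map; length-upTo; map-∘; map-++; map-id; map-cong-local; filter-++; filter-accept; filter-reject; map-cong; concat-map; filter-all; filter-none; foldl-∷ʳ; length-++)
open import Data.List.Membership.Propositional using (_∈_; _∉_)
open import Data.List.Relation.Unary.Any using (here; there)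
open import Data.List.Relation.Unary.All using (All; []; _∷_)
open import Data.List.Relation.Unary.AllPairs using (AllPairs; []; _∷_)
open import Data.List.Relation.Unary.Unique.Propositional using (Unique)
open import Data.List.Relation.Binary.Permutation.Propositional using (_↭_)
open import Data.Bool.ListAction using (any)
open import Data.Nat.ListAction using (sum)
open import Data.List.Relation.Binary.Sublist.Propositional using (_⊆_; []; _∷_; _∷ʳ_)
import Relation.Binary.Construct.Flip.EqAndOrd as Flip
import Data.Nat.Solver
import Data.List.Relation.Unary.AllPairs.Properties as AllPairsProperties
import Data.List.Relation.Unary.Unique.Propositional.Properties as UniqueProperties
import Data.List.Relation.Unary.All.Properties as All
import Data.List.Relation.Unary.All as AllBase
import Data.List.Membership.Propositional.Properties as Membership
import Data.List.Relation.Binary.Permutation.Propositional as ↭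
import Data.List.Relation.Unary.AllPairs as AllPairsBase
import Data.List.Membership.Propositional.Properties.WithK as MembershipK
import Data.List.Relation.Binary.BagAndSetEquality as BagSet
import Data.List.Relation.Binary.Permutation.Propositional.Properties as Perm↭
import Data.Bool.Properties
import Data.List.Properties
import Data.List.Reverse as Reverse
import Data.List.Relation.Binary.Sublist.Propositional.Properties as Sublist

-- Propositional formulas over strict comparisons of named naturals, decided by
-- unit propagation and splitting; the order axioms are instantiated up front.

-- Every atom condition concerns only two cycles of the involution. A change to one or two cycles
-- can therefore be tested against one further, arbitrary cycle, and each local verification becomes
-- a finite question about strict comparisons of values and of positions. The decision procedure
-- settles these questions. The permutation determines its involution. So, to see that a covering
-- swap leads from two atoms of π to atoms of the same τ, it is enough to construct from `z`, `i`
-- and `j` alone one involution that works for every atom of π, and then to identify it by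
-- uniqueness. The obstacle is that a covering swap of an atom can fail to be an atom. Being a cover
-- does not exclude the bad, nested configurations. They are excluded by the success of the swap for
-- a single atom: the old and the new involution are compared from the outer end inwards, where the
-- swap has not yet changed anything, and they contradict each other at the first nested cycle. A
-- similar asymmetry shapes the use of the action: where it does not move π, a given atom need not
-- have a descent, and only the existence of some atom with one is available.

infixr 6 _∧ᶠ_
infixr 5 _∨ᶠ_
infixr 4 _⇒ᶠ_

data Formula : Set where
  _<ᶠ_ : ℕ → ℕ → Formula
  _∧ᶠ_ _∨ᶠ_ _⇒ᶠ_ : Formula → Formula → Formula
  ¬ᶠ_ : Formula → Formula

infix 7 _<ᶠ_ _≤ᶠ_
infix 8 ¬ᶠ_

_≤ᶠ_ : ℕ → ℕ → Formula
a ≤ᶠ b = ¬ᶠ (b <ᶠ a)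

⟦_⟧ : Formula → (ℕ → ℕ) → Set
⟦ a <ᶠ b ⟧ ρ = ρ a < ρ b
⟦ φ ∧ᶠ ψ ⟧ ρ = ⟦ φ ⟧ ρ × ⟦ ψ ⟧ ρ
⟦ φ ∨ᶠ ψ ⟧ ρ = ⟦ φ ⟧ ρ ⊎ ⟦ ψ ⟧ ρ
⟦ φ ⇒ᶠ ψ ⟧ ρ = ⟦ φ ⟧ ρ → ⟦ ψ ⟧ ρ
⟦ ¬ᶠ φ ⟧ ρ = ¬ ⟦ φ ⟧ ρ

data Literal : Set where
  holds fails : ℕ → ℕ → Literal

Clause CNF : Set
Clause = List Literal
CNF = List Clause

⟦_⟧ˡ : Literal → (ℕ → ℕ) → Set
⟦ holds a b ⟧ˡ ρ = ρ a < ρ b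
⟦ fails a b ⟧ˡ ρ = ¬ (ρ a < ρ b)

⟦_⟧ᶜ : Clause → (ℕ → ℕ) → Set
⟦ [] ⟧ᶜ ρ = ⊥
⟦ l ∷ ls ⟧ᶜ ρ = ⟦ l ⟧ˡ ρ ⊎ ⟦ ls ⟧ᶜ ρ

⟦_⟧ⁿ : CNF → (ℕ → ℕ) → Set
⟦ [] ⟧ⁿ ρ = ⊤
⟦ c ∷ cs ⟧ⁿ ρ = ⟦ c ⟧ᶜ ρ × ⟦ cs ⟧ⁿ ρ

⟦⟧ᶜ-++ˡ : ∀ c d {ρ} → ⟦ c ⟧ᶜ ρ → ⟦ c ++ d ⟧ᶜ ρ
⟦⟧ᶜ-++ˡ (l ∷ c) d (inj₁ h) = inj₁ h
⟦⟧ᶜ-++ˡ (l ∷ c) d (inj₂ h) = inj₂ (⟦⟧ᶜ-++ˡ c d h)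

⟦⟧ᶜ-++ʳ : ∀ c d {ρ} → ⟦ d ⟧ᶜ ρ → ⟦ c ++ d ⟧ᶜ ρ
⟦⟧ᶜ-++ʳ [] d h = h
⟦⟧ᶜ-++ʳ (l ∷ c) d h = inj₂ (⟦⟧ᶜ-++ʳ c d h)

⟦⟧ⁿ-++ : ∀ cs ds {ρ} → ⟦ cs ⟧ⁿ ρ → ⟦ ds ⟧ⁿ ρ → ⟦ cs ++ ds ⟧ⁿ ρ
⟦⟧ⁿ-++ [] ds h k = k
⟦⟧ⁿ-++ (c ∷ cs) ds (h , hs) k = h , ⟦⟧ⁿ-++ cs ds hs k

_⊗_ : CNF → CNF → CNF
[] ⊗ ds = []
(c ∷ cs) ⊗ ds = map (c ++_) ds ++ (cs ⊗ ds)

⊗-sound : ∀ cs ds {ρ} → ⟦ cs ⟧ⁿ ρ ⊎ ⟦ ds ⟧ⁿ ρ → ⟦ cs ⊗ ds ⟧ⁿ ρ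
⊗-sound [] ds h = tt
⊗-sound (c ∷ cs) ds {ρ} h = ⟦⟧ⁿ-++ (map (c ++_) ds) (cs ⊗ ds) (row ds (first h)) (⊗-sound cs ds (rest h))
  where
  first : ⟦ c ∷ cs ⟧ⁿ ρ ⊎ ⟦ ds ⟧ⁿ ρ → ⟦ c ⟧ᶜ ρ ⊎ ⟦ ds ⟧ⁿ ρ
  first (inj₁ (h , _)) = inj₁ h
  first (inj₂ h) = inj₂ h
  rest : ⟦ c ∷ cs ⟧ⁿ ρ ⊎ ⟦ ds ⟧ⁿ ρ → ⟦ cs ⟧ⁿ ρ ⊎ ⟦ ds ⟧ⁿ ρ
  rest (inj₁ (_ , h)) = inj₁ h
  rest (inj₂ h) = inj₂ h
  row : ∀ es → ⟦ c ⟧ᶜ ρ ⊎ ⟦ es ⟧ⁿ ρ → ⟦ map (c ++_) es ⟧ⁿ ρ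
  row [] h = tt
  row (e ∷ es) (inj₁ h) = ⟦⟧ᶜ-++ˡ c e h , row es (inj₁ h)
  row (e ∷ es) (inj₂ (h , hs)) = ⟦⟧ᶜ-++ʳ c e h , row es (inj₂ hs)

cnf⁺ cnf⁻ : Formula → CNF
cnf⁺ (a <ᶠ b) = (holds a b ∷ []) ∷ []
cnf⁺ (φ ∧ᶠ ψ) = cnf⁺ φ ++ cnf⁺ ψ
cnf⁺ (φ ∨ᶠ ψ) = cnf⁺ φ ⊗ cnf⁺ ψ
cnf⁺ (φ ⇒ᶠ ψ) = cnf⁻ φ ⊗ cnf⁺ ψ
cnf⁺ (¬ᶠ φ) = cnf⁻ φ
cnf⁻ (a <ᶠ b) = (fails a b ∷ []) ∷ []
cnf⁻ (φ ∧ᶠ ψ) = cnf⁻ φ ⊗ cnf⁻ ψ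
cnf⁻ (φ ∨ᶠ ψ) = cnf⁻ φ ++ cnf⁻ ψ
cnf⁻ (φ ⇒ᶠ ψ) = cnf⁺ φ ++ cnf⁻ ψ
cnf⁻ (¬ᶠ φ) = cnf⁺ φ

-- Comparisons of naturals are decidable, hence so are all formulas. This justifies the classical
-- normal forms of implications and negations.
⟦_⟧? : ∀ φ ρ → Dec (⟦ φ ⟧ ρ)
⟦ a <ᶠ b ⟧? ρ = ρ a <? ρ b
⟦ φ ∧ᶠ ψ ⟧? ρ with ⟦ φ ⟧? ρ | ⟦ ψ ⟧? ρ
... | yes h | yes k = yes (h , k)
... | no h | _ = no λ { (h' , _) → h h' }
... | _ | no k = no λ { (_ , k') → k k' }
⟦ φ ∨ᶠ ψ ⟧? ρ with ⟦ φ ⟧? ρ | ⟦ ψ ⟧? ρ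
... | yes h | _ = yes (inj₁ h)
... | _ | yes k = yes (inj₂ k)
... | no h | no k = no λ { (inj₁ h') → h h' ; (inj₂ k') → k k' }
⟦ φ ⇒ᶠ ψ ⟧? ρ with ⟦ φ ⟧? ρ | ⟦ ψ ⟧? ρ
... | _ | yes k = yes λ _ → k
... | no h | _ = yes λ h' → ⊥-elim (h h')
... | yes h | no k = no λ i → k (i h)
⟦ ¬ᶠ φ ⟧? ρ with ⟦ φ ⟧? ρ
... | yes h = no λ k → k h
... | no h = yes h

cnf⁺-sound : ∀ φ {ρ} → ⟦ φ ⟧ ρ → ⟦ cnf⁺ φ ⟧ⁿ ρ
cnf⁻-sound : ∀ φ {ρ} → ¬ ⟦ φ ⟧ ρ → ⟦ cnf⁻ φ ⟧ⁿ ρ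
cnf⁺-sound (a <ᶠ b) h = inj₁ h , tt
cnf⁺-sound (φ ∧ᶠ ψ) (h , k) = ⟦⟧ⁿ-++ (cnf⁺ φ) _ (cnf⁺-sound φ h) (cnf⁺-sound ψ k)
cnf⁺-sound (φ ∨ᶠ ψ) (inj₁ h) = ⊗-sound (cnf⁺ φ) _ (inj₁ (cnf⁺-sound φ h))
cnf⁺-sound (φ ∨ᶠ ψ) (inj₂ k) = ⊗-sound (cnf⁺ φ) _ (inj₂ (cnf⁺-sound ψ k))
cnf⁺-sound (φ ⇒ᶠ ψ) {ρ} h with ⟦ φ ⟧? ρ
... | yes k = ⊗-sound (cnf⁻ φ) _ (inj₂ (cnf⁺-sound ψ (h k)))
... | no k = ⊗-sound (cnf⁻ φ) _ (inj₁ (cnf⁻-sound φ k))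
cnf⁺-sound (¬ᶠ φ) h = cnf⁻-sound φ h
cnf⁻-sound (a <ᶠ b) h = inj₁ h , tt
cnf⁻-sound (φ ∧ᶠ ψ) {ρ} h with ⟦ φ ⟧? ρ
... | yes k = ⊗-sound (cnf⁻ φ) _ (inj₂ (cnf⁻-sound ψ λ k' → h (k , k')))
... | no k = ⊗-sound (cnf⁻ φ) _ (inj₁ (cnf⁻-sound φ k))
cnf⁻-sound (φ ∨ᶠ ψ) h = ⟦⟧ⁿ-++ (cnf⁻ φ) _ (cnf⁻-sound φ λ k → h (inj₁ k)) (cnf⁻-sound ψ λ k → h (inj₂ k))
cnf⁻-sound (φ ⇒ᶠ ψ) {ρ} h with ⟦ φ ⟧? ρ
... | yes k = ⟦⟧ⁿ-++ (cnf⁺ φ) _ (cnf⁺-sound φ k) (cnf⁻-sound ψ λ k' → h λ _ → k')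
... | no k = ⊥-elim (h λ k' → ⊥-elim (k k'))
cnf⁻-sound (¬ᶠ φ) {ρ} h with ⟦ φ ⟧? ρ
... | yes k = cnf⁺-sound φ k
... | no k = ⊥-elim (h k)

negate : Literal → Literal
negate (holds a b) = fails a b
negate (fails a b) = holds a b

_==_ : Literal → Literal → Bool
holds a b == holds c d = (a ≡ᵇ c) ∧ (b ≡ᵇ d)
fails a b == fails c d = (a ≡ᵇ c) ∧ (b ≡ᵇ d)
_ == _ = false

∧-T : ∀ {x y} → x ∧ y ≡ true → x ≡ true × y ≡ true
∧-T {true} {true} _ = refl , refl

≡ᵇ-true : ∀ a b → (a ≡ᵇ b) ≡ true → a ≡ b
≡ᵇ-true a b h = ≡ᵇ⇒≡ a b (subst T (sym h) tt)

==-sound : ∀ l m → (l == m) ≡ true → l ≡ m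
==-sound (holds a b) (holds c d) h with ∧-T {a ≡ᵇ c} h
... | p , q = cong₂ holds (≡ᵇ-true a c p) (≡ᵇ-true b d q)
==-sound (fails a b) (fails c d) h with ∧-T {a ≡ᵇ c} h
... | p , q = cong₂ fails (≡ᵇ-true a c p) (≡ᵇ-true b d q)

contains : Literal → Clause → Bool
contains l [] = false
contains l (m ∷ c) = (l == m) ∨ contains l c

strike : Literal → Clause → Clause
strike l [] = []
strike l (m ∷ c) = if negate l == m then strike l c else m ∷ strike l c

assign : Literal → CNF → CNF
assign l [] = []
assign l (c ∷ cs) = if contains l c then assign l cs else strike l c ∷ assign l cs

negate-sound : ∀ l {ρ} → ⟦ l ⟧ˡ ρ → ¬ ⟦ negate l ⟧ˡ ρ
negate-sound (holds a b) h k = k h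
negate-sound (fails a b) h k = h k

literal? : ∀ l ρ → ⟦ l ⟧ˡ ρ ⊎ ⟦ negate l ⟧ˡ ρ
literal? (holds a b) ρ with ρ a <? ρ b
... | yes h = inj₁ h
... | no h = inj₂ h
literal? (fails a b) ρ with ρ a <? ρ b
... | yes h = inj₂ h
... | no h = inj₁ h

strike-sound : ∀ l c {ρ} → ⟦ l ⟧ˡ ρ → ⟦ c ⟧ᶜ ρ → ⟦ strike l c ⟧ᶜ ρ
strike-sound l (m ∷ c) h k with negate l == m in eq
strike-sound l (m ∷ c) h (inj₁ k) | true = ⊥-elim (negate-sound l h (subst (λ x → ⟦ x ⟧ˡ _) (sym (==-sound _ m eq)) k))
strike-sound l (m ∷ c) h (inj₂ k) | true = strike-sound l c h k
strike-sound l (m ∷ c) h (inj₁ k) | false = inj₁ k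
strike-sound l (m ∷ c) h (inj₂ k) | false = inj₂ (strike-sound l c h k)

assign-sound : ∀ l cs {ρ} → ⟦ l ⟧ˡ ρ → ⟦ cs ⟧ⁿ ρ → ⟦ assign l cs ⟧ⁿ ρ
assign-sound l [] h k = tt
assign-sound l (c ∷ cs) h (k , ks) with contains l c
... | true = assign-sound l cs h ks
... | false = strike-sound l c h k , assign-sound l cs h ks

data Status : Set where
  refuted undecided : Status
  unit branch : Literal → Status

status : Status → CNF → Status
status s [] = s
status s ([] ∷ cs) = refuted
status s ((l ∷ []) ∷ cs) = unit l
status undecided ((l ∷ _ ∷ _) ∷ cs) = status (branch l) cs
status s ((_ ∷ _ ∷ _) ∷ cs) = status s cs

refutes : ℕ → CNF → Bool
refutes-with : Status → ℕ → CNF → Bool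
refutes zero cs = false
refutes (suc k) cs = refutes-with (status undecided cs) k cs
refutes-with refuted k cs = true
refutes-with undecided k cs = false
refutes-with (unit l) k cs = refutes k (assign l cs)
refutes-with (branch l) k cs = refutes k (assign l cs) ∧ refutes k (assign (negate l) cs)

refuted-sound : ∀ s cs {ρ} → status s cs ≡ refuted → s ≢ refuted → ¬ ⟦ cs ⟧ⁿ ρ
refuted-sound s [] eq ne h = ne eq
refuted-sound s ([] ∷ cs) eq ne (() , _)
refuted-sound undecided ((l ∷ _ ∷ _) ∷ cs) eq ne (_ , h) = refuted-sound (branch l) cs eq (λ ()) h
refuted-sound refuted ((l ∷ _ ∷ _) ∷ cs) eq ne (_ , h) = ne refl
refuted-sound (unit x) ((l ∷ _ ∷ _) ∷ cs) eq ne (_ , h) = refuted-sound (unit x) cs eq ne h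
refuted-sound (branch x) ((l ∷ _ ∷ _) ∷ cs) eq ne (_ , h) = refuted-sound (branch x) cs eq ne h

unit-sound : ∀ s cs l {ρ} → status s cs ≡ unit l → s ≢ unit l → ⟦ cs ⟧ⁿ ρ → ⟦ l ⟧ˡ ρ
unit-sound s [] l eq ne h = ⊥-elim (ne eq)
unit-sound s ((m ∷ []) ∷ cs) .m refl ne (inj₁ h , _) = h
unit-sound undecided ((m ∷ _ ∷ _) ∷ cs) l eq ne (_ , h) = unit-sound (branch m) cs l eq (λ ()) h
unit-sound refuted ((m ∷ _ ∷ _) ∷ cs) l eq ne (_ , h) = unit-sound refuted cs l eq ne h
unit-sound (unit x) ((m ∷ _ ∷ _) ∷ cs) l eq ne (_ , h) = unit-sound (unit x) cs l eq ne h
unit-sound (branch x) ((m ∷ _ ∷ _) ∷ cs) l eq ne (_ , h) = unit-sound (branch x) cs l eq ne h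

refutes-sound : ∀ k cs {ρ} → refutes k cs ≡ true → ¬ ⟦ cs ⟧ⁿ ρ
refutes-sound (suc k) cs {ρ} r h with status undecided cs in eq
... | refuted = refuted-sound undecided cs eq (λ ()) h
... | unit l = refutes-sound k _ r (assign-sound l cs (unit-sound undecided cs l eq (λ ()) h) h)
... | branch l with ∧-T r | literal? l ρ
...   | r₁ , _ | inj₁ p = refutes-sound k _ r₁ (assign-sound l cs p h)
...   | _ , r₂ | inj₂ p = refutes-sound k _ r₂ (assign-sound (negate l) cs p h)

infixr 3 _⟫_
_⟫_ : ∀ {A B : Set} → List A → (A → List B) → List B
[] ⟫ f = []
(x ∷ xs) ⟫ f = f x ++ (xs ⟫ f)

⟫-sound : ∀ {A : Set} (xs : List A) (f : A → CNF) {ρ} → (∀ x → ⟦ f x ⟧ⁿ ρ) → ⟦ xs ⟫ f ⟧ⁿ ρ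
⟫-sound [] f h = tt
⟫-sound (x ∷ xs) f h = ⟦⟧ⁿ-++ (f x) _ (h x) (⟫-sound xs f h)

distinct₃ : ℕ → ℕ → ℕ → Bool
distinct₃ a b c = not (a ≡ᵇ b) ∧ (not (b ≡ᵇ c) ∧ not (a ≡ᵇ c))

-- Together these axiomatise strict weak orders. Equality needs no literal of its own, so points
-- that may coincide, such as the two ends of a fixed point, are covered by the same clauses.
asymmetries cotransitivities : List ℕ → CNF
asymmetries xs = xs ⟫ λ a → xs ⟫ λ b → if b Data.Nat.<ᵇ a then (fails a b ∷ fails b a ∷ []) ∷ [] else []
cotransitivities xs = xs ⟫ λ a → xs ⟫ λ b → xs ⟫ λ c →
  if distinct₃ a b c then (fails a c ∷ holds a b ∷ holds b c ∷ []) ∷ [] else []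

asymmetries-sound : ∀ xs {ρ} → ⟦ asymmetries xs ⟧ⁿ ρ
asymmetries-sound xs {ρ} = ⟫-sound xs _ λ a → ⟫-sound xs _ λ b → go a b (b Data.Nat.<ᵇ a)
  where
  go : ∀ a b t → ⟦ (if t then (fails a b ∷ fails b a ∷ []) ∷ [] else []) ⟧ⁿ ρ
  go a b false = tt
  go a b true with ρ a <? ρ b
  ... | yes h = inj₂ (inj₁ (<-asym h)) , tt
  ... | no h = inj₁ h , tt

cotransitivities-sound : ∀ xs {ρ} → ⟦ cotransitivities xs ⟧ⁿ ρ
cotransitivities-sound xs {ρ} = ⟫-sound xs _ λ a → ⟫-sound xs _ λ b → ⟫-sound xs _ λ c → go a b c (distinct₃ a b c)
  where
  go : ∀ a b c t → ⟦ (if t then (fails a c ∷ holds a b ∷ holds b c ∷ []) ∷ [] else []) ⟧ⁿ ρ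
  go a b c false = tt
  go a b c true with ρ a <? ρ c | ρ a <? ρ b
  ... | no h | _ = inj₁ h , tt
  ... | yes h | yes k = inj₂ (inj₁ k) , tt
  ... | yes h | no k = inj₂ (inj₂ (inj₁ (≤-<-trans (≮⇒≥ k) h))) , tt

orderAxioms : List (List ℕ) → CNF
orderAxioms gs = gs ⟫ λ xs → asymmetries xs ++ cotransitivities xs

-- Hypotheses become clauses and conjunctions are split before anything is negated, so that each
-- refutation starts from one small goal.
entails : CNF → Formula → Bool
entails cs (φ ∧ᶠ ψ) = entails cs φ ∧ entails cs ψ
entails cs (φ ⇒ᶠ ψ) = entails (cnf⁺ φ ++ cs) ψ
-- 1000 is fuel. Every call eliminates one comparison, and the formulas in use contain fewer than a
-- hundred of them.
entails cs φ = refutes 1000 (cnf⁻ φ ++ cs)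

entails-sound : ∀ cs φ {ρ} → entails cs φ ≡ true → ⟦ cs ⟧ⁿ ρ → ⟦ φ ⟧ ρ
by-refutation : ∀ cs φ {ρ} → refutes 1000 (cnf⁻ φ ++ cs) ≡ true → ⟦ cs ⟧ⁿ ρ → ⟦ φ ⟧ ρ
by-refutation cs φ {ρ} r h with ⟦ φ ⟧? ρ
... | yes k = k
... | no k = ⊥-elim (refutes-sound 1000 (cnf⁻ φ ++ cs) r (⟦⟧ⁿ-++ (cnf⁻ φ) cs (cnf⁻-sound φ k) h))
entails-sound cs (φ ∧ᶠ ψ) e h with ∧-T {entails cs φ} e
... | p , q = entails-sound cs φ p h , entails-sound cs ψ q h
entails-sound cs (φ ⇒ᶠ ψ) e h k = entails-sound (cnf⁺ φ ++ cs) ψ e (⟦⟧ⁿ-++ (cnf⁺ φ) cs (cnf⁺-sound φ k) h)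
entails-sound cs φ@(_ <ᶠ _) e h = by-refutation cs φ e h
entails-sound cs φ@(_ ∨ᶠ _) e h = by-refutation cs φ e h
entails-sound cs φ@(¬ᶠ _) e h = by-refutation cs φ e h

-- The points of one list are compared with each other only.
Valid : List (List ℕ) → Formula → Set
Valid gs φ = entails (orderAxioms gs) φ ≡ true

by-order : ∀ gs φ → Valid gs φ → ∀ ρ → ⟦ φ ⟧ ρ
by-order gs φ r ρ = entails-sound (orderAxioms gs) φ r
  (⟫-sound gs _ λ xs → ⟦⟧ⁿ-++ (asymmetries xs) _ (asymmetries-sound xs) (cotransitivities-sound xs))

env : List ℕ → ℕ → ℕ
env [] _ = 0
env (x ∷ xs) zero = x
env (x ∷ xs) (suc k) = env xs k

-- The Bruhat order on permutations

≡ᵇ-refl : ∀ a → (a ≡ᵇ a) ≡ true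
≡ᵇ-refl zero = refl
≡ᵇ-refl (suc a) = ≡ᵇ-refl a

≡ᵇ-false : ∀ {a b} → a ≢ b → (a ≡ᵇ b) ≡ false
≡ᵇ-false {a} {b} ne with a ≡ᵇ b in eq
... | true = ⊥-elim (ne (≡ᵇ-true a b eq))
... | false = refl

<ᵇ-true : ∀ {a b} → a < b → (a <ᵇ b) ≡ true
<ᵇ-true {a} {b} h with a <ᵇ b in eq
... | true = refl
... | false = ⊥-elim (subst T eq (<⇒<ᵇ h))

<ᵇ-false : ∀ {a b} → ¬ (a < b) → (a <ᵇ b) ≡ false
<ᵇ-false {a} {b} h with a <ᵇ b in eq
... | true = ⊥-elim (h (<ᵇ⇒< a b (subst T (sym eq) tt)))
... | false = refl

swap-left : ∀ a b → swapℕ a b a ≡ b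
swap-left a b rewrite ≡ᵇ-refl a = refl

swap-right : ∀ a b → swapℕ a b b ≡ a
swap-right a b with b ≡ᵇ a in eq
... | true = ≡ᵇ-true b a eq
... | false rewrite ≡ᵇ-refl b = refl

swap-other : ∀ {a b k} → k ≢ a → k ≢ b → swapℕ a b k ≡ k
swap-other h h' rewrite ≡ᵇ-false h | ≡ᵇ-false h' = refl

data SwapView (a b k : ℕ) : Set where
  is-left : k ≡ a → swapℕ a b k ≡ b → SwapView a b k
  is-right : k ≡ b → swapℕ a b k ≡ a → SwapView a b k
  is-other : k ≢ a → k ≢ b → swapℕ a b k ≡ k → SwapView a b k

swapView : ∀ a b k → SwapView a b k
swapView a b k with k ≟ a
... | yes refl = is-left refl (swap-left a b)
... | no h with k ≟ b
...   | yes refl = is-right refl (swap-right a b)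
...   | no h' = is-other h h' (swap-other h h')

swap-involutive : ∀ a b k → swapℕ a b (swapℕ a b k) ≡ k
swap-involutive a b k with swapView a b k
... | is-left p q = trans (cong (swapℕ a b) q) (trans (swap-right a b) (sym p))
... | is-right p q = trans (cong (swapℕ a b) q) (trans (swap-left a b) (sym p))
... | is-other _ _ q = trans (cong (swapℕ a b) q) q

swap-injective : ∀ a b {k l} → swapℕ a b k ≡ swapℕ a b l → k ≡ l
swap-injective a b {k} {l} h = trans (sym (swap-involutive a b k)) (trans (cong (swapℕ a b) h) (swap-involutive a b l))

swap-< : ∀ {a b n} → a < n → b < n → ∀ {k} → k < n → swapℕ a b k < n
swap-< {a} {b} ha hb {k} hk with swapView a b k
... | is-left _ q = subst (_< _) (sym q) hb
... | is-right _ q = subst (_< _) (sym q) ha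
... | is-other _ _ q = subst (_< _) (sym q) hk

swap-sym : ∀ a b k → swapℕ a b k ≡ swapℕ b a k
swap-sym a b k with swapView a b k
... | is-left refl q = trans q (sym (swap-right b a))
... | is-right refl q = trans q (sym (swap-left b a))
... | is-other h h' q = trans q (sym (swap-other h' h))

swap-conj : ∀ {h : ℕ → ℕ} → (∀ {x y} → h x ≡ h y → x ≡ y) → ∀ a b k → h (swapℕ a b k) ≡ swapℕ (h a) (h b) (h k)
swap-conj {h} inj a b k with swapView a b k
... | is-left refl q = trans (cong h q) (sym (swap-left (h a) (h b)))
... | is-right refl q = trans (cong h q) (sym (swap-right (h a) (h b)))
... | is-other p p' q = trans (cong h q) (sym (swap-other (λ e → p (inj e)) (λ e → p' (inj e))))

-- Permutations of [n] as total functions, so that later statements carry no bounds.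
record Perm (n : ℕ) : Set where
  field
    to from : ℕ → ℕ
    to-from : ∀ k → to (from k) ≡ k
    from-to : ∀ k → from (to k) ≡ k
    fixes : ∀ k → n ≤ k → to k ≡ k

  injective : ∀ {x y} → to x ≡ to y → x ≡ y
  injective {x} {y} h = trans (sym (from-to x)) (trans (cong from h) (from-to y))

  bounded : ∀ {k} → k < n → to k < n
  bounded {k} h with to k <? n
  ... | yes p = p
  ... | no p = ⊥-elim (<⇒≱ h (subst (n ≤_) (injective (fixes (to k) (≮⇒≥ p))) (≮⇒≥ p)))

open Perm public

inverse : ∀ {n} → Perm n → Perm n
inverse P = record
  { to = from P ; from = to P ; to-from = from-to P ; from-to = to-from P
  ; fixes = λ k h → trans (cong (from P) (sym (fixes P k h))) (from-to P k) }

identity : ∀ n → Perm n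
identity n = record
  { to = λ k → k ; from = λ k → k ; to-from = λ _ → refl ; from-to = λ _ → refl ; fixes = λ _ _ → refl }

swap-fixes : ∀ {a b n} → a < n → b < n → ∀ k → n ≤ k → swapℕ a b k ≡ k
swap-fixes ha hb k h = swap-other (λ e → <⇒≱ ha (subst (_ ≤_) e h)) (λ e → <⇒≱ hb (subst (_ ≤_) e h))

mulʳ : ∀ {n} → Perm n → ∀ a b → a < n → b < n → Perm n
mulʳ P a b ha hb = record
  { to = λ k → to P (swapℕ a b k) ; from = λ k → swapℕ a b (from P k)
  ; to-from = λ k → trans (cong (to P) (swap-involutive a b _)) (to-from P k)
  ; from-to = λ k → trans (cong (swapℕ a b) (from-to P _)) (swap-involutive a b k)
  ; fixes = λ k h → trans (cong (to P) (swap-fixes ha hb k h)) (fixes P k h) }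

mulˡ : ∀ {n} → Perm n → ∀ a b → a < n → b < n → Perm n
mulˡ P a b ha hb = inverse (mulʳ (inverse P) a b ha hb)

bit : Bool → ℕ
bit true = 1
bit false = 0

rank : (ℕ → ℕ) → ℕ → ℕ → ℕ
rank f zero q = 0
rank f (suc p) q = rank f p q + bit (f p <ᵇ q)

rank-cong : ∀ {f g : ℕ → ℕ} p q → (∀ v → v < p → f v ≡ g v) → rank f p q ≡ rank g p q
rank-cong zero q h = refl
rank-cong (suc p) q h = cong₂ _+_ (rank-cong p q λ v l → h v (<-trans l ≤-refl)) (cong (λ x → bit (x <ᵇ q)) (h p ≤-refl))

bit-suc : ∀ x q → x ≢ q → bit (x <ᵇ suc q) ≡ bit (x <ᵇ q)
bit-suc x q ne with x <? q
... | yes h = cong bit (trans (<ᵇ-true (<-trans h ≤-refl)) (sym (<ᵇ-true h)))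
... | no h = cong bit (trans (<ᵇ-false λ k → h (≤∧≢⇒< (≤-pred k) ne)) (sym (<ᵇ-false h)))

module _ {n : ℕ} (P : Perm n) where

  rank-column : ∀ p q → rank (to P) p (suc q) ≡ rank (to P) p q + bit (from P q <ᵇ p)
  rank-column zero q = refl
  rank-column (suc p) q = trans (cong (_+ bit (to P p <ᵇ suc q)) (rank-column p q))
    (trans (+-assoc R _ _) (trans (cong (R +_) bits) (sym (+-assoc R _ _))))
    where
    R = rank (to P) p q
    bits : bit (from P q <ᵇ p) + bit (to P p <ᵇ suc q) ≡ bit (to P p <ᵇ q) + bit (from P q <ᵇ suc p)
    bits with to P p ≟ q
    ... | yes refl rewrite from-to P p = cong₂ (λ x y → bit x + bit y)
            (trans (<ᵇ-false (<-irrefl {p} refl)) (sym (<ᵇ-false (<-irrefl {to P p} refl))))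
            (trans (<ᵇ-true {to P p} ≤-refl) (sym (<ᵇ-true {p} ≤-refl)))
    ... | no ne = trans (cong₂ _+_ (sym (bit-suc (from P q) p λ e → ne (trans (cong (to P) (sym e)) (to-from P q)))) (bit-suc (to P p) q ne)) (+-comm (bit (from P q <ᵇ suc p)) _)

  -- Inverting a permutation transposes its rank matrix. Hence the Bruhat order is invariant under
  -- inversion, and left steps need no theory of their own.
  rank-inverse : ∀ p q → rank (to P) p q ≡ rank (from P) q p
  rank-inverse p zero = zeros p
    where
    zeros : ∀ p → rank (to P) p 0 ≡ 0
    zeros zero = refl
    zeros (suc p) rewrite zeros p = refl
  rank-inverse p (suc q) = trans (rank-column p q) (cong (_+ bit (from P q <ᵇ p)) (rank-inverse p q))

infix 4 _⊑_
-- The Bruhat order by its rank matrix criterion. In this form a right step affects a single row,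
-- which makes the lifting property a statement about that row.
record _⊑_ {n} (V W : Perm n) : Set where
  constructor below
  field rank-≥ : ∀ p q → rank (to W) p q ≤ rank (to V) p q
open _⊑_ public

⊑-refl : ∀ {n} {V : Perm n} → V ⊑ V
⊑-refl = below λ _ _ → ≤-refl

⊑-trans : ∀ {n} {U V W : Perm n} → U ⊑ V → V ⊑ W → U ⊑ W
⊑-trans h k = below λ p q → ≤-trans (rank-≥ k p q) (rank-≥ h p q)

⊑-inverse : ∀ {n} {V W : Perm n} → V ⊑ W → inverse V ⊑ inverse W
⊑-inverse {V = V} {W} h = below λ p q →
  subst₂ _≤_ (rank-inverse W q p) (rank-inverse V q p) (rank-≥ h q p)

⊑-≗ : ∀ {n} {V W : Perm n} → (∀ k → to V k ≡ to W k) → V ⊑ W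
⊑-≗ e = below λ p q → ≤-reflexive (rank-cong p q λ v _ → sym (e v))

Ascent Descent : ∀ {n} → Perm n → ℕ → Set
Ascent P i = to P i < to P (suc i)
Descent P i = to P (suc i) < to P i

ascent⊎descent : ∀ {n} (P : Perm n) i → Ascent P i ⊎ Descent P i
ascent⊎descent P i with <-cmp (to P i) (to P (suc i))
... | tri< h _ _ = inj₁ h
... | tri≈ _ h _ = ⊥-elim (1+n≢n (sym (injective P h)))
... | tri> _ _ h = inj₂ h

-- Row `suc i` is left out because it is the only one that a right step at `i` changes.
AgreeOff : ∀ {n} → ℕ → Perm n → Perm n → Set
AgreeOff i V W = ∀ p q → p ≢ suc i → rank (to W) p q ≤ rank (to V) p q

bit-mono : ∀ {x y q} → x < y → bit (y <ᵇ q) ≤ bit (x <ᵇ q)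
bit-mono {x} {y} {q} h with y <? q
... | yes k rewrite <ᵇ-true k | <ᵇ-true (<-trans h k) = ≤-refl
... | no k rewrite <ᵇ-false k = z≤n

bit≤1 : ∀ b → bit b ≤ 1
bit≤1 true = ≤-refl
bit≤1 false = z≤n

-- Row i + 1 of the rank matrix is the largest one compatible with rows i and
-- i + 2 at an ascent, and the smallest at a descent.
maximal-row : ∀ a x y k → y ≤ x → x ≤ 1 → k ≤ suc a → k ≤ a + x + y → k ≤ a + x
maximal-row a zero zero k h l p q = subst (k ≤_) (+-identityʳ _) q
maximal-row a (suc zero) y k h l p q = subst (k ≤_) (+-comm 1 a) p
maximal-row a (suc (suc x)) y k h (s≤s ()) p q

minimal-row : ∀ a x y k → x ≤ y → y ≤ 1 → a ≤ k → a + x + y ≤ suc k → a + x ≤ k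
minimal-row a zero y k h l p q = subst (_≤ k) (sym (+-identityʳ a)) p
minimal-row a (suc x) (suc zero) k h l p q = ≤-pred (subst (_≤ suc k) (+-comm (a + suc x) 1) q)
minimal-row a (suc x) (suc (suc y)) k h (s≤s ()) p q

⊑-ascents : ∀ {n} (V W : Perm n) i → Ascent V i → AgreeOff i V W → V ⊑ W
⊑-ascents V W i h agree = below go
  where
  go : ∀ p q → rank (to W) p q ≤ rank (to V) p q
  go p q with p ≟ suc i
  ... | no ne = agree p q ne
  ... | yes refl = maximal-row (rank (to V) i q) _ _ _ (bit-mono {q = q} h) (bit≤1 _)
    (≤-trans (+-mono-≤ (agree i q λ ()) (bit≤1 _)) (≤-reflexive (+-comm _ 1)))
    (≤-trans (m≤m+n _ _) (agree (suc (suc i)) q λ ()))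

⊑-descents : ∀ {n} (V W : Perm n) i → Descent W i → AgreeOff i V W → V ⊑ W
⊑-descents V W i h agree = below go
  where
  go : ∀ p q → rank (to W) p q ≤ rank (to V) p q
  go p q with p ≟ suc i
  ... | no ne = agree p q ne
  ... | yes refl = minimal-row (rank (to W) i q) _ _ _ (bit-mono {q = q} h) (bit≤1 _)
    (≤-trans (agree i q λ ()) (m≤m+n _ _))
    (≤-trans (agree (suc (suc i)) q λ ()) (≤-trans (+-monoʳ-≤ _ (bit≤1 _)) (≤-reflexive (+-comm _ 1))))

module _ {n : ℕ} (P : Perm n) (i : ℕ) (hi : i < n) (hj : suc i < n) where

  stepʳ : Perm n
  stepʳ = mulʳ P i (suc i) hi hj

  stepˡ : Perm n
  stepˡ = mulˡ P i (suc i) hi hj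

  to-stepʳ-left : to stepʳ i ≡ to P (suc i)
  to-stepʳ-left = cong (to P) (swap-left i (suc i))

  to-stepʳ-right : to stepʳ (suc i) ≡ to P i
  to-stepʳ-right = cong (to P) (swap-right i (suc i))

  stepʳ-ascent : Descent P i → Ascent stepʳ i
  stepʳ-ascent = subst₂ _<_ (sym to-stepʳ-left) (sym to-stepʳ-right)

  stepʳ-descent : Ascent P i → Descent stepʳ i
  stepʳ-descent = subst₂ _<_ (sym to-stepʳ-right) (sym to-stepʳ-left)

  rank-stepʳ : ∀ p q → p ≢ suc i → rank (to stepʳ) p q ≡ rank (to P) p q
  rank-stepʳ zero q ne = refl
  rank-stepʳ (suc p) q ne with p ≟ suc i
  ... | yes refl = begin
      rank (to stepʳ) i q + b (to stepʳ i) + b (to stepʳ (suc i))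
        ≡⟨ cong₂ (λ x y → rank (to stepʳ) i q + b x + b y) to-stepʳ-left to-stepʳ-right ⟩
      rank (to stepʳ) i q + b (to P (suc i)) + b (to P i)
        ≡⟨ cong (λ x → x + b (to P (suc i)) + b (to P i)) (rank-cong i q λ v l → cong (to P) (swap-other (<⇒≢ l) (<⇒≢ (<-trans l ≤-refl)))) ⟩
      rank (to P) i q + b (to P (suc i)) + b (to P i)
        ≡⟨ +-assoc (rank (to P) i q) _ _ ⟩
      rank (to P) i q + (b (to P (suc i)) + b (to P i))
        ≡⟨ cong (rank (to P) i q +_) (+-comm (b (to P (suc i))) _) ⟩
      rank (to P) i q + (b (to P i) + b (to P (suc i)))
        ≡⟨ +-assoc (rank (to P) i q) _ _ ⟨
      rank (to P) i q + b (to P i) + b (to P (suc i)) ∎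
    where
    open ≡-Reasoning
    b : ℕ → ℕ
    b x = bit (x <ᵇ q)
  ... | no ne' = cong₂ _+_ (rank-stepʳ p q ne') (cong (λ x → bit (to P x <ᵇ q)) (swap-other (λ e → ne (cong suc e)) ne'))

  stepʳ-stepʳ : ∀ k → to (mulʳ stepʳ i (suc i) hi hj) k ≡ to P k
  stepʳ-stepʳ k = cong (to P) (swap-involutive i (suc i) k)

module _ {n : ℕ} {V W : Perm n} (i : ℕ) (hi : i < n) (hj : suc i < n) (V⊑W : V ⊑ W) where

  private
    Vs Ws : Perm n
    Vs = stepʳ V i hi hj
    Ws = stepʳ W i hi hj
    off : ∀ {A B : Perm n} → (∀ p q → p ≢ suc i → rank (to A) p q ≡ rank (to V) p q) →
      (∀ p q → p ≢ suc i → rank (to B) p q ≡ rank (to W) p q) → AgreeOff i A B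
    off h k p q ne = subst₂ _≤_ (sym (k p q ne)) (sym (h p q ne)) (rank-≥ V⊑W p q)

  -- This and the next three are the forms of the lifting property. The other rows compare as
  -- before, and row `suc i` is settled by an ascent of the smaller or a descent of the larger
  -- permutation.
  lower-both : Descent V i → Vs ⊑ Ws
  lower-both h = ⊑-ascents Vs Ws i (stepʳ-ascent V i hi hj h) (off {Vs} {Ws} (rank-stepʳ V i hi hj) (rank-stepʳ W i hi hj))

  lower-right : Ascent V i → V ⊑ Ws
  lower-right h = ⊑-ascents V Ws i h (off {V} {Ws} (λ _ _ _ → refl) (rank-stepʳ W i hi hj))

  raise-both : Ascent W i → Vs ⊑ Ws
  raise-both h = ⊑-descents Vs Ws i (stepʳ-descent W i hi hj h) (off {Vs} {Ws} (rank-stepʳ V i hi hj) (rank-stepʳ W i hi hj))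

  raise-left : Descent W i → Vs ⊑ W
  raise-left h = ⊑-descents Vs W i h (off {Vs} {W} (rank-stepʳ V i hi hj) (λ _ _ _ → refl))

⊑-raise : ∀ {n} (V : Perm n) i hi hj → Ascent V i → V ⊑ stepʳ V i hi hj
⊑-raise V i hi hj h = ⊑-ascents V (stepʳ V i hi hj) i h λ p q ne → ≤-reflexive (rank-stepʳ V i hi hj p q ne)

≤id⇒≡id : ∀ {n} (P : Perm n) → (∀ k → to P k ≤ k) → ∀ k → to P k ≡ k
≤id⇒≡id P h = <-rec _ λ k ih → case k ih (m≤n⇒m<n∨m≡n (h k))
  where
  case : ∀ k → (∀ {l} → l < k → to P l ≡ l) → to P k < k ⊎ to P k ≡ k → to P k ≡ k
  case k ih (inj₁ l) = injective P (ih l)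
  case k ih (inj₂ e) = e

≥id⇒≡id : ∀ {n} (P : Perm n) → (∀ k → k ≤ to P k) → ∀ k → to P k ≡ k
≥id⇒≡id P h k = trans (cong (to P) (sym (≤id⇒≡id (inverse P) (λ l → subst (from P l ≤_) (to-from P l) (h (from P l))) k))) (to-from P k)

rank≤ : ∀ f p q → rank f p q ≤ p
rank≤ f zero q = z≤n
rank≤ f (suc p) q = ≤-trans (+-mono-≤ (rank≤ f p q) (bit≤1 _)) (≤-reflexive (+-comm p 1))

rank-full : ∀ f p q → p ≤ rank f p q → ∀ v → v < p → f v < q
rank-full f (suc p) q h v l with f p <? q
... | no k rewrite <ᵇ-false k = ⊥-elim (<⇒≱ h (≤-trans (≤-reflexive (+-identityʳ _)) (rank≤ f p q)))
... | yes k with m≤n⇒m<n∨m≡n (≤-pred l)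
...   | inj₂ refl = k
...   | inj₁ l' rewrite <ᵇ-true k = rank-full f p q (≤-pred (≤-trans h (≤-reflexive (+-comm _ 1)))) v l'

rank-id : ∀ p q → p ≤ q → rank (λ k → k) p q ≡ p
rank-id zero q h = refl
rank-id (suc p) q h rewrite <ᵇ-true h = trans (+-comm _ 1) (cong suc (rank-id p q (≤-trans (n≤1+n p) h)))

⊑id⇒≡id : ∀ {n} (V W : Perm n) → (∀ k → to W k ≡ k) → V ⊑ W → ∀ k → to V k ≡ k
⊑id⇒≡id V W e h = ≤id⇒≡id V λ k → ≤-pred (rank-full (to V) (suc k) (suc k)
  (subst (_≤ rank (to V) (suc k) (suc k)) (trans (rank-cong (suc k) (suc k) λ v _ → e v) (rank-id (suc k) (suc k) ≤-refl)) (rank-≥ h (suc k) (suc k))) k ≤-refl)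

-- As long as no descent occurs, `k ≤ to P k` propagates upwards, and a permutation that satisfies
-- this everywhere is the identity.
descent⊎identity : ∀ {n} (P : Perm n) → (Σ ℕ λ i → suc i < n × Descent P i) ⊎ (∀ k → to P k ≡ k)
descent⊎identity {n} P = finish (search n ≤-refl)
  where
  Found : Set
  Found = Σ ℕ λ i → suc i < n × Descent P i
  search : ∀ m → m ≤ n → Found ⊎ (∀ k → k < m → k ≤ to P k)
  search zero h = inj₂ λ k ()
  search (suc zero) h = inj₂ λ { zero _ → z≤n ; (suc k) (s≤s ()) }
  search (suc (suc m)) h with search (suc m) (≤-trans (n≤1+n _) h) | ascent⊎descent P m
  ... | inj₁ x | _ = inj₁ x
  ... | inj₂ f | inj₂ d = inj₁ (m , h , d)
  ... | inj₂ f | inj₁ a = inj₂ λ k l → ext k (m≤n⇒m<n∨m≡n (≤-pred l))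
    where
    ext : ∀ k → k < suc m ⊎ k ≡ suc m → k ≤ to P k
    ext k (inj₁ l) = f k l
    ext .(suc m) (inj₂ refl) = ≤-trans (s≤s (f m ≤-refl)) a
  finish : Found ⊎ (∀ k → k < n → k ≤ to P k) → Found ⊎ (∀ k → to P k ≡ k)
  finish (inj₁ x) = inj₁ x
  finish (inj₂ f) = inj₂ (≥id⇒≡id P λ k → case k)
    where
    case : ∀ k → k ≤ to P k
    case k with k <? n
    ... | yes l = f k l
    ... | no l = ≤-reflexive (sym (fixes P k (≮⇒≥ l)))

-- Atoms

adjacent-< : ∀ i {x y} → swapℕ i (suc i) x < swapℕ i (suc i) y → x < y ⊎ (x ≡ suc i × y ≡ i)
adjacent-< i {x} {y} h with swapView i (suc i) x | swapView i (suc i) y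
... | is-left refl p | is-left refl q = inj₁ (⊥-elim (<-irrefl refl h))
... | is-left refl p | is-right refl q = inj₁ ≤-refl
... | is-left refl p | is-other _ _ q = inj₁ (<-trans ≤-refl (subst₂ _<_ p q h))
... | is-right refl p | is-left refl q = inj₂ (refl , refl)
... | is-right refl p | is-right refl q = inj₁ (⊥-elim (<-irrefl refl h))
... | is-right refl p | is-other _ ne q = inj₁ (≤∧≢⇒< (subst₂ _<_ p q h) (λ e → ne (sym e)))
... | is-other ne _ p | is-left refl q = inj₁ (≤∧≢⇒< (≤-pred (subst₂ _<_ p q h)) ne)
... | is-other _ _ p | is-right refl q = inj₁ (<-trans (subst₂ _<_ p q h) ≤-refl)
... | is-other _ _ p | is-other _ _ q = inj₁ (subst₂ _<_ p q h)

-- A word with prefix e ∘_μ w = π is recognised on the inverse of w, whose entry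
-- of value v sits at position f v.  With z the involution of values attached to
-- π: 2-cycles appear as descents with no intermediate value between them, and
-- two non-nested cycles in a block occur in the order of their minima.
record Atom {n : ℕ} (blk : ℕ → ℕ) (P : Perm n) (z : ℕ → ℕ) : Set where
  field
    invol : ∀ v → z (z v) ≡ v
    outside : ∀ v → n ≤ v → z v ≡ v
    colour : ∀ v → blk (to P (z v)) ≡ blk (to P v)
    desc : ∀ v → v < z v → to P (z v) < to P v
    mono : ∀ x y → blk (to P x) ≡ blk (to P y) → x < y → z x < z y → to P x < to P (z y)
    gap : ∀ u x → u < x → x < z u → to P x < to P (z u) ⊎ to P u < to P x

  z-injective : ∀ {x y} → z x ≡ z y → x ≡ y
  z-injective {x} {y} h = trans (sym (invol x)) (trans (cong z h) (invol y))

  z-bounded : ∀ {v} → v < n → z v < n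
  z-bounded {v} h with z v <? n
  ... | yes p = p
  ... | no p = ⊥-elim (p (subst (_< n) (trans (sym (invol v)) (outside (z v) (≮⇒≥ p))) h))

open Atom public

Atom-cong : ∀ {n : ℕ} {blk} {P Q : Perm n} {z z'} → (∀ k → to P k ≡ to Q k) → (∀ k → z k ≡ z' k) → Atom blk P z → Atom blk Q z'
Atom-cong {blk = blk} {P} {Q} {z} {z'} e e' A = record
  { invol = λ v → trans (cong z' (sym (e' v))) (trans (sym (e' (z v))) (invol A v))
  ; outside = λ v h → trans (sym (e' v)) (outside A v h)
  ; colour = λ v → trans (cong blk (f-z v)) (trans (colour A v) (cong blk (e v)))
  ; desc = λ v h → subst₂ _<_ (sym (f-z v)) (e v) (desc A v (subst (v <_) (sym (e' v)) h))
  ; mono = λ x y s h k → subst₂ _<_ (e x) (sym (f-z y))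
      (mono A x y (trans (cong blk (e x)) (trans s (cong blk (sym (e y))))) h (subst₂ _<_ (sym (e' x)) (sym (e' y)) k))
  ; gap = λ u x h k → Data.Sum.map (subst₂ _<_ (e x) (sym (f-z u))) (subst₂ _<_ (e u) (e x))
      (gap A u x h (subst (x <_) (sym (e' u)) k)) }
  where
  f-z : ∀ v → to Q (z' v) ≡ to P (z v)
  f-z v = trans (cong (to Q) (sym (e' v))) (sym (e (z v)))

-- Stated for arbitrary total orders so that it can be used with both orders
-- reversed.
module Directed (_≺_ _⊏_ : ℕ → ℕ → Set)
  (≺-order : IsStrictTotalOrder _≡_ _≺_) (⊏-order : IsStrictTotalOrder _≡_ _⊏_) where

  open IsStrictTotalOrder ≺-order using () renaming (compare to ≺-cmp; irrefl to ≺-irrefl; asym to ≺-asym)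
  open IsStrictTotalOrder ⊏-order using () renaming (irrefl to ⊏-irrefl; asym to ⊏-asym; trans to ⊏-trans)

  record Facts (blk f z : ℕ → ℕ) : Set where
    field
      z-z : ∀ v → z (z v) ≡ v
      f-injective : ∀ {x y} → f x ≡ f y → x ≡ y
      col : ∀ v → blk (f (z v)) ≡ blk (f v)
      ≺-desc : ∀ v → v ≺ z v → f (z v) ⊏ f v
      ≺-mono : ∀ x y → blk (f x) ≡ blk (f y) → x ≺ y → z x ≺ z y → f x ⊏ f (z y)
      ≺-gap : ∀ u x → u ≺ x → x ≺ z u → f x ⊏ f (z u) ⊎ f u ⊏ f x

    z-inj : ∀ {x y} → z x ≡ z y → x ≡ y
    z-inj {x} {y} h = trans (sym (z-z x)) (trans (cong z h) (z-z y))

    -- `≺-mono` compares `x` with the far end `z y`. If `y` is the smaller end of its cycle,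
    -- `≺-desc` finishes. Otherwise `≺-mono` is used after `y`, and if necessary `x`, has been
    -- replaced by its partner.
    ≺-mono′ : ∀ x y → blk (f x) ≡ blk (f y) → x ≺ y → z x ≺ z y → f x ⊏ f y
    ≺-mono′ x y s h k with ≺-cmp y (z y)
    ... | tri< l _ _ = ⊏-trans (≺-mono x y s h k) (≺-desc y l)
    ... | tri≈ _ e _ = subst (λ v → f x ⊏ f v) (sym e) (≺-mono x y s h k)
    ... | tri> _ _ l with ≺-cmp x (z x)
    ...   | tri< m _ _ = subst (λ v → f x ⊏ f v) (z-z y)
            (≺-mono x (z y) (trans s (sym (col y))) (≺-trans m k) (subst (z x ≺_) (sym (z-z y)) (≺-trans k l)))
            where open IsStrictTotalOrder ≺-order using () renaming (trans to ≺-trans)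
    ...   | tri≈ _ e _ = subst₂ (λ u v → f u ⊏ f v) (sym e) (z-z y)
            (≺-mono (z x) (z y) (trans (col x) (trans s (sym (col y)))) k (subst₂ _≺_ (sym (z-z x)) (sym (z-z y)) h))
    ...   | tri> _ _ m = ⊏-trans (subst (λ v → f v ⊏ f (z x)) (z-z x) (≺-desc (z x) (subst (z x ≺_) (sym (z-z x)) m)))
            (subst (λ v → f (z x) ⊏ f v) (z-z y)
            (≺-mono (z x) (z y) (trans (col x) (trans s (sym (col y)))) k (subst₂ _≺_ (sym (z-z x)) (sym (z-z y)) h)))

    -- If the cycles were not nested, monotonicity would put `x` before `v`. So `v` lies inside the
    -- cycle of `x`, and since it precedes `x`, the gap condition moves it in front of the whole
    -- descending pair.
    nested-before : ∀ x v → blk (f v) ≡ blk (f x) → x ≺ v → x ≺ z v → v ≢ z x → f v ⊏ f x → v ≺ z x × f v ⊏ f (z x)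
    nested-before x v s h k ne l with ≺-cmp (z x) (z v)
    ... | tri< m _ _ = ⊥-elim (⊏-asym l (≺-mono′ x v (sym s) h m))
    ... | tri≈ _ e _ = ⊥-elim (≺-irrefl (z-inj e) h)
    ... | tri> _ _ m with ≺-cmp v (z x)
    ...   | tri≈ _ e _ = ⊥-elim (ne e)
    ...   | tri> _ _ o = ⊥-elim (⊏-asym l (subst (λ w → f x ⊏ f w) (z-z v)
            (≺-mono x (z v) (trans (sym s) (sym (col v))) k (subst (z x ≺_) (sym (z-z v)) o))))
    ...   | tri< o _ _ with ≺-gap x v h o
    ...     | inj₁ p = o , p
    ...     | inj₂ p = ⊥-elim (⊏-asym l p)

  -- `t` is the identity when two involutions of one permutation are compared, and the transposition
  -- of a swap when an atom is compared with its neighbour.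
  module Compare {blk f z z' t : ℕ → ℕ} (F : Facts blk f z) (F' : Facts blk (λ v → f (t v)) z')
    (t-t : ∀ v → t (t v) ≡ v) (t-block : ∀ v → blk (f (t v)) ≡ blk (f v)) where

    private
      module F = Facts F
      module F' = Facts F'

    AgreeBelow : ℕ → Set
    AgreeBelow a = ∀ x → x ≺ a → z' x ≡ z x

    module _ {a : ℕ} (agree : AgreeBelow a) where

      below-z : ∀ {v} → z v ≺ a → z' v ≡ z v
      below-z {v} h = trans (cong z' (sym (trans (agree _ h) (F.z-z v)))) (F'.z-z (z v))

      below-z' : ∀ {v} → z' v ≺ a → z' v ≡ z v
      below-z' {v} h = trans (sym (F.z-z (z' v))) (cong z (trans (sym (agree _ h)) (F'.z-z v)))

      above-z' : ∀ {v} → ¬ (z v ≺ a) → z' v ≢ a → a ≺ z' v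
      above-z' {v} h ne with ≺-cmp a (z' v)
      ... | tri< l _ _ = l
      ... | tri≈ _ e _ = ⊥-elim (ne (sym e))
      ... | tri> _ _ l = ⊥-elim (h (subst (_≺ a) (below-z' l) l))

      above-z : ∀ {v} → ¬ (z' v ≺ a) → z v ≢ a → a ≺ z v
      above-z {v} h ne with ≺-cmp a (z v)
      ... | tri< l _ _ = l
      ... | tri≈ _ e _ = ⊥-elim (ne (sym e))
      ... | tri> _ _ l = ⊥-elim (h (subst (_≺ a) (sym (below-z l)) l))

    -- Two different partners of `x` would each be nested in the cycle formed with the other. By
    -- `nested-before` each of them would then precede the other in position. A partner below `x` is
    -- covered by the agreement there.
    agree-at : ∀ {x} → AgreeBelow x → (∀ y → y ≺ x → t y ≡ y × t (z y) ≡ z y) → t x ≡ x → t (z x) ≡ z x → z' x ≡ z x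
    agree-at {x} agree fix tx tzx with z' x ≟ z x
    ... | yes e = e
    ... | no ne with ≺-cmp x (z x) | ≺-cmp x (z' x)
    ...   | tri> _ _ h | _ = below-z agree h
    ...   | _ | tri> _ _ h = below-z' agree h
    ...   | tri≈ _ e _ | tri≈ _ e' _ = ⊥-elim (ne (trans (sym e') e))
    ...   | tri< h _ _ | tri≈ _ e' _ = ⊥-elim (≺-asym h (subst (z x ≺_) (sym e') (proj₁ (partner h))))
      where
      partner : x ≺ z x → z x ≺ z' x × f (t (z x)) ⊏ f (t (z' x))
      partner h = F'.nested-before x (z x) (trans (cong blk (cong f tzx)) (trans (F.col x) (cong blk (cong f (sym tx))))) h
        (above-z' agree (λ k → ≺-irrefl (F.z-z x) k) (λ e → ne (trans (cong z' (sym e)) (F'.z-z (z x)))))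
        (λ e → ne (sym e)) (subst₂ _⊏_ (cong f (sym tzx)) (cong f (sym tx)) (F.≺-desc x h))
    ...   | c | tri< h' _ _ = ⊥-elim (conclude c)
      where
      v : ℕ
      v = t (z' x)
      v≢x : v ≢ x
      v≢x e = ≺-irrefl (trans (sym tx) (trans (cong t (sym e)) (t-t (z' x)))) h'
      v≢zx : v ≢ z x
      v≢zx e = ne (trans (sym (t-t (z' x))) (trans (cong t e) tzx))
      fixed : t v ≡ v → v ≡ z' x
      fixed e = trans (sym e) (t-t (z' x))
      x≺v : x ≺ v
      x≺v with ≺-cmp x v
      ... | tri< l _ _ = l
      ... | tri≈ _ e _ = ⊥-elim (v≢x (sym e))
      ... | tri> _ _ l = ⊥-elim (≺-asym h' (subst (_≺ x) (fixed (proj₁ (fix v l))) l))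
      x≺zv : x ≺ z v
      x≺zv with ≺-cmp x (z v)
      ... | tri< l _ _ = l
      ... | tri≈ _ e _ = ⊥-elim (v≢zx (trans (sym (F.z-z v)) (cong z (sym e))))
      ... | tri> _ _ l = ⊥-elim (≺-irrefl (trans (sym (below-z agree l)) (trans (cong z' (fixed tv)) (F'.z-z x))) l)
        where
        tv : t v ≡ v
        tv = trans (cong t (sym (F.z-z v))) (trans (proj₂ (fix (z v) l)) (F.z-z v))
      fv⊏fx : f v ⊏ f x
      fv⊏fx = subst (f v ⊏_) (cong f tx) (F'.≺-desc x h')
      inner : v ≺ z x × f v ⊏ f (z x)
      inner = F.nested-before x v (trans (F'.col x) (cong blk (cong f tx))) x≺v x≺zv v≢zx fv⊏fx
      conclude : _ → ⊥
      conclude (tri≈ _ e _) = ≺-asym x≺v (subst (v ≺_) (sym e) (proj₁ inner))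
      conclude (tri> _ _ h) = ne (below-z agree h)
      conclude (tri< h _ _) = ⊏-asym (proj₂ inner) (subst (_⊏ f v) (cong f tzx) (proj₂ (F'.nested-before x (z x)
        (trans (cong blk (cong f tzx)) (trans (F.col x) (cong blk (cong f (sym tx))))) h
        (above-z' agree (λ k → ≺-irrefl (F.z-z x) k) (λ e → ne (trans (cong z' (sym e)) (F'.z-z (z x)))))
        (λ e → ne (sym e)) (subst₂ _⊏_ (cong f (sym tzx)) (cong f (sym tx)) (F.≺-desc x h)))))

    -- The swap would move the maximum z a of the cycle of a to the position of
    -- the nested value i, and no cycle of a is compatible with that.
    not-nested : ∀ {a i} → AgreeBelow a → a ≺ z a → a ≺ i → i ≺ z a → a ≺ z i → blk (f i) ≡ blk (f a) →
      t i ≡ z a → (∀ v → v ≢ i → v ≢ z a → t v ≡ v) → ¬ (f i ⊏ f (z a))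
    not-nested {a} {i} agree a≺b a≺i i≺b a≺zi s ti fix fi⊏fb = go (≺-cmp a (z' a))
      where
      b : ℕ
      b = z a
      tb : t b ≡ i
      tb = trans (cong t (sym ti)) (t-t i)
      i≢b : i ≢ b
      i≢b e = ⊏-irrefl (cong f e) fi⊏fb
      ta : t a ≡ a
      ta = fix a (λ e → ≺-irrefl e a≺i) (λ e → ≺-irrefl e a≺b)
      fb⊏fa : f b ⊏ f a
      fb⊏fa = F.≺-desc a a≺b
      s' : blk (f (t i)) ≡ blk (f (t a))
      s' = trans (cong blk (cong f ti)) (trans (F.col a) (cong blk (cong f (sym ta))))
      sb : blk (f (t b)) ≡ blk (f (t a))
      sb = trans (cong blk (cong f tb)) (trans s (cong blk (cong f (sym ta))))
      i-inner : z' a ≢ i → i ≺ z' a × f b ⊏ f (t (z' a))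
      i-inner ne with F'.nested-before a i s' a≺i
          (above-z' agree (λ k → ≺-asym k a≺zi) (λ e → ne (trans (cong z' (sym e)) (F'.z-z i))))
          (λ e → ne (sym e)) (subst₂ _⊏_ (cong f (sym ti)) (cong f (sym ta)) fb⊏fa)
      ... | p , q = p , subst (_⊏ f (t (z' a))) (cong f ti) q
      go : _ → ⊥
      go (tri> _ _ h) = ≺-asym a≺b (subst (_≺ a) (below-z' agree h) h)
      go (tri≈ _ e _) = ≺-asym a≺i (subst (i ≺_) (sym e) (proj₁ (i-inner λ e' → ≺-irrefl (trans e e') a≺i)))
      -- Either `a` is now paired with `i`, and `b` would have to lie below `i`; or its partner is
      -- an untouched value `y`, which `z` places before and `z'` after the position of `b`.
      go (tri< h _ _) with z' a ≟ i
      ... | yes e = ≺-asym (subst (b ≺_) e (proj₁ outer)) i≺b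
        where
        z'b≢a : z' b ≢ a
        z'b≢a e' = i≢b (trans (sym e) (trans (cong z' (sym e')) (F'.z-z b)))
        outer : b ≺ z' a × f (t b) ⊏ f (t (z' a))
        outer = F'.nested-before a b sb a≺b (above-z' agree (λ k → ≺-irrefl (F.z-z a) k) z'b≢a)
          (λ e' → i≢b (sym (trans e' e))) (subst₂ _⊏_ (cong f (sym tb)) (cong f (sym ta)) (⊏-trans fi⊏fb fb⊏fa))
      ... | no ne = ⊏-asym (proj₂ y-inner) fb⊏fy
        where
        y : ℕ
        y = z' a
        y≢b : y ≢ b
        y≢b e = ⊏-asym fi⊏fb (subst (f b ⊏_) (cong f (trans (cong t e) tb)) (proj₂ (i-inner ne)))
        ty : t y ≡ y
        ty = fix y ne y≢b
        fb⊏fy : f b ⊏ f y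
        fb⊏fy = subst (f b ⊏_) (cong f ty) (proj₂ (i-inner ne))
        y-inner : y ≺ b × f y ⊏ f b
        y-inner = F.nested-before a y (trans (cong blk (cong f (sym ty))) (trans (F'.col a) (cong blk (cong f ta)))) h
          (above-z agree (λ k → ≺-irrefl (F'.z-z a) k) (λ e → y≢b (trans (sym (F.z-z y)) (cong z e)))) y≢b
          (subst₂ _⊏_ (cong f ty) (cong f ta) (F'.≺-desc a h))

module Up = Directed _<_ _<_ <-isStrictTotalOrder <-isStrictTotalOrder
module Down = Directed _>_ _>_ (Flip.isStrictTotalOrder <-isStrictTotalOrder) (Flip.isStrictTotalOrder <-isStrictTotalOrder)

module _ {n : ℕ} {blk : ℕ → ℕ} {P : Perm n} {z : ℕ → ℕ} (A : Atom blk P z) where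

  upFacts : Up.Facts blk (to P) z
  upFacts = record { z-z = invol A ; f-injective = injective P ; col = colour A ; ≺-desc = desc A ; ≺-mono = mono A ; ≺-gap = gap A }

  downFacts : Down.Facts blk (to P) z
  downFacts = record
    { z-z = invol A ; f-injective = injective P ; col = colour A
    ; ≺-desc = λ v h → subst (λ w → to P w < to P (z v)) (invol A v) (desc A (z v) (subst (z v <_) (sym (invol A v)) h))
    ; ≺-mono = λ x y s h k → subst (λ w → to P (z y) < to P w) (invol A x)
        (mono A (z y) (z x) (trans (colour A y) (trans (sym s) (sym (colour A x)))) k
          (subst₂ _<_ (sym (invol A y)) (sym (invol A x)) h))
    ; ≺-gap = λ u x h k → Data.Sum.swap (Data.Sum.map (subst (λ w → to P x < to P w) (invol A u)) (λ l → l)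
        (gap A (z u) x k (subst (x <_) (sym (invol A u)) h))) }

  mono′ : ∀ x y → blk (to P x) ≡ blk (to P y) → x < y → z x < z y → to P x < to P y
  mono′ = Up.Facts.≺-mono′ upFacts

  -- With `t` the identity every value is untouched, so agreement propagates through all values by
  -- induction.
  atom-unique : ∀ {z'} → Atom blk P z' → ∀ x → z' x ≡ z x
  atom-unique {z'} A' = <-rec _ λ x ih → Up.Compare.agree-at upFacts facts' (λ _ → refl) (λ _ → refl)
    (λ y l → ih l) (λ _ _ → refl , refl) refl refl
    where
    facts' : Up.Facts blk (λ v → to P v) z'
    facts' = record { z-z = invol A' ; f-injective = injective P ; col = colour A' ; ≺-desc = desc A' ; ≺-mono = mono A' ; ≺-gap = gap A' }

bounded-above-rec : ∀ {n} {Q : ℕ → Set} → (∀ x → n ≤ x → Q x) → (∀ x → (∀ y → x < y → Q y) → Q x) → ∀ x → Q x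
bounded-above-rec {n} {Q} base step x = go (n ∸ x) x ≤-refl
  where
  go : ∀ m x → n ∸ x ≤ m → Q x
  go zero x h = base x (m∸n≡0⇒m≤n (n≤0⇒n≡0 h))
  go (suc m) x h with n ≤? x
  ... | yes l = base x l
  ... | no l = step x next
    where
    next : ∀ y → x < y → Q y
    next y k with n ≤? y
    ... | yes l' = base y l'
    ... | no l' = go m y (≤-pred (≤-trans (∸-monoʳ-< k (≰⇒≥ l')) h))

module _ {n : ℕ} {blk : ℕ → ℕ} {P : Perm n} {z z' : ℕ → ℕ} (A : Atom blk P z) {i j : ℕ} {hi : i < n} {hj : j < n}
  (A' : Atom blk (mulʳ P i j hi hj) z') (i<j : i < j) (s : blk (to P i) ≡ blk (to P j)) (fi<fj : to P i < to P j) where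

  private
    swap-block : ∀ v → blk (to P (swapℕ i j v)) ≡ blk (to P v)
    swap-block v with swapView i j v
    ... | is-left refl e = trans (cong (λ w → blk (to P w)) e) (sym s)
    ... | is-right refl e = trans (cong (λ w → blk (to P w)) e) s
    ... | is-other _ _ e = cong (λ w → blk (to P w)) e

    module CU = Up.Compare (upFacts A) (upFacts A') (swap-involutive i j) swap-block
    module CD = Down.Compare (downFacts A) (downFacts A') (swap-involutive i j) swap-block

  -- Here `j` is the larger end of a cycle around `i`. The swap touches neither the values below
  -- `z j` nor their partners, so both involutions agree there and `not-nested` applies at
  -- `a = z j`.
  cover-not-nested-max : z j < i → z j < z i → ⊥
  cover-not-nested-max h k = CU.not-nested {z j} {i} agree (subst (z j <_) (sym (invol A j)) (<-trans h i<j)) h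
    (subst (i <_) (sym (invol A j)) i<j) k (trans s (sym (colour A j)))
    (trans (swap-left i j) (sym (invol A j))) (λ v p q → swap-other p λ e → q (trans e (sym (invol A j))))
    (subst (λ w → to P i < to P w) (sym (invol A j)) fi<fj)
    where
    untouched : ∀ x → x < z j → swapℕ i j x ≡ x × swapℕ i j (z x) ≡ z x
    untouched x l = swap-other (<⇒≢ (<-trans l h)) (<⇒≢ (<-trans l (<-trans h i<j))) ,
      swap-other (λ e → <-asym k (subst (_< z j) (trans (sym (invol A x)) (cong z e)) l))
                 (λ e → <-irrefl (trans (sym (invol A x)) (cong z e)) l)
    agree : ∀ x → x < z j → z' x ≡ z x
    agree = <-rec _ λ x ih l → CU.agree-at (λ y m → ih m (<-trans m l)) (λ y m → untouched y (<-trans m l))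
      (proj₁ (untouched x l)) (proj₂ (untouched x l))

  -- The mirror image, with both orders reversed: now `i` is the smaller end of a cycle around `j`,
  -- and the induction runs down from `n`, beyond which both involutions are trivial.
  cover-not-nested-min : j < z i → z j < z i → ⊥
  cover-not-nested-min h k = CD.not-nested {z i} {j} agree (subst (_< z i) (sym (invol A i)) (<-trans i<j h)) h
    (subst (_< j) (sym (invol A i)) i<j) k (trans (sym s) (sym (colour A i)))
    (trans (swap-right i j) (sym (invol A i))) (λ v p q → swap-other (λ e → q (trans e (sym (invol A i)))) p)
    (subst (λ w → to P w < to P j) (sym (invol A i)) fi<fj)
    where
    untouched : ∀ x → z i < x → swapℕ i j x ≡ x × swapℕ i j (z x) ≡ z x
    untouched x l = swap-other (λ e → <-irrefl (sym e) (<-trans (<-trans i<j h) l)) (λ e → <-irrefl (sym e) (<-trans h l)) ,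
      swap-other (λ e → <-irrefl (sym (trans (sym (invol A x)) (cong z e))) l)
                 (λ e → <-asym k (subst (z i <_) (trans (sym (invol A x)) (cong z e)) l))
    agree : ∀ x → z i < x → z' x ≡ z x
    agree = bounded-above-rec {n} (λ x m _ → trans (outside A' x m) (sym (outside A x m)))
      λ x ih l → CD.agree-at (λ y m → ih y m (<-trans l m)) (λ y m → untouched y (<-trans l m))
      (proj₁ (untouched x l)) (proj₂ (untouched x l))

-- The 0-Hecke step by s_i on a coloured involution (c , z), when it moves it.
data Rise (c z : ℕ → ℕ) (i : ℕ) : (ℕ → ℕ) → Set where
  across : c i < c (suc i) → Rise c z i (λ v → swapℕ i (suc i) (z (swapℕ i (suc i) v)))
  conjugate : c i ≡ c (suc i) → z i < z (suc i) → ¬ (z i ≡ i × z (suc i) ≡ suc i) →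
    Rise c z i (λ v → swapℕ i (suc i) (z (swapℕ i (suc i) v)))
  couple : c i ≡ c (suc i) → z i ≡ i → z (suc i) ≡ suc i → Rise c z i (λ v → z (swapℕ i (suc i) v))

data Fall (c z : ℕ → ℕ) (i : ℕ) : Set where
  across : c (suc i) < c i → Fall c z i
  within : c i ≡ c (suc i) → z (suc i) < z i → Fall c z i

rise⊎fall : ∀ c z i → (∀ {x y} → z x ≡ z y → x ≡ y) → (∃ λ z' → Rise c z i z') ⊎ Fall c z i
rise⊎fall c z i inj with <-cmp (c i) (c (suc i))
... | tri< h _ _ = inj₁ (_ , across h)
... | tri> _ _ h = inj₂ (across h)
... | tri≈ _ e _ with <-cmp (z i) (z (suc i))
...   | tri> _ _ h = inj₂ (within e h)
...   | tri≈ _ e' _ = ⊥-elim (1+n≢n (sym (inj e')))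
...   | tri< h _ _ with z i ≟ i | z (suc i) ≟ suc i
...     | yes p | yes q = inj₁ (_ , couple e p q)
...     | no p | _ = inj₁ (_ , conjugate e h λ k → p (proj₁ k))
...     | _ | no q = inj₁ (_ , conjugate e h λ k → q (proj₂ k))

-- Rel relates an element a with partner a' to an element b with partner b', at
-- the positions A, A', B, B'.
Rel : (a a' b b' A A' B B' : ℕ) → Set
Rel a a' b b' A A' B B' = (a < b → a' < b' → A < B') × (a < b → b < a' → B < A' ⊎ A < B)

relᶠ : (a a' b b' A A' B B' : ℕ) → Formula
relᶠ a a' b b' A A' B B' = (a <ᶠ b ⇒ᶠ a' <ᶠ b' ⇒ᶠ A <ᶠ B') ∧ᶠ (a <ᶠ b ⇒ᶠ b <ᶠ a' ⇒ᶠ B <ᶠ A' ∨ᶠ A <ᶠ B)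

Rels : (a a' b b' A A' B B' : ℕ) → Set
Rels a a' b b' A A' B B' = Rel a a' b b' A A' B B' × Rel b b' a a' B B' A A'

relsᶠ : (a a' b b' A A' B B' : ℕ) → Formula
relsᶠ a a' b b' A A' B B' = relᶠ a a' b b' A A' B B' ∧ᶠ relᶠ b b' a a' B B' A A'

-- `Rel` distinguishes an element from its partner, so the relation between two cycles consists of
-- all four choices of representatives.
Cycles : (a a' b b' A A' B B' : ℕ) → Set
Cycles a a' b b' A A' B B' = Rels a a' b b' A A' B B' × Rels a a' b' b A A' B' B × Rels a' a b b' A' A B B' × Rels a' a b' b A' A B' B

cyclesᶠ : (a a' b b' A A' B B' : ℕ) → Formula
cyclesᶠ a a' b b' A A' B B' = relsᶠ a a' b b' A A' B B' ∧ᶠ relsᶠ a a' b' b A A' B' B ∧ᶠ relsᶠ a' a b b' A' A B B' ∧ᶠ relsᶠ a' a b' b A' A B' B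

module _ {n : ℕ} {blk : ℕ → ℕ} {P : Perm n} {z : ℕ → ℕ} (A : Atom blk P z) where

  rel : ∀ {x y} → blk (to P x) ≡ blk (to P y) → Rel x (z x) y (z y) (to P x) (to P (z x)) (to P y) (to P (z y))
  rel {x} {y} s = mono A x y s , gap A x y

  cycles : ∀ {x x' y y'} → z x ≡ x' → z y ≡ y' → blk (to P x) ≡ blk (to P y) → Cycles x x' y y' (to P x) (to P x') (to P y) (to P y')
  cycles {x} {x'} {y} {y'} refl refl s = rels refl refl s , rels refl (invol A y) (trans s (sym (colour A y))) ,
    rels (invol A x) refl (trans (colour A x) s) , rels (invol A x) (invol A y) (trans (colour A x) (trans s (sym (colour A y))))
    where
    rels : ∀ {x x' y y'} → z x ≡ x' → z y ≡ y' → blk (to P x) ≡ blk (to P y) → Rels x x' y y' (to P x) (to P x') (to P y) (to P y')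
    rels refl refl s = rel s , rel (sym s)

-- Since the conditions of an atom compare two cycles at a time, a local change has to be checked
-- only for pairs of cycles that meet the touched values.
module _ {n : ℕ} {blk : ℕ → ℕ} (blk-mono : ∀ {x y} → x ≤ y → blk x ≤ blk y)
  {P : Perm n} {z : ℕ → ℕ} (A : Atom blk P z) (Q : Perm n) (z' : ℕ → ℕ)
  {Touched : ℕ → Set} (touched? : ∀ v → Dec (Touched v))
  (fixed-z : ∀ v → ¬ Touched v → z' v ≡ z v)
  (fixed-closed : ∀ v → ¬ Touched v → ¬ Touched (z v))
  (fixed-f : ∀ v → ¬ Touched v → to Q v ≡ to P v)
  (touched-bound : ∀ v → Touched v → v < n)
  (touched-z : ∀ v → Touched v → z' (z' v) ≡ v × Touched (z' v) × blk (to Q (z' v)) ≡ blk (to Q v))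
  (touched-desc : ∀ v → Touched v → v < z' v → to Q (z' v) < to Q v)
  (touched-rel : ∀ x y → Touched x → Touched y → blk (to Q x) ≡ blk (to Q y) →
    Rel x (z' x) y (z' y) (to Q x) (to Q (z' x)) (to Q y) (to Q (z' y)))
  (mixed-rels : ∀ x c → Touched x → ¬ Touched c → blk (to Q x) ≡ blk (to P c) →
    Rels x (z' x) c (z c) (to Q x) (to Q (z' x)) (to P c) (to P (z c))) where

  private
    f-z : ∀ v → ¬ Touched v → to Q (z' v) ≡ to P (z v)
    f-z v t = trans (cong (to Q) (fixed-z v t)) (fixed-f (z v) (fixed-closed v t))

    rel-same : ∀ x y → blk (to Q x) ≡ blk (to Q y) → Rel x (z' x) y (z' y) (to Q x) (to Q (z' x)) (to Q y) (to Q (z' y))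
    rel-same x y s with touched? x | touched? y
    ... | yes p | yes q = touched-rel x y p q s
    ... | yes p | no q rewrite fixed-f y q | f-z y q | fixed-z y q = proj₁ (mixed-rels x y p q s)
    ... | no p | yes q rewrite fixed-f x p | f-z x p | fixed-z x p = proj₂ (mixed-rels y x q p (sym s))
    ... | no p | no q rewrite fixed-f x p | f-z x p | fixed-z x p | fixed-f y q | f-z y q | fixed-z y q = rel A s

    colour' : ∀ v → blk (to Q (z' v)) ≡ blk (to Q v)
    colour' v with touched? v
    ... | yes t = proj₂ (proj₂ (touched-z v t))
    ... | no t = trans (cong blk (f-z v t)) (trans (colour A v) (cong blk (sym (fixed-f v t))))

    gap' : ∀ u x → u < x → x < z' u → to Q x < to Q (z' u) ⊎ to Q u < to Q x
    gap' u x h k with to Q x <? to Q (z' u) | to Q u <? to Q x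
    ... | yes l | _ = inj₁ l
    ... | _ | yes l = inj₂ l
    -- A value positioned between the two ends of a cycle lies in their block, because blocks are
    -- intervals of positions. So `gap` has content only inside a block.
    ... | no l | no m = proj₂ (rel-same u x (≤-antisym
            (subst (_≤ blk (to Q x)) (colour' u) (blk-mono (≮⇒≥ l))) (blk-mono (≮⇒≥ m)))) h k

  rebuild : Atom blk Q z'
  rebuild = record
    { invol = invol'
    ; outside = λ v h → out v h (touched? v)
    ; colour = colour'
    ; desc = desc'
    ; mono = λ x y s → proj₁ (rel-same x y s)
    ; gap = gap' }
    where
    invol' : ∀ v → z' (z' v) ≡ v
    invol' v with touched? v
    ... | yes t = proj₁ (touched-z v t)
    ... | no t = trans (cong z' (fixed-z v t)) (trans (fixed-z (z v) (fixed-closed v t)) (invol A v))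
    out : ∀ v → n ≤ v → Dec (Touched v) → z' v ≡ v
    out v h (yes t) = ⊥-elim (<⇒≱ (touched-bound v t) h)
    out v h (no t) = trans (fixed-z v t) (outside A v h)
    desc' : ∀ v → v < z' v → to Q (z' v) < to Q v
    desc' v h with touched? v
    ... | yes t = touched-desc v t h
    ... | no t = subst₂ _<_ (sym (f-z v t)) (sym (fixed-f v t)) (desc A v (subst (v <_) (fixed-z v t) h))

private
  -- 0 and 1 stand for `i` and `i + 1`, 2 and 3 for another cycle, 4 to 7 for the positions of 0 to
  -- 3 before the step. Adjacency enters only through the fact that 2 and 3 are not between 0 and 1.
  adjacentᶠ : Formula → Formula
  adjacentᶠ φ = 0 <ᶠ 1 ⇒ᶠ 2 <ᶠ 0 ∨ᶠ 1 <ᶠ 2 ⇒ᶠ 3 <ᶠ 0 ∨ᶠ 1 <ᶠ 3 ⇒ᶠ φ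

  coupleᶠ decoupleᶠ : Formula
  coupleᶠ = adjacentᶠ (cyclesᶠ 0 0 2 3 4 4 6 7 ⇒ᶠ cyclesᶠ 1 1 2 3 5 5 6 7 ⇒ᶠ
    relsᶠ 0 1 2 3 5 4 6 7 ∧ᶠ relsᶠ 1 0 2 3 4 5 6 7)
  decoupleᶠ = adjacentᶠ (cyclesᶠ 0 1 2 3 4 5 6 7 ⇒ᶠ 5 <ᶠ 4 ⇒ᶠ
    relsᶠ 0 0 2 3 5 5 6 7 ∧ᶠ relsᶠ 1 1 2 3 4 4 6 7)

  groups : List (List ℕ)
  groups = (0 ∷ 1 ∷ 2 ∷ 3 ∷ []) ∷ (4 ∷ 5 ∷ 6 ∷ 7 ∷ []) ∷ []

  couple-valid : Valid groups coupleᶠ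
  couple-valid = refl

  decouple-valid : Valid groups decoupleᶠ
  decouple-valid = refl

module Steps {n : ℕ} {blk : ℕ → ℕ} (blk-mono : ∀ {x y} → x ≤ y → blk x ≤ blk y)
  {P : Perm n} {z : ℕ → ℕ} (A : Atom blk P z) (i : ℕ) (hi : i < n) (hj : suc i < n) where

  private
    f : ℕ → ℕ
    f = to P
    c : ℕ → ℕ
    c v = blk (f v)
    j : ℕ
    j = suc i
    s : ℕ → ℕ
    s = swapℕ i j
    s-s : ∀ v → s (s v) ≡ v
    s-s = swap-involutive i j
    Q : Perm n
    Q = stepʳ P i hi hj

  blk-< : ∀ {x y} → c x < c y → f x < f y
  blk-< {x} {y} h with f x <? f y
  ... | yes l = l
  ... | no l = ⊥-elim (<⇒≱ h (blk-mono (≮⇒≥ l)))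

  private
    conj : ℕ → ℕ
    conj v = s (z (s v))

    f-conj : ∀ v → to Q (conj v) ≡ f (z (s v))
    f-conj v = cong f (s-s _)

    -- Conjugation by `s` changes the relative order of `i` and `j` only. Each hypothesis handles
    -- one way in which this pair, as values or as partners, can occur in a condition.
    conj-atom :
      (z i ≢ j) →
      (c i ≡ c j → z j < z i → f j < f (z i) × f (z j) < f i) →
      (j < z j → f i < f (z j) ⊎ f j < f i) →
      (z i < i → f j < f i ⊎ f (z i) < f j) →
      (c i ≡ c j → z i ≡ i → z j ≡ j → f j < f i) →
      Atom blk Q conj
    conj-atom ne swapped gap₁ gap₂ both = record
      { invol = λ v → trans (cong (λ w → s (z w)) (s-s _)) (trans (cong s (invol A (s v))) (s-s v))
      ; outside = λ v h → trans (cong (λ w → s (z w)) (swap-fixes hi hj v h))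
          (trans (cong s (outside A v h)) (swap-fixes hi hj v h))
      ; colour = λ v → trans (cong blk (f-conj v)) (colour A (s v))
      ; desc = desc'
      ; mono = λ x y e h k → subst (f (s x) <_) (sym (f-conj y)) (mono' x y e h k)
      ; gap = gap' }
      where
      unswap : ∀ {x y} → x < y → s x < s y ⊎ (s x ≡ j × s y ≡ i)
      unswap {x} {y} h = adjacent-< i (subst₂ _<_ (sym (s-s x)) (sym (s-s y)) h)
      z-of : ∀ {v w} → z v ≡ w → v ≡ z w
      z-of {v} e = trans (sym (invol A v)) (cong z e)
      desc' : ∀ v → v < conj v → to Q (conj v) < to Q v
      desc' v h with adjacent-< i (subst (_< conj v) (sym (s-s v)) h)
      ... | inj₁ l = subst (_< f (s v)) (sym (f-conj v)) (desc A (s v) l)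
      ... | inj₂ (p , q) = ⊥-elim (ne (trans (cong z (sym q)) (trans (invol A (s v)) p)))
      mono' : ∀ x y → c (s x) ≡ c (s y) → x < y → conj x < conj y → f (s x) < f (z (s y))
      mono' x y e h k with unswap h | adjacent-< i k
      ... | inj₁ a | inj₁ b = mono A (s x) (s y) e a b
      ... | inj₂ (p , q) | inj₁ b = subst₂ (λ u v → f u < f (z v)) (sym p) (sym q)
              (proj₁ (swapped (trans (cong c (sym q)) (trans (sym e) (cong c p))) (subst₂ (λ u v → z u < z v) p q b)))
      ... | inj₁ a | inj₂ (p , q) = subst₂ (λ u v → f u < f v) (sym (z-of p)) (sym q)
              (proj₂ (swapped (trans (sym (colour A i)) (trans (cong c (sym (z-of q))) (trans (sym e) (trans (cong c (z-of p)) (colour A j)))))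
                (subst₂ _<_ (z-of p) (z-of q) a)))
      ... | inj₂ (p , q) | inj₂ (p' , q') = subst₂ _<_ (cong f (sym p)) (cong f (sym q'))
              (both (trans (cong c (sym q)) (trans (sym e) (cong c p))) (trans (cong z (sym q)) q') (trans (cong z (sym p)) p'))
      gap' : ∀ u x → u < x → x < conj u → to Q x < to Q (conj u) ⊎ to Q u < to Q x
      gap' u x h k with unswap h | adjacent-< i (subst (_< conj u) (sym (s-s x)) k)
      ... | inj₁ a | inj₁ b = Data.Sum.map₁ (subst (f (s x) <_) (sym (f-conj u))) (gap A (s u) (s x) a b)
      ... | inj₂ (p , q) | inj₁ b = Data.Sum.map (subst₂ _<_ (cong f (sym q)) (sym (trans (f-conj u) (cong (λ w → f (z w)) p))))
              (subst₂ _<_ (cong f (sym p)) (cong f (sym q))) (gap₁ b'')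
        where
        b' : i < z j
        b' = subst₂ (λ u v → u < z v) q p b
        k' : j < s (z j)
        k' = subst₂ _<_ (trans (sym (s-s x)) (trans (cong s q) (swap-left i j))) (cong (λ w → s (z w)) p) k
        b'' : j < z j
        b'' = ≤∧≢⇒< b' λ e → <⇒≱ k' (≤-trans (≤-reflexive (trans (cong s (sym e)) (swap-right i j))) (n≤1+n i))
      ... | inj₁ a | inj₂ (p , q) = Data.Sum.map (subst₂ _<_ (cong f (sym p)) (sym (trans (f-conj u) (cong f q))))
              (subst₂ _<_ (cong f (sym (z-of q))) (cong f (sym p))) (gap₂ a')
        where
        a' : z i < i
        a' = ≤∧≢⇒< (subst (_≤ i) (z-of q) (≤-pred (subst (s u <_) p a))) λ e → <⇒≱ h
          (subst₂ _≤_ (trans (sym (swap-right i j)) (trans (cong s (sym p)) (s-s x)))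
            (trans (sym (swap-left i j)) (trans (cong s (trans (sym e) (sym (z-of q)))) (s-s u))) (n≤1+n i))
      ... | inj₂ (p , q) | inj₂ (p' , q') = ⊥-elim (1+n≢n (trans (sym p') q))

    ascent-within : c i ≡ c j → z i < z j → f i < f j
    ascent-within e h = mono′ A i j e ≤-refl h

    -- These are the inequalities that `mono` requires of the conjugated involution at the pair `i`,
    -- `j`, whose order is reversed.
    descent-nested : f j < f i → z i ≢ j → z j < z i → c i ≡ c j → f j < f (z i) × f (z j) < f i
    descent-nested d ne h e with <-cmp (z i) j
    ... | tri≈ _ p _ = ⊥-elim (ne p)
    ... | tri> _ _ p = low , high
      where
      low : f j < f (z i)
      low with gap A i j ≤-refl p
      ... | inj₁ q = q
      ... | inj₂ q = ⊥-elim (<-asym d q)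
      high : f (z j) < f i
      high with <-cmp (z j) j
      ... | tri≈ _ q _ = subst (λ w → f w < f i) (sym q) d
      ... | tri< q _ _ = <-trans (subst (λ w → f w < f (z i)) refl
              (mono A (z j) i (trans (colour A j) (sym e)) (≤∧≢⇒< (≤-pred q) λ r → ne (trans (cong z (sym r)) (invol A j)))
                (subst (_< z i) (sym (invol A j)) p))) (desc A i (<-trans ≤-refl p))
      ... | tri> _ _ q with gap A i (z j) (<-trans ≤-refl q) h
      ...   | inj₁ r = <-trans r (desc A i (<-trans ≤-refl p))
      ...   | inj₂ r = ⊥-elim (<-asym d (<-trans r (desc A j q)))
    ... | tri< p _ _ = low , high
      where
      zj<i : z j < i
      zj<i = <-≤-trans h (≤-pred p)
      high : f (z j) < f i
      high with gap A (z j) i zj<i (subst (i <_) (sym (invol A j)) ≤-refl)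
      ... | inj₁ q = ⊥-elim (<-asym d (subst (λ w → f i < f w) (invol A j) q))
      ... | inj₂ q = q
      fi≤ : f i ≤ f (z i)
      fi≤ with m≤n⇒m<n∨m≡n (≤-pred p)
      ... | inj₁ q = <⇒≤ (subst (λ w → f w < f (z i)) (invol A i) (desc A (z i) (subst (z i <_) (sym (invol A i)) q)))
      ... | inj₂ q = ≤-reflexive (cong f (sym q))
      low : f j < f (z i)
      low with gap A (z j) (z i) h (subst (z i <_) (sym (invol A j)) p)
      ... | inj₁ q = ⊥-elim (<-asym d (≤-<-trans fi≤ (subst (λ w → f (z i) < f w) (invol A j) q)))
      ... | inj₂ q = <-trans (subst (λ w → f w < f (z j)) (invol A j)
              (desc A (z j) (subst (z j <_) (sym (invol A j)) (<-trans zj<i ≤-refl)))) q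


  module _ (z' : ℕ → ℕ) (z'-fixed : ∀ v → v ≢ i → v ≢ j → z' v ≡ z v) where

    private
      Touched : ℕ → Set
      Touched v = v ≡ i ⊎ v ≡ j

      touched? : ∀ v → Dec (Touched v)
      touched? v with v ≟ i | v ≟ j
      ... | yes p | _ = yes (inj₁ p)
      ... | _ | yes q = yes (inj₂ q)
      ... | no p | no q = no λ { (inj₁ e) → p e ; (inj₂ e) → q e }

      Qi : to Q i ≡ f j
      Qi = to-stepʳ-left P i hi hj
      Qj : to Q j ≡ f i
      Qj = to-stepʳ-right P i hi hj

      away : ∀ {v} → ¬ Touched v → v < i ⊎ j < v
      away {v} t with <-cmp v i
      ... | tri< l _ _ = inj₁ l
      ... | tri≈ _ e _ = ⊥-elim (t (inj₁ e))
      ... | tri> _ _ l = inj₂ (≤∧≢⇒< l λ e → t (inj₂ (sym e)))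

      bound : ∀ v → Touched v → v < n
      bound v (inj₁ refl) = hi
      bound v (inj₂ refl) = hj

      z'-off : ∀ v → ¬ Touched v → z' v ≡ z v
      z'-off v t = z'-fixed v (λ e → t (inj₁ e)) (λ e → t (inj₂ e))

      f-off : ∀ v → ¬ Touched v → to Q v ≡ f v
      f-off v t = cong f (swap-other (λ e → t (inj₁ e)) (λ e → t (inj₂ e)))

    couple-atom : c i ≡ c j → z i ≡ i → z j ≡ j → z' i ≡ j → z' j ≡ i → f i < f j → Atom blk Q z'
    couple-atom e zi zj z'i z'j a = rebuild blk-mono A Q z' touched? z'-off closed f-off bound sym-z descends among mixed
      where
      closed : ∀ v → ¬ Touched v → ¬ Touched (z v)
      closed v t (inj₁ e) = t (inj₁ (z-injective A (trans e (sym zi))))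
      closed v t (inj₂ e) = t (inj₂ (z-injective A (trans e (sym zj))))
      sym-z : ∀ v → Touched v → z' (z' v) ≡ v × Touched (z' v) × blk (to Q (z' v)) ≡ blk (to Q v)
      sym-z v (inj₁ refl) rewrite z'i | Qi | Qj = z'j , inj₂ refl , e
      sym-z v (inj₂ refl) rewrite z'j | Qi | Qj = z'i , inj₁ refl , sym e
      descends : ∀ v → Touched v → v < z' v → to Q (z' v) < to Q v
      descends v (inj₁ refl) h rewrite z'i | Qi | Qj = a
      descends v (inj₂ refl) h rewrite z'j = ⊥-elim (<⇒≱ h (n≤1+n i))
      among : ∀ x y → Touched x → Touched y → blk (to Q x) ≡ blk (to Q y) →
        Rel x (z' x) y (z' y) (to Q x) (to Q (z' x)) (to Q y) (to Q (z' y))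
      among x y (inj₁ refl) (inj₁ refl) _ = (λ h → ⊥-elim (<-irrefl refl h)) , λ h → ⊥-elim (<-irrefl refl h)
      among x y (inj₂ refl) (inj₂ refl) _ = (λ h → ⊥-elim (<-irrefl refl h)) , λ h → ⊥-elim (<-irrefl refl h)
      among x y (inj₂ refl) (inj₁ refl) _ = (λ h → ⊥-elim (<⇒≱ h (n≤1+n i))) , λ h → ⊥-elim (<⇒≱ h (n≤1+n i))
      among x y (inj₁ refl) (inj₂ refl) _ rewrite z'i | z'j = (λ _ h → ⊥-elim (<⇒≱ h (n≤1+n i))) , λ _ h → ⊥-elim (<-irrefl refl h)
      solved : ∀ v → ¬ Touched v → c i ≡ c v → Rels i j v (z v) (f j) (f i) (f v) (f (z v)) × Rels j i v (z v) (f i) (f j) (f v) (f (z v))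
      solved v t s = by-order groups coupleᶠ couple-valid (env (i ∷ j ∷ v ∷ z v ∷ f i ∷ f j ∷ f v ∷ f (z v) ∷ []))
        ≤-refl (away t) (away (closed v t)) (cycles A zi refl s) (cycles A zj refl (trans (sym e) s))
      mixed : ∀ x v → Touched x → ¬ Touched v → blk (to Q x) ≡ c v → Rels x (z' x) v (z v) (to Q x) (to Q (z' x)) (f v) (f (z v))
      mixed x v (inj₁ refl) t s rewrite z'i | Qi | Qj = proj₁ (solved v t (trans e s))
      mixed x v (inj₂ refl) t s rewrite z'j | Qi | Qj = proj₂ (solved v t s)

    decouple-atom : z i ≡ j → z' i ≡ i → z' j ≡ j → f j < f i → Atom blk Q z'
    decouple-atom zi z'i z'j d = rebuild blk-mono A Q z' touched? z'-off closed f-off bound sym-z descends among mixed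
      where
      zj : z j ≡ i
      zj = trans (cong z (sym zi)) (invol A i)
      same : c i ≡ c j
      same = trans (sym (colour A i)) (cong c zi)
      closed : ∀ v → ¬ Touched v → ¬ Touched (z v)
      closed v t (inj₁ e) = t (inj₂ (z-injective A (trans e (sym zj))))
      closed v t (inj₂ e) = t (inj₁ (z-injective A (trans e (sym zi))))
      sym-z : ∀ v → Touched v → z' (z' v) ≡ v × Touched (z' v) × blk (to Q (z' v)) ≡ blk (to Q v)
      sym-z v (inj₁ refl) = trans (cong z' z'i) z'i , inj₁ z'i , cong (λ w → blk (to Q w)) z'i
      sym-z v (inj₂ refl) = trans (cong z' z'j) z'j , inj₂ z'j , cong (λ w → blk (to Q w)) z'j
      descends : ∀ v → Touched v → v < z' v → to Q (z' v) < to Q v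
      descends v (inj₁ refl) h = ⊥-elim (<-irrefl (sym z'i) h)
      descends v (inj₂ refl) h = ⊥-elim (<-irrefl (sym z'j) h)
      among : ∀ x y → Touched x → Touched y → blk (to Q x) ≡ blk (to Q y) →
        Rel x (z' x) y (z' y) (to Q x) (to Q (z' x)) (to Q y) (to Q (z' y))
      among x y (inj₁ refl) (inj₁ refl) _ = (λ h → ⊥-elim (<-irrefl refl h)) , λ h → ⊥-elim (<-irrefl refl h)
      among x y (inj₂ refl) (inj₂ refl) _ = (λ h → ⊥-elim (<-irrefl refl h)) , λ h → ⊥-elim (<-irrefl refl h)
      among x y (inj₂ refl) (inj₁ refl) _ = (λ h → ⊥-elim (<⇒≱ h (n≤1+n i))) , λ h → ⊥-elim (<⇒≱ h (n≤1+n i))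
      among x y (inj₁ refl) (inj₂ refl) _ rewrite z'i | z'j | Qi | Qj = (λ _ _ → d) , λ _ h → ⊥-elim (<⇒≱ h (n≤1+n i))
      solved : ∀ v → ¬ Touched v → c i ≡ c v → Rels i i v (z v) (f j) (f j) (f v) (f (z v)) × Rels j j v (z v) (f i) (f i) (f v) (f (z v))
      solved v t s = by-order groups decoupleᶠ decouple-valid (env (i ∷ j ∷ v ∷ z v ∷ f i ∷ f j ∷ f v ∷ f (z v) ∷ []))
        ≤-refl (away t) (away (closed v t)) (cycles A zi refl s) d
      mixed : ∀ x v → Touched x → ¬ Touched v → blk (to Q x) ≡ c v → Rels x (z' x) v (z v) (to Q x) (to Q (z' x)) (f v) (f (z v))
      mixed x v (inj₁ refl) t s rewrite z'i | Qi = proj₁ (solved v t (trans same s))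
      mixed x v (inj₂ refl) t s rewrite z'j | Qj = proj₂ (solved v t s)

  private
    Z : ℕ → ℕ
    Z v = z (s v)

    Z-fixed : ∀ v → v ≢ i → v ≢ j → Z v ≡ z v
    Z-fixed v p q = cong z (swap-other p q)

  -- The ascent is not a choice: the colours enforce it across blocks and `mono` inside a block. So
  -- when the action moves, every atom rises with it.
  raise : ∀ {z'} → Rise c z i z' → Ascent P i × Atom blk Q z'
  raise (across h) = blk-< h , conj-atom
    (λ e → ne (trans (sym (colour A i)) (cong c e))) (λ e → ⊥-elim (ne e))
    (λ _ → inj₁ (blk-< (subst (c i <_) (sym (colour A j)) h)))
    (λ _ → inj₂ (blk-< (subst (_< c j) (sym (colour A i)) h)))
    (λ e → ⊥-elim (ne e))
    where
    ne : c i ≢ c j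
    ne e = <-irrefl e h
  raise (conjugate e h nb) = ascent-within e h , conj-atom
    (λ e' → <⇒≱ h (≤-trans (≤-reflexive (trans (cong z (sym e')) (invol A i))) (≤-trans (n≤1+n i) (≤-reflexive (sym e')))))
    (λ _ l → ⊥-elim (<-asym h l))
    (λ _ → inj₁ (mono A i j e ≤-refl h))
    (λ l → inj₂ (subst (λ w → f (z i) < f w) (invol A j) (mono A (z i) (z j)
      (trans (colour A i) (trans e (sym (colour A j)))) h (subst₂ _<_ (sym (invol A i)) (sym (invol A j)) ≤-refl))))
    (λ _ p q → ⊥-elim (nb (p , q)))
  raise (couple e p q) = a , couple-atom Z Z-fixed e p q (trans (cong z (swap-left i j)) q) (trans (cong z (swap-right i j)) p) a
    where
    a : Ascent P i
    a = ascent-within e (subst₂ _<_ (sym p) (sym q) ≤-refl)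

  -- The converse of `raise`: any descent of an atom can be removed, and a single rise leads back.
  -- This is how a word is peeled off an atom from the right. If `i` and `j` are partners the cycle
  -- dissolves, otherwise it is conjugated.
  lower : Descent P i → Σ (ℕ → ℕ) λ z₀ → Σ (ℕ → ℕ) λ z₁ → Atom blk Q z₀ × Rise (λ v → blk (to Q v)) z₀ i z₁ × (∀ v → z₁ v ≡ z v)
  lower d with z i ≟ j
  ... | yes e = Z , _ , decouple-atom Z Z-fixed e Zi Zj d , couple same Zi Zj , λ v → cong z (s-s v)
    where
    zj : z j ≡ i
    zj = trans (cong z (sym e)) (invol A i)
    Zi : Z i ≡ i
    Zi = trans (cong z (swap-left i j)) zj
    Zj : Z j ≡ j
    Zj = trans (cong z (swap-right i j)) e
    same : blk (to Q i) ≡ blk (to Q j)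
    same = trans (cong c (swap-left i j)) (trans (cong c (sym e)) (trans (colour A i) (cong c (sym (swap-right i j)))))
  ... | no ne = conj , (λ v → s (conj (s v))) , conj-atom ne (λ e h → descent-nested d ne h e) (λ _ → inj₂ d) (λ _ → inj₁ d) (λ _ _ _ → d) , rise ,
        λ v → trans (s-s _) (cong z (s-s v))
    where
    rise : Rise (λ v → blk (to Q v)) conj i (λ v → s (conj (s v)))
    rise with blk (to Q i) <? blk (to Q j)
    ... | yes l = across l
    ... | no l = conjugate same (subst₂ _<_ (cong (λ w → s (z w)) (sym (swap-left i j))) (cong (λ w → s (z w)) (sym (swap-right i j))) s-<) not-both
      where
      same : blk (to Q i) ≡ blk (to Q j)
      same = ≤-antisym (blk-mono (subst₂ _≤_ (sym (to-stepʳ-left P i hi hj)) (sym (to-stepʳ-right P i hi hj)) (<⇒≤ d))) (≮⇒≥ l)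
      same' : c i ≡ c j
      same' = trans (cong c (sym (swap-right i j))) (trans (sym same) (cong c (swap-left i j)))
      nested : z j < z i
      nested with <-cmp (z i) (z j)
      ... | tri< h _ _ = ⊥-elim (<-asym d (ascent-within same' h))
      ... | tri≈ _ e _ = ⊥-elim (1+n≢n (sym (z-injective A e)))
      ... | tri> _ _ h = h
      s-< : s (z j) < s (z i)
      s-< with adjacent-< i (subst₂ _<_ (sym (s-s (z j))) (sym (s-s (z i))) nested)
      ... | inj₁ h = h
      ... | inj₂ (p , q) = ⊥-elim (ne (trans (sym (s-s (z i))) (trans (cong s q) (swap-left i j))))
      not-both : ¬ (conj i ≡ i × conj j ≡ j)
      not-both (p , q) = <⇒≱ nested (subst₂ _≤_
        (trans (cong s (trans (sym q) (cong (λ w → s (z w)) (swap-right i j)))) (s-s (z i)))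
        (trans (cong s (trans (sym p) (cong (λ w → s (z w)) (swap-left i j)))) (s-s (z j)))
        (subst₂ _≤_ (sym (swap-right i j)) (sym (swap-left i j)) (n≤1+n i)))


-- Covers of atoms

infix 7 _≈ᶠ_
_≈ᶠ_ : ℕ → ℕ → Formula
a ≈ᶠ b = a ≤ᶠ b ∧ᶠ b ≤ᶠ a

apartᶠ : ℕ → ℕ → Formula
apartᶠ a b = a <ᶠ b ∨ᶠ b <ᶠ a

coverᶠ : (i j x I J X : ℕ) → Formula
coverᶠ i j x I J X = i <ᶠ x ⇒ᶠ x <ᶠ j ⇒ᶠ X <ᶠ I ∨ᶠ J <ᶠ X

cycleᶠ : (a b A B : ℕ) → Formula
cycleᶠ a b A B = (a ≈ᶠ b ⇒ᶠ A ≈ᶠ B) ∧ᶠ (a <ᶠ b ⇒ᶠ B <ᶠ A) ∧ᶠ (b <ᶠ a ⇒ᶠ A <ᶠ B)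

-- The cycles `(p q)` and `(p' q')` with `p < p'` and `q < q'`, hence not nested. Later `i` is an
-- end of the first and `j` an end of the second, and exchanging their positions is a cover. Fixed
-- points are the cases `p = q` and `p' = q'`.
twoCyclesᶠ : (p q p' q' i j P Q P' Q' I J : ℕ) → Formula
twoCyclesᶠ p q p' q' i j P Q P' Q' I J =
  (p ≤ᶠ q ∧ᶠ p' ≤ᶠ q' ∧ᶠ p <ᶠ p' ∧ᶠ q <ᶠ q') ∧ᶠ (i <ᶠ j ∧ᶠ I <ᶠ J) ∧ᶠ
  cycleᶠ p q P Q ∧ᶠ cycleᶠ p' q' P' Q' ∧ᶠ cyclesᶠ p q p' q' P Q P' Q' ∧ᶠ
  coverᶠ i j p I J P ∧ᶠ coverᶠ i j q I J Q ∧ᶠ coverᶠ i j p' I J P' ∧ᶠ coverᶠ i j q' I J Q'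

otherCycleᶠ : (p q p' q' i j c d P Q P' Q' I J C D : ℕ) → Formula
otherCycleᶠ p q p' q' i j c d P Q P' Q' I J C D =
  (apartᶠ c p ∧ᶠ apartᶠ c q ∧ᶠ apartᶠ c p' ∧ᶠ apartᶠ c q') ∧ᶠ (apartᶠ d p ∧ᶠ apartᶠ d q ∧ᶠ apartᶠ d p' ∧ᶠ apartᶠ d q') ∧ᶠ
  cycleᶠ c d C D ∧ᶠ coverᶠ i j c I J C ∧ᶠ coverᶠ i j d I J D ∧ᶠ
  cyclesᶠ p q c d P Q C D ∧ᶠ cyclesᶠ p' q' c d P' Q' C D

-- In the goals P, Q, P', Q' are the positions after the swap.
pairedᶠ : (a a' b b' c d A A' B B' C D : ℕ) → Formula
pairedᶠ a a' b b' c d A A' B B' C D = (relsᶠ a a' c d A A' C D ∧ᶠ relsᶠ a' a c d A' A C D) ∧ᶠ relsᶠ b b' c d B B' C D ∧ᶠ relsᶠ b' b c d B' B C D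

pairᶠ : (a a' b b' A A' B B' : ℕ) → Formula
pairᶠ a a' b b' A A' B B' = (a <ᶠ a' ⇒ᶠ A' <ᶠ A) ∧ᶠ (b <ᶠ b' ⇒ᶠ B' <ᶠ B) ∧ᶠ (a' <ᶠ a ⇒ᶠ A <ᶠ A') ∧ᶠ (b' <ᶠ b ⇒ᶠ B <ᶠ B') ∧ᶠ cyclesᶠ a a' b b' A A' B B'

splitᶠ : (p q p' q' c d P Q P' Q' C D : ℕ) → Formula
splitᶠ p q p' q' c d P Q P' Q' C D = (relsᶠ p q' c d P Q' C D ∧ᶠ relsᶠ q' p c d Q' P C D) ∧ᶠ
  (p <ᶠ q ⇒ᶠ relsᶠ q q c d Q Q C D) ∧ᶠ (p' <ᶠ q' ⇒ᶠ relsᶠ p' p' c d P' P' C D)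

splitPairᶠ : (p q p' q' P Q P' Q' : ℕ) → Formula
splitPairᶠ p q p' q' P Q P' Q' = (Q' <ᶠ P) ∧ᶠ (p <ᶠ q ⇒ᶠ relsᶠ q q p q' Q Q P Q' ∧ᶠ relsᶠ q q q' p Q Q Q' P) ∧ᶠ
  (p' <ᶠ q' ⇒ᶠ relsᶠ p' p' p q' P' P' P Q' ∧ᶠ relsᶠ p' p' q' p P' P' Q' P) ∧ᶠ
  (p <ᶠ q ⇒ᶠ p' <ᶠ q' ⇒ᶠ relsᶠ q q p' p' Q Q P' P')

renew : (z : ℕ → ℕ) {New : ℕ → ℕ → Set} → (∀ v → Dec (Σ ℕ (New v))) → ℕ → ℕ
renew z new? v with new? v
... | yes (w , _) = w
... | no _ = z v

-- The new cycles are listed by a relation `New`, so that the same list serves when one of the old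
-- cycles degenerates to a fixed point.
module _ {n : ℕ} {blk : ℕ → ℕ} (blk-mono : ∀ {x y} → x ≤ y → blk x ≤ blk y)
  {P : Perm n} {z : ℕ → ℕ} (A : Atom blk P z) (Q : Perm n)
  {New : ℕ → ℕ → Set} (new? : ∀ v → Dec (Σ ℕ (New v)))
  (new-functional : ∀ {x y y'} → New x y → New x y' → y ≡ y')
  (new-sym : ∀ {x y} → New x y → New y x)
  (new-closed : ∀ v → ¬ Σ ℕ (New v) → ¬ Σ ℕ (New (z v)))
  (fixed-f : ∀ v → ¬ Σ ℕ (New v) → to Q v ≡ to P v)
  (new-bound : ∀ {x y} → New x y → x < n)
  (new-block : ∀ {x y} → New x y → blk (to Q y) ≡ blk (to Q x))
  (new-desc : ∀ {x y} → New x y → x < y → to Q y < to Q x)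
  (new-new : ∀ {x x' y y'} → New x x' → New y y' → blk (to Q x) ≡ blk (to Q y) →
    Rel x x' y y' (to Q x) (to Q x') (to Q y) (to Q y'))
  (new-old : ∀ {x x'} c → New x x' → ¬ Σ ℕ (New c) → blk (to Q x) ≡ blk (to P c) →
    Rels x x' c (z c) (to Q x) (to Q x') (to P c) (to P (z c))) where

  private
    z' : ℕ → ℕ
    z' = renew z new?

    z'-new : ∀ {x y} → New x y → z' x ≡ y
    z'-new {x} h with new? x
    ... | yes (w , k) = new-functional k h
    ... | no k = ⊥-elim (k (_ , h))

    z'-old : ∀ v → ¬ Σ ℕ (New v) → z' v ≡ z v
    z'-old v h with new? v
    ... | yes k = ⊥-elim (h k)
    ... | no _ = refl

  renew-atom : Atom blk Q z'
  renew-atom = rebuild blk-mono A Q z' new? z'-old new-closed fixed-f (λ v t → new-bound (proj₂ t)) symmetric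
    (λ { v (w , t) h → subst (λ u → to Q u < to Q v) (sym (z'-new t)) (new-desc t (subst (v <_) (z'-new t) h)) })
    (λ { x y (x' , p) (y' , q) s → subst₂ (λ u v → Rel x u y v (to Q x) (to Q u) (to Q y) (to Q v)) (sym (z'-new p)) (sym (z'-new q)) (new-new p q s) })
    (λ { x c (x' , p) t s → subst (λ u → Rels x u c (z c) (to Q x) (to Q u) (to P c) (to P (z c))) (sym (z'-new p)) (new-old c p t s) })
    where
    symmetric : ∀ v → Σ ℕ (New v) → z' (z' v) ≡ v × Σ ℕ (New (z' v)) × blk (to Q (z' v)) ≡ blk (to Q v)
    symmetric v (w , t) rewrite z'-new t = z'-new (new-sym t) , (v , new-sym t) , new-block t

rel-self : ∀ {x x' A A' B B'} → Rel x x' x x' A A' B B'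
rel-self = (λ h → ⊥-elim (<-irrefl refl h)) , λ h → ⊥-elim (<-irrefl refl h)

rel-partner : ∀ {x x' A A' B B'} → Rel x x' x' x A A' B B'
rel-partner = (λ h k → ⊥-elim (<-asym h k)) , λ _ h → ⊥-elim (<-irrefl refl h)

data Pairs (a a' b b' : ℕ) : ℕ → ℕ → Set where
  first : Pairs a a' b b' a a'
  first⁻ : Pairs a a' b b' a' a
  second : Pairs a a' b b' b b'
  second⁻ : Pairs a a' b b' b' b

pairs-sym : ∀ {a a' b b' x y} → Pairs a a' b b' x y → Pairs a a' b b' y x
pairs-sym first = first⁻
pairs-sym first⁻ = first
pairs-sym second = second⁻
pairs-sym second⁻ = second

pairs? : ∀ a a' b b' v → Dec (Σ ℕ (Pairs a a' b b' v))
pairs? a a' b b' v with v ≟ a | v ≟ a' | v ≟ b | v ≟ b'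
... | yes refl | _ | _ | _ = yes (_ , first)
... | _ | yes refl | _ | _ = yes (_ , first⁻)
... | _ | _ | yes refl | _ = yes (_ , second)
... | _ | _ | _ | yes refl = yes (_ , second⁻)
... | no p | no q | no r | no s = no λ { (_ , first) → p refl ; (_ , first⁻) → q refl ; (_ , second) → r refl ; (_ , second⁻) → s refl }

pairs-functional : ∀ {a a' b b'} → a ≢ a' → b ≢ b' → a ≢ b → a ≢ b' → a' ≢ b → a' ≢ b' →
  ∀ {x y y'} → Pairs a a' b b' x y → Pairs a a' b b' x y' → y ≡ y'
pairs-functional u v w x y z first first = refl
pairs-functional u v w x y z first first⁻ = ⊥-elim (u refl)
pairs-functional u v w x y z first second = ⊥-elim (w refl)
pairs-functional u v w x y z first second⁻ = ⊥-elim (x refl)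
pairs-functional u v w x y z first⁻ first = ⊥-elim (u refl)
pairs-functional u v w x y z first⁻ first⁻ = refl
pairs-functional u v w x y z first⁻ second = ⊥-elim (y refl)
pairs-functional u v w x y z first⁻ second⁻ = ⊥-elim (z refl)
pairs-functional u v w x y z second first = ⊥-elim (w refl)
pairs-functional u v w x y z second first⁻ = ⊥-elim (y refl)
pairs-functional u v w x y z second second = refl
pairs-functional u v w x y z second second⁻ = ⊥-elim (v refl)
pairs-functional u v w x y z second⁻ first = ⊥-elim (x refl)
pairs-functional u v w x y z second⁻ first⁻ = ⊥-elim (z refl)
pairs-functional u v w x y z second⁻ second = ⊥-elim (v refl)
pairs-functional u v w x y z second⁻ second⁻ = refl

pairs-rel : ∀ {a a' b b' x x' y y'} (g : ℕ → ℕ) → Cycles a a' b b' (g a) (g a') (g b) (g b') →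
  Pairs a a' b b' x x' → Pairs a a' b b' y y' → Rel x x' y y' (g x) (g x') (g y) (g y')
pairs-rel g c first first = rel-self
pairs-rel g c first first⁻ = rel-partner
pairs-rel g c first⁻ first = rel-partner
pairs-rel g c first⁻ first⁻ = rel-self
pairs-rel g c second second = rel-self
pairs-rel g c second second⁻ = rel-partner
pairs-rel g c second⁻ second = rel-partner
pairs-rel g c second⁻ second⁻ = rel-self
pairs-rel g ((c , _) , _) first second = c
pairs-rel g ((_ , c) , _) second first = c
pairs-rel g (_ , (c , _) , _) first second⁻ = c
pairs-rel g (_ , (_ , c) , _) second⁻ first = c
pairs-rel g (_ , _ , (c , _) , _) first⁻ second = c
pairs-rel g (_ , _ , (_ , c) , _) second first⁻ = c
pairs-rel g (_ , _ , _ , (c , _)) first⁻ second⁻ = c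
pairs-rel g (_ , _ , _ , (_ , c)) second⁻ first⁻ = c

-- Cycles that stand side by side merge into `(p q')` and release their inner ends `q` and `p'` as
-- fixed points. An end of a degenerate cycle already belongs to `(p q')`, which the guards express.
data Split (p q p' q' : ℕ) : ℕ → ℕ → Set where
  outer : Split p q p' q' p q'
  outer⁻ : Split p q p' q' q' p
  left : p < q → Split p q p' q' q q
  right : p' < q' → Split p q p' q' p' p'

split-sym : ∀ {p q p' q' x y} → Split p q p' q' x y → Split p q p' q' y x
split-sym outer = outer⁻
split-sym outer⁻ = outer
split-sym (left h) = left h
split-sym (right h) = right h

split? : ∀ {p q p' q'} → p ≤ q → p' ≤ q' → ∀ v → Dec (Σ ℕ (Split p q p' q' v))
split? {p} {q} {p'} {q'} h k v with v ≟ p | v ≟ q' | v ≟ q | v ≟ p'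
... | yes refl | _ | _ | _ = yes (_ , outer)
... | _ | yes refl | _ | _ = yes (_ , outer⁻)
... | no e | _ | yes refl | _ = yes (_ , left (≤∧≢⇒< h λ e' → e (sym e')))
... | _ | no e | _ | yes refl = yes (_ , right (≤∧≢⇒< k e))
... | no a | no b | no c | no d = no λ { (_ , outer) → a refl ; (_ , outer⁻) → b refl ; (_ , left _) → c refl ; (_ , right _) → d refl }

split-functional : ∀ {p q p' q'} → q < p' → p < p' → q < q' → p < q' → ∀ {x y y'} → Split p q p' q' x y → Split p q p' q' x y' → y ≡ y'
split-functional a b c d outer outer = refl
split-functional a b c d outer outer⁻ = ⊥-elim (<-irrefl refl d)
split-functional a b c d outer (left h) = ⊥-elim (<-irrefl refl h)
split-functional a b c d outer (right h) = ⊥-elim (<-irrefl refl b)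
split-functional a b c d outer⁻ outer = ⊥-elim (<-irrefl refl d)
split-functional a b c d outer⁻ outer⁻ = refl
split-functional a b c d outer⁻ (left h) = ⊥-elim (<-irrefl refl c)
split-functional a b c d outer⁻ (right h) = ⊥-elim (<-irrefl refl h)
split-functional a b c d (left h) outer = ⊥-elim (<-irrefl refl h)
split-functional a b c d (left h) outer⁻ = ⊥-elim (<-irrefl refl c)
split-functional a b c d (left h) (left k) = refl
split-functional a b c d (left h) (right k) = refl
split-functional a b c d (right h) outer = ⊥-elim (<-irrefl refl b)
split-functional a b c d (right h) outer⁻ = ⊥-elim (<-irrefl refl h)
split-functional a b c d (right h) (left k) = refl
split-functional a b c d (right h) (right k) = refl

SplitPair : (p q p' q' : ℕ) (g : ℕ → ℕ) → Set
SplitPair p q p' q' g = ⟦ splitPairᶠ 0 1 2 3 4 5 6 7 ⟧ (env (p ∷ q ∷ p' ∷ q' ∷ g p ∷ g q ∷ g p' ∷ g q' ∷ []))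

split-rel : ∀ {p q p' q' x x' y y'} (g : ℕ → ℕ) → SplitPair p q p' q' g →
  Split p q p' q' x x' → Split p q p' q' y y' → Rel x x' y y' (g x) (g x') (g y) (g y')
split-rel g c outer outer = rel-self
split-rel g c outer outer⁻ = rel-partner
split-rel g c outer⁻ outer = rel-partner
split-rel g c outer⁻ outer⁻ = rel-self
split-rel g c (left _) (left _) = rel-self
split-rel g c (right _) (right _) = rel-self
split-rel g (_ , c , _) outer (left h) = proj₂ (proj₁ (c h))
split-rel g (_ , c , _) (left h) outer = proj₁ (proj₁ (c h))
split-rel g (_ , c , _) outer⁻ (left h) = proj₂ (proj₂ (c h))
split-rel g (_ , c , _) (left h) outer⁻ = proj₁ (proj₂ (c h))
split-rel g (_ , _ , c , _) outer (right h) = proj₂ (proj₁ (c h))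
split-rel g (_ , _ , c , _) (right h) outer = proj₁ (proj₁ (c h))
split-rel g (_ , _ , c , _) outer⁻ (right h) = proj₂ (proj₂ (c h))
split-rel g (_ , _ , c , _) (right h) outer⁻ = proj₁ (proj₂ (c h))
split-rel g (_ , _ , _ , c) (left h) (right k) = proj₁ (c h k)
split-rel g (_ , _ , _ , c) (right k) (left h) = proj₂ (c h k)

≢⇒<⊎> : ∀ {a b} → a ≢ b → a < b ⊎ b < a
≢⇒<⊎> {a} {b} ne with <-cmp a b
... | tri< h _ _ = inj₁ h
... | tri≈ _ e _ = ⊥-elim (ne e)
... | tri> _ _ h = inj₂ h

IsCover : ∀ {n} → Perm n → ℕ → ℕ → Set
IsCover P i j = to P i < to P j × (∀ x → i < x → x < j → to P x < to P i ⊎ to P j < to P x)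

Cycle : (a b A B : ℕ) → Set
Cycle a b A B = ⟦ cycleᶠ 0 1 2 3 ⟧ (env (a ∷ b ∷ A ∷ B ∷ []))

cycle : ∀ {n blk} {P : Perm n} {z} → Atom blk P z → ∀ {v w} → z v ≡ w → Cycle v w (to P v) (to P w)
cycle {P = P} {z} A {v} refl = (λ h → subst (λ w → ¬ (to P w < to P v) × ¬ (to P v < to P w)) (≤-antisym (≮⇒≥ (proj₁ h)) (≮⇒≥ (proj₂ h))) (<-irrefl refl , <-irrefl refl)) ,
  desc A v , λ h → subst (λ w → to P w < to P (z v)) (invol A v) (desc A (z v) (subst (z v <_) (sym (invol A v)) h))

TwoCycles : (p q p' q' i j P Q P' Q' I J : ℕ) → Set
TwoCycles p q p' q' i j P Q P' Q' I J = ⟦ twoCyclesᶠ 0 1 2 3 4 5 6 7 8 9 10 11 ⟧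
  (env (p ∷ q ∷ p' ∷ q' ∷ i ∷ j ∷ P ∷ Q ∷ P' ∷ Q' ∷ I ∷ J ∷ []))

OtherCycle : (p q p' q' i j c d P Q P' Q' I J C D : ℕ) → Set
OtherCycle p q p' q' i j c d P Q P' Q' I J C D = ⟦ otherCycleᶠ 0 1 2 3 4 5 6 7 8 9 10 11 12 13 14 15 ⟧
  (env (p ∷ q ∷ p' ∷ q' ∷ i ∷ j ∷ c ∷ d ∷ P ∷ Q ∷ P' ∷ Q' ∷ I ∷ J ∷ C ∷ D ∷ []))

module Instances where

  -- `i` and `j` are among the indices 0 to 3 of `p`, `q`, `p'`, `q'`, whose positions have the
  -- indices 6 to 9. The other cycle has the indices 4 and 5, with positions 10 and 11.
  two : ℕ → ℕ → Formula
  two i j = twoCyclesᶠ 0 1 2 3 i j 6 7 8 9 (6 + i) (6 + j)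

  other : ℕ → ℕ → Formula
  other i j = otherCycleᶠ 0 1 2 3 i j 4 5 6 7 8 9 (6 + i) (6 + j) 10 11

  six four : List (List ℕ)
  six = (0 ∷ 1 ∷ 2 ∷ 3 ∷ 4 ∷ 5 ∷ []) ∷ (6 ∷ 7 ∷ 8 ∷ 9 ∷ 10 ∷ 11 ∷ []) ∷ []
  four = (0 ∷ 1 ∷ 2 ∷ 3 ∷ []) ∷ (6 ∷ 7 ∷ 8 ∷ 9 ∷ []) ∷ []

  pairedAt pairAt splitAt splitPairAt : (i j P Q P' Q' : ℕ) → Formula
  pairedAt i j P Q P' Q' = 2 <ᶠ 1 ⇒ᶠ two i j ⇒ᶠ other i j ⇒ᶠ pairedᶠ 0 3 2 1 4 5 P Q' P' Q 10 11
  pairAt i j P Q P' Q' = 2 <ᶠ 1 ⇒ᶠ two i j ⇒ᶠ pairᶠ 0 3 2 1 P Q' P' Q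
  splitAt i j P Q P' Q' = 1 <ᶠ 2 ⇒ᶠ two i j ⇒ᶠ other i j ⇒ᶠ splitᶠ 0 1 2 3 4 5 P Q P' Q' 10 11
  splitPairAt i j P Q P' Q' = 1 <ᶠ 2 ⇒ᶠ two i j ⇒ᶠ splitPairᶠ 0 1 2 3 P Q P' Q'

  crossed crossedPair : Formula
  crossed = 0 <ᶠ 1 ⇒ᶠ 2 <ᶠ 3 ⇒ᶠ two 1 2 ⇒ᶠ other 1 2 ⇒ᶠ pairedᶠ 0 2 1 3 4 5 6 7 8 9 10 11
  crossedPair = 0 <ᶠ 1 ⇒ᶠ 2 <ᶠ 3 ⇒ᶠ two 1 2 ⇒ᶠ pairᶠ 0 2 1 3 6 7 8 9

  abstract
    -- The last four numbers are 6, 7, 8, 9 with the positions of `i` and `j` exchanged. The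
    -- premises `2 <ᶠ 3` and `0 <ᶠ 1` of the other cases say that `p'` or `p` belongs to a 2-cycle;
    -- fixed points are handled by the pair 0, 3.
    paired-03 : Valid six (pairedAt 0 3 9 7 8 6)
    paired-03 = refl
    paired-02 : Valid six (2 <ᶠ 3 ⇒ᶠ pairedAt 0 2 8 7 6 9)
    paired-02 = refl
    paired-13 : Valid six (0 <ᶠ 1 ⇒ᶠ pairedAt 1 3 6 9 8 7)
    paired-13 = refl
    pair-03 : Valid four (pairAt 0 3 9 7 8 6)
    pair-03 = refl
    pair-02 : Valid four (2 <ᶠ 3 ⇒ᶠ pairAt 0 2 8 7 6 9)
    pair-02 = refl
    pair-13 : Valid four (0 <ᶠ 1 ⇒ᶠ pairAt 1 3 6 9 8 7)
    pair-13 = refl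
    split-03 : Valid six (splitAt 0 3 9 7 8 6)
    split-03 = refl
    split-02 : Valid six (2 <ᶠ 3 ⇒ᶠ splitAt 0 2 8 7 6 9)
    split-02 = refl
    split-13 : Valid six (0 <ᶠ 1 ⇒ᶠ splitAt 1 3 6 9 8 7)
    split-13 = refl
    splitPair-03 : Valid four (splitPairAt 0 3 9 7 8 6)
    splitPair-03 = refl
    splitPair-02 : Valid four (2 <ᶠ 3 ⇒ᶠ splitPairAt 0 2 8 7 6 9)
    splitPair-02 = refl
    splitPair-13 : Valid four (0 <ᶠ 1 ⇒ᶠ splitPairAt 1 3 6 9 8 7)
    splitPair-13 = refl
    crossed-12 : Valid six crossed
    crossed-12 = refl
    crossedPair-12 : Valid four crossedPair
    crossedPair-12 = refl

module Exchange {n : ℕ} {blk : ℕ → ℕ} (blk-mono : ∀ {x y} → x ≤ y → blk x ≤ blk y)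
  {P : Perm n} {z : ℕ → ℕ} (A : Atom blk P z) {p q p' q' : ℕ} (zp : z p ≡ q) (zp' : z p' ≡ q')
  (p≤q : p ≤ q) (p'≤q' : p' ≤ q') (p<p' : p < p') (q<q' : q < q')
  {i j : ℕ} (hi : i < n) (hj : j < n) (i∈ : i ≡ p ⊎ i ≡ q) (j∈ : j ≡ p' ⊎ j ≡ q')
  (i<j : i < j) (same : blk (to P p) ≡ blk (to P p')) (cover : IsCover P i j) where

  f : ℕ → ℕ
  f = to P

  Q : Perm n
  Q = mulʳ P i j hi hj

  data Four : ℕ → Set where
    is-p : Four p
    is-q : Four q
    is-p' : Four p'
    is-q' : Four q'

  zq : z q ≡ p
  zq = trans (cong z (sym zp)) (invol A p)

  zq' : z q' ≡ p'
  zq' = trans (cong z (sym zp')) (invol A p')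

  four-z : ∀ {v} → Four v → Four (z v)
  four-z is-p = subst Four (sym zp) is-q
  four-z is-q = subst Four (sym zq) is-p
  four-z is-p' = subst Four (sym zp') is-q'
  four-z is-q' = subst Four (sym zq') is-p'

  four-closed : ∀ {v} → ¬ Four v → ¬ Four (z v)
  four-closed {v} h k = h (subst Four (invol A v) (four-z k))

  four-i : Four i
  four-i = Data.Sum.[ (λ e → subst Four (sym e) is-p) , (λ e → subst Four (sym e) is-q) ]′ i∈

  four-j : Four j
  four-j = Data.Sum.[ (λ e → subst Four (sym e) is-p') , (λ e → subst Four (sym e) is-q') ]′ j∈

  four-swap : ∀ {v} → Four v → Four (swapℕ i j v)
  four-swap {v} h with swapView i j v
  ... | is-left _ e = subst Four (sym e) four-j
  ... | is-right _ e = subst Four (sym e) four-i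
  ... | is-other _ _ e = subst Four (sym e) h

  four-block : ∀ {v} → Four v → blk (f v) ≡ blk (f p)
  four-block is-p = refl
  four-block is-q = trans (cong (λ w → blk (f w)) (sym zp)) (colour A p)
  four-block is-p' = sym same
  four-block is-q' = trans (cong (λ w → blk (f w)) (sym zp')) (trans (colour A p') (sym same))

  four-bound : ∀ {v} → Four v → v < n
  four-bound = go (low i∈) (high j∈)
    where
    low : i ≡ p ⊎ i ≡ q → p < n
    low (inj₁ e) = subst (_< n) e hi
    low (inj₂ e) = subst (_< n) (trans (cong z e) zq) (z-bounded A hi)
    high : j ≡ p' ⊎ j ≡ q' → p' < n
    high (inj₁ e) = subst (_< n) e hj
    high (inj₂ e) = subst (_< n) (trans (cong z e) zq') (z-bounded A hj)
    go : p < n → p' < n → ∀ {v} → Four v → v < n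
    go h k is-p = h
    go h k is-q = subst (_< n) zp (z-bounded A h)
    go h k is-p' = k
    go h k is-q' = subst (_< n) zp' (z-bounded A k)

  twoCycles : TwoCycles p q p' q' i j (f p) (f q) (f p') (f q') (f i) (f j)
  twoCycles = (≤⇒≯ p≤q , ≤⇒≯ p'≤q' , p<p' , q<q') , (i<j , proj₁ cover) , cycle A zp , cycle A zp' , cycles A zp zp' same ,
    proj₂ cover p , proj₂ cover q , proj₂ cover p' , proj₂ cover q'

  otherCycle : ∀ c → ¬ Four c → blk (f p) ≡ blk (f c) →
    OtherCycle p q p' q' i j c (z c) (f p) (f q) (f p') (f q') (f i) (f j) (f c) (f (z c))
  otherCycle c t s = aparts t , aparts (four-closed t) , cycle A refl , proj₂ cover c , proj₂ cover (z c) ,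
    cycles A zp refl s , cycles A zp' refl (trans (sym same) s)
    where
    apart : ∀ {x y} → ¬ Four x → Four y → x < y ⊎ y < x
    apart h k = ≢⇒<⊎> λ e → h (subst Four (sym e) k)
    aparts : ∀ {x} → ¬ Four x → (x < p ⊎ p < x) × (x < q ⊎ q < x) × (x < p' ⊎ p' < x) × (x < q' ⊎ q' < x)
    aparts h = apart h is-p , apart h is-q , apart h is-p' , apart h is-q'

  module _ {New : ℕ → ℕ → Set} (new? : ∀ v → Dec (Σ ℕ (New v)))
    (new-functional : ∀ {x y y'} → New x y → New x y' → y ≡ y') (new-sym : ∀ {x y} → New x y → New y x)
    (new-four : ∀ {x y} → New x y → Four x) (four-new : ∀ {x} → Four x → Σ ℕ (New x))
    (new-desc : ∀ {x y} → New x y → x < y → to Q y < to Q x)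
    (new-new : ∀ {x x' y y'} → New x x' → New y y' → Rel x x' y y' (to Q x) (to Q x') (to Q y) (to Q y'))
    (new-old : ∀ c → ¬ Four c → blk (f p) ≡ blk (f c) → ∀ {x x'} → New x x' → Rels x x' c (z c) (to Q x) (to Q x') (f c) (f (z c))) where

    exchange-atom : Atom blk Q (renew z new?)
    exchange-atom = renew-atom blk-mono A Q new? new-functional new-sym
      (λ v h k → four-closed (λ t → h (four-new t)) (new-four (proj₂ k)))
      (λ v h → cong f (swap-other (λ e → h (four-new (subst Four (sym e) four-i))) (λ e → h (four-new (subst Four (sym e) four-j)))))
      (λ h → four-bound (new-four h))
      (λ h → trans (block (new-sym h)) (sym (block h)))
      new-desc (λ h k _ → new-new h k)
      (λ c h k s → new-old c (λ t → k (four-new t)) (trans (sym (block h)) s) h)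
      where
      block : ∀ {x y} → New x y → blk (to Q x) ≡ blk (f p)
      block h = four-block (four-swap (new-four h))

  PairedGoal : (a a' b b' : ℕ) → ℕ → Set
  PairedGoal a a' b b' c = ⟦ pairedᶠ 0 1 2 3 4 5 6 7 8 9 10 11 ⟧
    (env (a ∷ a' ∷ b ∷ b' ∷ c ∷ z c ∷ to Q a ∷ to Q a' ∷ to Q b ∷ to Q b' ∷ f c ∷ f (z c) ∷ []))

  PairGoal : (a a' b b' : ℕ) → Set
  PairGoal a a' b b' = ⟦ pairᶠ 0 1 2 3 4 5 6 7 ⟧ (env (a ∷ a' ∷ b ∷ b' ∷ to Q a ∷ to Q a' ∷ to Q b ∷ to Q b' ∷ []))

  pairs-atom : ∀ {a a' b b'} → a ≢ a' → b ≢ b' → a ≢ b → a ≢ b' → a' ≢ b → a' ≢ b' →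
    (∀ {x y} → Pairs a a' b b' x y → Four x) → (∀ {x} → Four x → Σ ℕ (Pairs a a' b b' x)) →
    PairGoal a a' b b' → (∀ c → ¬ Four c → blk (f p) ≡ blk (f c) → PairedGoal a a' b b' c) →
    Atom blk Q (renew z (pairs? a a' b b'))
  pairs-atom {a} {a'} {b} {b'} n₁ n₂ n₃ n₄ n₅ n₆ to-four from-four (d₁ , d₂ , d₃ , d₄ , r) goal =
    exchange-atom (pairs? a a' b b') (pairs-functional n₁ n₂ n₃ n₄ n₅ n₆) pairs-sym to-four from-four
      (λ { first → d₁ ; first⁻ → d₃ ; second → d₂ ; second⁻ → d₄ }) (pairs-rel (to Q) r)
      λ c t s → old (goal c t s)
    where
    old : ∀ {c} → PairedGoal a a' b b' c → ∀ {x x'} → Pairs a a' b b' x x' → Rels x x' c (z c) (to Q x) (to Q x') (f c) (f (z c))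
    old ((g , _) , _) first = g
    old ((_ , g) , _) first⁻ = g
    old (_ , g , _) second = g
    old (_ , _ , g) second⁻ = g

  SplitGoal : ℕ → Set
  SplitGoal c = ⟦ splitᶠ 0 1 2 3 4 5 6 7 8 9 10 11 ⟧
    (env (p ∷ q ∷ p' ∷ q' ∷ c ∷ z c ∷ to Q p ∷ to Q q ∷ to Q p' ∷ to Q q' ∷ f c ∷ f (z c) ∷ []))

  split-atom : q < p' → SplitPair p q p' q' (to Q) → (∀ c → ¬ Four c → blk (f p) ≡ blk (f c) → SplitGoal c) →
    Atom blk Q (renew z (split? p≤q p'≤q'))
  split-atom q<p' pair goal = exchange-atom (split? p≤q p'≤q') (split-functional q<p' p<p' q<q' (≤-<-trans p≤q q<q')) split-sym
    (λ { outer → is-p ; outer⁻ → is-q' ; (left _) → is-q ; (right _) → is-p' }) from-four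
    (λ { outer _ → proj₁ pair ; outer⁻ h → ⊥-elim (<-asym h (≤-<-trans p≤q q<q')) ; (left _) h → ⊥-elim (<-irrefl refl h) ; (right _) h → ⊥-elim (<-irrefl refl h) })
    (split-rel (to Q) pair) λ c t s → old (goal c t s)
    where
    from-four : ∀ {x} → Four x → Σ ℕ (Split p q p' q' x)
    from-four is-p = _ , outer
    from-four is-q' = _ , outer⁻
    from-four is-q = Data.Sum.[ (λ h → _ , left h) , (λ e → _ , subst (λ x → Split p q p' q' x q') e outer) ]′ (m≤n⇒m<n∨m≡n p≤q)
    from-four is-p' = Data.Sum.[ (λ h → _ , right h) , (λ e → _ , subst (λ x → Split p q p' q' x p) (sym e) outer⁻) ]′ (m≤n⇒m<n∨m≡n p'≤q')
    old : ∀ {c} → SplitGoal c → ∀ {x x'} → Split p q p' q' x x' → Rels x x' c (z c) (to Q x) (to Q x') (f c) (f (z c))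
    old ((g , _) , _) outer = g
    old ((_ , g) , _) outer⁻ = g
    old (_ , g , _) (left h) = g h
    old (_ , _ , g) (right h) = g h

-- `z'` is chosen before the permutation: one involution serves every atom of `z` in which the swap
-- is a cover. This is the independence of `t^μ` from the chosen atom.
ExchangedAtom : ∀ {n} (blk z z' : ℕ → ℕ) (i j : ℕ) → Set
ExchangedAtom {n} blk z z' i j = ∀ {P : Perm n} → Atom blk P z → (hi : i < n) (hj : j < n) → i < j → blk (to P i) ≡ blk (to P j) →
  IsCover P i j → Atom blk (mulʳ P i j hi hj) z'

module _ {n : ℕ} {blk : ℕ → ℕ} (blk-mono : ∀ {x y} → x ≤ y → blk x ≤ blk y)
  {z : ℕ → ℕ} {p q p' q' : ℕ} (zp : z p ≡ q) (zp' : z p' ≡ q')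
  (p≤q : p ≤ q) (p'≤q' : p' ≤ q') (p<p' : p < p') (q<q' : q < q') where

  open Instances

  private
    p<q' : p < q'
    p<q' = ≤-<-trans p≤q q<q'

    module _ {P : Perm n} (A : Atom blk P z) where
      zq' : z q' ≡ p'
      zq' = trans (cong z (sym zp')) (invol A p')
      zq : z q ≡ p
      zq = trans (cong z (sym zp)) (invol A p)
      block-q : blk (to P q) ≡ blk (to P p)
      block-q = trans (cong (λ v → blk (to P v)) (sym zp)) (colour A p)
      block-q' : blk (to P q') ≡ blk (to P p')
      block-q' = trans (cong (λ v → blk (to P v)) (sym zp')) (colour A p')

  crossing-atom : p < q → p' < q' → q < p' → ExchangedAtom {n} blk z (renew z (pairs? p p' q q')) q p'
  crossing-atom p<q p'<q' q<p' {P} A hi hj _ s cov = E.pairs-atom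
    (<⇒≢ p<p') (<⇒≢ q<q') (<⇒≢ p<q) (<⇒≢ p<q') (λ e → <⇒≢ q<p' (sym e)) (<⇒≢ p'<q')
    (λ { first → E.is-p ; first⁻ → E.is-p' ; second → E.is-q ; second⁻ → E.is-q' })
    (λ { E.is-p → _ , first ; E.is-p' → _ , first⁻ ; E.is-q → _ , second ; E.is-q' → _ , second⁻ })
    (pair Qp Qq Qp' Qq') (λ c t s' → paired c t s' Qp Qq Qp' Qq')
    where
    module E = Exchange blk-mono A zp zp' p≤q p'≤q' p<p' q<q' hi hj (inj₂ refl) (inj₁ refl) q<p' (trans (sym (block-q A)) s) cov
    open E using (f; Q)
    Qp : to Q p ≡ f p
    Qp = cong f (swap-other (<⇒≢ p<q) (<⇒≢ p<p'))
    Qq : to Q q ≡ f p'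
    Qq = cong f (swap-left q p')
    Qp' : to Q p' ≡ f q
    Qp' = cong f (swap-right q p')
    Qq' : to Q q' ≡ f q'
    Qq' = cong f (swap-other (λ e → <⇒≢ q<q' (sym e)) (λ e → <⇒≢ p'<q' (sym e)))
    pair : ∀ {a b a' b'} → a ≡ f p → b ≡ f p' → a' ≡ f q → b' ≡ f q' →
      ⟦ pairᶠ 0 1 2 3 4 5 6 7 ⟧ (env (p ∷ p' ∷ q ∷ q' ∷ a ∷ a' ∷ b ∷ b' ∷ []))
    pair refl refl refl refl = by-order four crossedPair crossedPair-12
      (env (p ∷ q ∷ p' ∷ q' ∷ 0 ∷ 0 ∷ f p ∷ f q ∷ f p' ∷ f q' ∷ [])) p<q p'<q' E.twoCycles
    paired : ∀ c → ¬ E.Four c → blk (f p) ≡ blk (f c) → ∀ {a b a' b'} → a ≡ f p → b ≡ f p' → a' ≡ f q → b' ≡ f q' →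
      ⟦ pairedᶠ 0 1 2 3 4 5 6 7 8 9 10 11 ⟧ (env (p ∷ p' ∷ q ∷ q' ∷ c ∷ z c ∷ a ∷ a' ∷ b ∷ b' ∷ f c ∷ f (z c) ∷ []))
    paired c t s refl refl refl refl = by-order six crossed crossed-12
      (env (p ∷ q ∷ p' ∷ q' ∷ c ∷ z c ∷ f p ∷ f q ∷ f p' ∷ f q' ∷ f c ∷ f (z c) ∷ [])) p<q p'<q' E.twoCycles (E.otherCycle c t s)

  -- The swaps other than that of `q` and `p'`. All three produce the same involution:
  -- `(p q')(p' q)` if the cycles cross, and `(p q')` with the inner ends released if they stand
  -- side by side. The guards leave fixed points to `pq'`.
  data Chosen : ℕ → ℕ → Set where
    pq' : Chosen p q'
    pp' : p' < q' → Chosen p p'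
    qq' : p < q → Chosen q q'

  module _ {P : Perm n} (A : Atom blk P z) {i j : ℕ} (ch : Chosen i j) (hi : i < n) (hj : j < n) (i<j : i < j)
    (s : blk (to P i) ≡ blk (to P j)) (cov : IsCover P i j) where

    private
      i∈ : ∀ {i j} → Chosen i j → i ≡ p ⊎ i ≡ q
      i∈ pq' = inj₁ refl
      i∈ (pp' _) = inj₁ refl
      i∈ (qq' _) = inj₂ refl
      j∈ : ∀ {i j} → Chosen i j → j ≡ p' ⊎ j ≡ q'
      j∈ pq' = inj₂ refl
      j∈ (pp' _) = inj₁ refl
      j∈ (qq' _) = inj₂ refl
      same : ∀ {i j} → Chosen i j → blk (to P i) ≡ blk (to P j) → blk (to P p) ≡ blk (to P p')
      same pq' s = trans s (block-q' A)
      same (pp' _) s = s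
      same (qq' _) s = trans (sym (block-q A)) (trans s (block-q' A))

      open module E = Exchange blk-mono A zp zp' p≤q p'≤q' p<p' q<q' hi hj (i∈ ch) (j∈ ch) i<j (same ch s) cov using (f; Q)

      -- Where the four values sit after the swap; for a fixed point p = q (or
      -- p' = q') only p (or q') is meaningful.
      P̂ Q̂ P̂' Q̂' : ∀ {i j} → Chosen i j → ℕ
      P̂ pq' = f q'
      P̂ (pp' _) = f p'
      P̂ (qq' _) = f p
      Q̂ (qq' _) = f q'
      Q̂ _ = f q
      P̂' (pp' _) = f p
      P̂' _ = f p'
      Q̂' pq' = f p
      Q̂' (pp' _) = f q'
      Q̂' (qq' _) = f q

      moved : ∀ {i j} (ch : Chosen i j) → f (swapℕ i j p) ≡ P̂ ch × (p < q → f (swapℕ i j q) ≡ Q̂ ch) ×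
        (p' < q' → f (swapℕ i j p') ≡ P̂' ch) × f (swapℕ i j q') ≡ Q̂' ch
      moved pq' = cong f (swap-left p q') , (λ h → cong f (swap-other (λ e → <⇒≢ h (sym e)) (<⇒≢ q<q'))) ,
        (λ h → cong f (swap-other (λ e → <⇒≢ p<p' (sym e)) (<⇒≢ h))) , cong f (swap-right p q')
      moved (pp' k) = cong f (swap-left p p') , (λ h → cong f (swap-other (λ e → <⇒≢ h (sym e)) q≢p')) ,
        (λ h → cong f (swap-right p p')) , cong f (swap-other (λ e → <⇒≢ p<q' (sym e)) (λ e → <⇒≢ k (sym e)))
        where
        q≢p' : q ≢ p'
        q≢p' e = <⇒≢ p<q' (trans (sym (zq A)) (trans (cong z e) zp'))
      moved (qq' k) = cong f (swap-other (<⇒≢ k) (<⇒≢ p<q')) , (λ h → cong f (swap-left q q')) ,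
        (λ h → cong f (swap-other p'≢q (<⇒≢ h))) , cong f (swap-right q q')
        where
        p'≢q : p' ≢ q
        p'≢q e = <⇒≢ p<q' (trans (sym (zq A)) (trans (cong z (sym e)) zp'))

    private
      ρ₄ : ℕ → ℕ
      ρ₄ = env (p ∷ q ∷ p' ∷ q' ∷ 0 ∷ 0 ∷ f p ∷ f q ∷ f p' ∷ f q' ∷ [])
      ρ₆ : ℕ → ℕ → ℕ
      ρ₆ c = env (p ∷ q ∷ p' ∷ q' ∷ c ∷ z c ∷ f p ∷ f q ∷ f p' ∷ f q' ∷ f c ∷ f (z c) ∷ [])
      TwoAt : ℕ → ℕ → Set
      TwoAt i j = TwoCycles p q p' q' i j (f p) (f q) (f p') (f q') (f i) (f j)
      OtherAt : ℕ → ℕ → ℕ → Set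
      OtherAt i j c = OtherCycle p q p' q' i j c (z c) (f p) (f q) (f p') (f q') (f i) (f j) (f c) (f (z c))

    coupled-atom : p' < q → Atom blk Q (renew z (pairs? p q' p' q))
    coupled-atom p'<q = E.pairs-atom (<⇒≢ p<q') (<⇒≢ p'<q) (<⇒≢ p<p') (<⇒≢ (<-trans p<p' p'<q))
      (λ e → <⇒≢ (<-trans p'<q q<q') (sym e)) (λ e → <⇒≢ q<q' (sym e))
      (λ { first → E.is-p ; first⁻ → E.is-q' ; second → E.is-p' ; second⁻ → E.is-q })
      (λ { E.is-p → _ , first ; E.is-q' → _ , first⁻ ; E.is-p' → _ , second ; E.is-q → _ , second⁻ })
      (pair ch E.twoCycles Qp Qq Qp' Qq')
      (λ c t s' → paired ch c E.twoCycles (E.otherCycle c t s') Qp Qq Qp' Qq')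
      where
      p<q : p < q
      p<q = <-trans p<p' p'<q
      p'<q' : p' < q'
      p'<q' = <-trans p'<q q<q'
      Qp = proj₁ (moved ch)
      Qq = proj₁ (proj₂ (moved ch)) p<q
      Qp' = proj₁ (proj₂ (proj₂ (moved ch))) p'<q'
      Qq' = proj₂ (proj₂ (proj₂ (moved ch)))
      pair : ∀ {i j} (ch : Chosen i j) → TwoAt i j →
        ∀ {a b a' b'} → a ≡ P̂ ch → b ≡ Q̂ ch → a' ≡ P̂' ch → b' ≡ Q̂' ch →
        ⟦ pairᶠ 0 1 2 3 4 5 6 7 ⟧ (env (p ∷ q' ∷ p' ∷ q ∷ a ∷ b' ∷ a' ∷ b ∷ []))
      pair ch t refl refl refl refl = go ch t
        where
        go : ∀ {i j} (ch : Chosen i j) → TwoAt i j →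
          ⟦ pairᶠ 0 1 2 3 4 5 6 7 ⟧ (env (p ∷ q' ∷ p' ∷ q ∷ P̂ ch ∷ Q̂' ch ∷ P̂' ch ∷ Q̂ ch ∷ []))
        go pq' t = by-order four (pairAt 0 3 9 7 8 6) pair-03 ρ₄ p'<q t
        go (pp' h) t = by-order four (2 <ᶠ 3 ⇒ᶠ pairAt 0 2 8 7 6 9) pair-02 ρ₄ h p'<q t
        go (qq' h) t = by-order four (0 <ᶠ 1 ⇒ᶠ pairAt 1 3 6 9 8 7) pair-13 ρ₄ h p'<q t
      paired : ∀ {i j} (ch : Chosen i j) → ∀ c → TwoAt i j →
        OtherAt i j c →
        ∀ {a b a' b'} → a ≡ P̂ ch → b ≡ Q̂ ch → a' ≡ P̂' ch → b' ≡ Q̂' ch →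
        ⟦ pairedᶠ 0 1 2 3 4 5 6 7 8 9 10 11 ⟧ (env (p ∷ q' ∷ p' ∷ q ∷ c ∷ z c ∷ a ∷ b' ∷ a' ∷ b ∷ f c ∷ f (z c) ∷ []))
      paired ch c t o refl refl refl refl = go ch t o
        where
        go : ∀ {i j} (ch : Chosen i j) → TwoAt i j →
          OtherAt i j c →
          ⟦ pairedᶠ 0 1 2 3 4 5 6 7 8 9 10 11 ⟧ (env (p ∷ q' ∷ p' ∷ q ∷ c ∷ z c ∷ P̂ ch ∷ Q̂' ch ∷ P̂' ch ∷ Q̂ ch ∷ f c ∷ f (z c) ∷ []))
        go pq' t o = by-order six (pairedAt 0 3 9 7 8 6) paired-03 (ρ₆ c) p'<q t o
        go (pp' h) t o = by-order six (2 <ᶠ 3 ⇒ᶠ pairedAt 0 2 8 7 6 9) paired-02 (ρ₆ c) h p'<q t o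
        go (qq' h) t o = by-order six (0 <ᶠ 1 ⇒ᶠ pairedAt 1 3 6 9 8 7) paired-13 (ρ₆ c) h p'<q t o

    split-exchanged-atom : q < p' → Atom blk Q (renew z (split? p≤q p'≤q'))
    split-exchanged-atom q<p' = E.split-atom q<p' (transport (pair ch E.twoCycles)) λ c t s' → transport' (split ch c E.twoCycles (E.otherCycle c t s'))
      where
      Qp = proj₁ (moved ch)
      Qq = proj₁ (proj₂ (moved ch))
      Qp' = proj₁ (proj₂ (proj₂ (moved ch)))
      Qq' = proj₂ (proj₂ (proj₂ (moved ch)))
      pair : ∀ {i j} (ch : Chosen i j) → TwoAt i j →
        ⟦ splitPairᶠ 0 1 2 3 4 5 6 7 ⟧ (env (p ∷ q ∷ p' ∷ q' ∷ P̂ ch ∷ Q̂ ch ∷ P̂' ch ∷ Q̂' ch ∷ []))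
      pair pq' t = by-order four (splitPairAt 0 3 9 7 8 6) splitPair-03 ρ₄ q<p' t
      pair (pp' h) t = by-order four (2 <ᶠ 3 ⇒ᶠ splitPairAt 0 2 8 7 6 9) splitPair-02 ρ₄ h q<p' t
      pair (qq' h) t = by-order four (0 <ᶠ 1 ⇒ᶠ splitPairAt 1 3 6 9 8 7) splitPair-13 ρ₄ h q<p' t
      split : ∀ {i j} (ch : Chosen i j) → ∀ c → TwoAt i j →
        OtherAt i j c →
        ⟦ splitᶠ 0 1 2 3 4 5 6 7 8 9 10 11 ⟧ (env (p ∷ q ∷ p' ∷ q' ∷ c ∷ z c ∷ P̂ ch ∷ Q̂ ch ∷ P̂' ch ∷ Q̂' ch ∷ f c ∷ f (z c) ∷ []))
      split pq' c t o = by-order six (splitAt 0 3 9 7 8 6) split-03 (ρ₆ c) q<p' t o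
      split (pp' h) c t o = by-order six (2 <ᶠ 3 ⇒ᶠ splitAt 0 2 8 7 6 9) split-02 (ρ₆ c) h q<p' t o
      split (qq' h) c t o = by-order six (0 <ᶠ 1 ⇒ᶠ splitAt 1 3 6 9 8 7) split-13 (ρ₆ c) h q<p' t o
      transport : ⟦ splitPairᶠ 0 1 2 3 4 5 6 7 ⟧ (env (p ∷ q ∷ p' ∷ q' ∷ P̂ ch ∷ Q̂ ch ∷ P̂' ch ∷ Q̂' ch ∷ [])) → SplitPair p q p' q' (to Q)
      transport (a , b , c , d) = subst₂ _<_ (sym Qq') (sym Qp) a ,
        (λ h → subst₂ (λ G H → Rels q q p q' G G H (to Q q') × Rels q q q' p G G (to Q q') H) (sym (Qq h)) (sym Qp)
          (subst (λ K → Rels q q p q' (Q̂ ch) (Q̂ ch) (P̂ ch) K × Rels q q q' p (Q̂ ch) (Q̂ ch) K (P̂ ch)) (sym Qq') (b h))) ,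
        (λ h → subst₂ (λ G H → Rels p' p' p q' G G H (to Q q') × Rels p' p' q' p G G (to Q q') H) (sym (Qp' h)) (sym Qp)
          (subst (λ K → Rels p' p' p q' (P̂' ch) (P̂' ch) (P̂ ch) K × Rels p' p' q' p (P̂' ch) (P̂' ch) K (P̂ ch)) (sym Qq') (c h))) ,
        λ h k → subst₂ (λ G H → Rels q q p' p' G G H H) (sym (Qq h)) (sym (Qp' k)) (d h k)
      transport' : ∀ {c} → ⟦ splitᶠ 0 1 2 3 4 5 6 7 8 9 10 11 ⟧ (env (p ∷ q ∷ p' ∷ q' ∷ c ∷ z c ∷ P̂ ch ∷ Q̂ ch ∷ P̂' ch ∷ Q̂' ch ∷ f c ∷ f (z c) ∷ [])) → E.SplitGoal c
      transport' {c} (a , b , d) =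
        subst₂ (λ G H → Rels p q' c (z c) G H (f c) (f (z c)) × Rels q' p c (z c) H G (f c) (f (z c))) (sym Qp) (sym Qq') a ,
        (λ h → subst (λ G → Rels q q c (z c) G G (f c) (f (z c))) (sym (Qq h)) (b h)) ,
        λ h → subst (λ G → Rels p' p' c (z c) G G (f c) (f (z c))) (sym (Qp' h)) (d h)

  exchange-chosen : q ≢ p' → ∀ {i j} → Chosen i j → ∃ λ z' → ExchangedAtom {n} blk z z' i j
  exchange-chosen ne ch with <-cmp p' q
  ... | tri< h _ _ = _ , λ A hi hj i<j s cov → coupled-atom A ch hi hj i<j s cov h
  ... | tri≈ _ e _ = ⊥-elim (ne (sym e))
  ... | tri> _ _ h = _ , λ A hi hj i<j s cov → split-exchanged-atom A ch hi hj i<j s cov h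

-- The cycles of the block of i after j has taken the place of i; a is the
-- partner of i.  The other block is obtained by reversing the orders.
data Side (_≺_ : ℕ → ℕ → Set) (i a j : ℕ) : ℕ → ℕ → Set where
  alone : i ≡ a ⊎ (i ≺ a × a ≺ j) → Side _≺_ i a j j j
  freed : i ≺ a → a ≺ j → Side _≺_ i a j a a
  joined : a ≺ i ⊎ j ≺ a → Side _≺_ i a j j a
  joined⁻ : a ≺ i ⊎ j ≺ a → Side _≺_ i a j a j

module SideFormulas (_≺ᶠ_ : ℕ → ℕ → Formula) where

  -- 0 = i, 1 = a, 2 = j, 3, 4 = another cycle; positions of i, a, 3, 4 are 5, 6, 7, 8.
  side other otherGoal sideGoal : Formula
  side = 0 ≺ᶠ 2 ∧ᶠ cycleᶠ 0 1 5 6 ∧ᶠ (0 ≺ᶠ 1 ⇒ᶠ 1 ≺ᶠ 2 ⇒ᶠ 6 ≺ᶠ 5)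
  other = ((apartᶠ 3 0 ∧ᶠ apartᶠ 3 1 ∧ᶠ apartᶠ 3 2) ∧ᶠ (apartᶠ 4 0 ∧ᶠ apartᶠ 4 1 ∧ᶠ apartᶠ 4 2)) ∧ᶠ cycleᶠ 3 4 7 8 ∧ᶠ
    (0 ≺ᶠ 3 ⇒ᶠ 3 ≺ᶠ 2 ⇒ᶠ 7 ≺ᶠ 5) ∧ᶠ (0 ≺ᶠ 4 ⇒ᶠ 4 ≺ᶠ 2 ⇒ᶠ 8 ≺ᶠ 5) ∧ᶠ cyclesᶠ 0 1 3 4 5 6 7 8
  otherGoal = (0 ≈ᶠ 1 ∨ᶠ 0 ≺ᶠ 1 ∧ᶠ 1 ≺ᶠ 2 ⇒ᶠ relsᶠ 2 2 3 4 5 5 7 8) ∧ᶠ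
    (0 ≺ᶠ 1 ⇒ᶠ 1 ≺ᶠ 2 ⇒ᶠ relsᶠ 1 1 3 4 6 6 7 8) ∧ᶠ
    (1 ≺ᶠ 0 ∨ᶠ 2 ≺ᶠ 1 ⇒ᶠ relsᶠ 2 1 3 4 5 6 7 8 ∧ᶠ relsᶠ 1 2 3 4 6 5 7 8)
  sideGoal = (0 ≺ᶠ 1 ⇒ᶠ 1 ≺ᶠ 2 ⇒ᶠ relsᶠ 2 2 1 1 5 5 6 6) ∧ᶠ
    (1 ≺ᶠ 0 ∨ᶠ 2 ≺ᶠ 1 ⇒ᶠ (2 <ᶠ 1 ⇒ᶠ 6 <ᶠ 5) ∧ᶠ (1 <ᶠ 2 ⇒ᶠ 5 <ᶠ 6))

module SideUp = SideFormulas _<ᶠ_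
module SideDown = SideFormulas (λ a b → b <ᶠ a)

module _ where
  private
    points points′ : List (List ℕ)
    points = (0 ∷ 1 ∷ 2 ∷ 3 ∷ 4 ∷ []) ∷ (5 ∷ 6 ∷ 7 ∷ 8 ∷ []) ∷ []
    points′ = (0 ∷ 1 ∷ 2 ∷ []) ∷ (5 ∷ 6 ∷ []) ∷ []

  sideUp-other : ∀ ρ → ⟦ apartᶠ 1 2 ⇒ᶠ SideUp.side ⇒ᶠ SideUp.other ⇒ᶠ SideUp.otherGoal ⟧ ρ
  sideUp-other = by-order points (apartᶠ 1 2 ⇒ᶠ SideUp.side ⇒ᶠ SideUp.other ⇒ᶠ SideUp.otherGoal) refl

  sideUp-self : ∀ ρ → ⟦ apartᶠ 1 2 ⇒ᶠ SideUp.side ⇒ᶠ SideUp.sideGoal ⟧ ρ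
  sideUp-self = by-order points′ (apartᶠ 1 2 ⇒ᶠ SideUp.side ⇒ᶠ SideUp.sideGoal) refl

  sideDown-other : ∀ ρ → ⟦ apartᶠ 1 2 ⇒ᶠ SideDown.side ⇒ᶠ SideDown.other ⇒ᶠ SideDown.otherGoal ⟧ ρ
  sideDown-other = by-order points (apartᶠ 1 2 ⇒ᶠ SideDown.side ⇒ᶠ SideDown.other ⇒ᶠ SideDown.otherGoal) refl

  sideDown-self : ∀ ρ → ⟦ apartᶠ 1 2 ⇒ᶠ SideDown.side ⇒ᶠ SideDown.sideGoal ⟧ ρ
  sideDown-self = by-order points′ (apartᶠ 1 2 ⇒ᶠ SideDown.side ⇒ᶠ SideDown.sideGoal) refl

SideSelf : (_≺_ : ℕ → ℕ → Set) (i a j J A : ℕ) → Set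
SideSelf _≺_ i a j J A = (i ≺ a → a ≺ j → Rels j j a a J J A A) × (a ≺ i ⊎ j ≺ a → (j < a → A < J) × (a < j → J < A))

SideOther : (_≺_ : ℕ → ℕ → Set) (i a j c d J A C D : ℕ) → Set
SideOther _≺_ i a j c d J A C D =
  ((¬ a < i × ¬ i < a) ⊎ (i ≺ a × a ≺ j) → Rels j j c d J J C D) × (i ≺ a → a ≺ j → Rels a a c d A A C D) ×
  (a ≺ i ⊎ j ≺ a → Rels j a c d J A C D × Rels a j c d A J C D)

module SideProperties (_≺_ : ℕ → ℕ → Set) (≺-irrefl : ∀ {x} → ¬ (x ≺ x)) (≺-asym : ∀ {x y} → x ≺ y → ¬ (y ≺ x))
  (≺-cmp : ∀ x y → x ≺ y ⊎ x ≡ y ⊎ y ≺ x) {i a j : ℕ} (a≢j : a ≢ j) where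

  private
    clash : ∀ {A : Set} → i ≺ a → a ≺ j → a ≺ i ⊎ j ≺ a → A
    clash h k (inj₁ l) = ⊥-elim (≺-asym h l)
    clash h k (inj₂ l) = ⊥-elim (≺-asym k l)

    clash′ : ∀ {A : Set} → i ≺ j → i ≡ a ⊎ (i ≺ a × a ≺ j) → a ≺ i ⊎ j ≺ a → A
    clash′ l (inj₁ refl) (inj₁ m) = ⊥-elim (≺-irrefl m)
    clash′ l (inj₁ refl) (inj₂ m) = ⊥-elim (≺-asym l m)
    clash′ l (inj₂ (h , k)) m = clash h k m

  side-sym : ∀ {x y} → Side _≺_ i a j x y → Side _≺_ i a j y x
  side-sym (alone h) = alone h
  side-sym (freed h k) = freed h k
  side-sym (joined h) = joined⁻ h
  side-sym (joined⁻ h) = joined h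

  side-functional : i ≺ j → ∀ {x y y'} → Side _≺_ i a j x y → Side _≺_ i a j x y' → y ≡ y'
  side-functional l (alone h) (alone k) = refl
  side-functional l (alone h) (freed _ _) = refl
  side-functional l (alone h) (joined k) = clash′ l h k
  side-functional l (alone h) (joined⁻ _) = refl
  side-functional l (freed _ _) (alone _) = refl
  side-functional l (freed _ _) (freed _ _) = refl
  side-functional l (freed _ _) (joined _) = refl
  side-functional l (freed h k) (joined⁻ m) = clash h k m
  side-functional l (joined k) (alone h) = clash′ l h k
  side-functional l (joined _) (freed _ _) = refl
  side-functional l (joined _) (joined _) = refl
  side-functional l (joined _) (joined⁻ _) = ⊥-elim (a≢j refl)
  side-functional l (joined⁻ _) (alone _) = refl
  side-functional l (joined⁻ m) (freed h k) = clash h k m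
  side-functional l (joined⁻ _) (joined _) = ⊥-elim (a≢j refl)
  side-functional l (joined⁻ _) (joined⁻ _) = refl

  side-at-j : Σ ℕ (Side _≺_ i a j j)
  side-at-j with ≺-cmp i a | ≺-cmp a j
  ... | inj₂ (inj₁ e) | _ = j , alone (inj₁ e)
  ... | inj₂ (inj₂ h) | _ = a , joined (inj₁ h)
  ... | inj₁ h | inj₁ k = j , alone (inj₂ (h , k))
  ... | inj₁ h | inj₂ (inj₁ e) = ⊥-elim (a≢j e)
  ... | inj₁ h | inj₂ (inj₂ k) = a , joined (inj₂ k)

  side-at-a : i ≢ a → Σ ℕ (Side _≺_ i a j a)
  side-at-a ne with ≺-cmp i a | ≺-cmp a j
  ... | inj₂ (inj₁ e) | _ = ⊥-elim (ne e)
  ... | inj₂ (inj₂ h) | _ = j , joined⁻ (inj₁ h)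
  ... | inj₁ h | inj₁ k = a , freed h k
  ... | inj₁ h | inj₂ (inj₁ e) = ⊥-elim (a≢j e)
  ... | inj₁ h | inj₂ (inj₂ k) = j , joined⁻ (inj₂ k)

  side-domain : i ≺ j → ∀ {x y} → Side _≺_ i a j x y → x ≡ j ⊎ (x ≡ a × a ≢ i)
  side-domain l (alone _) = inj₁ refl
  side-domain l (freed h _) = inj₂ (refl , λ e → ≺-irrefl (subst (_≺ a) (sym e) h))
  side-domain l (joined _) = inj₁ refl
  side-domain l (joined⁻ h) = inj₂ (refl , ne h)
    where
    ne : a ≺ i ⊎ j ≺ a → a ≢ i
    ne (inj₁ k) e = ≺-irrefl (subst (_≺ i) e k)
    ne (inj₂ k) e = ≺-asym l (subst (j ≺_) e k)

  side-rel : ∀ (g : ℕ → ℕ) → i ≺ j → SideSelf _≺_ i a j (g j) (g a) → ∀ {x x' y y'} →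
    Side _≺_ i a j x x' → Side _≺_ i a j y y' → Rel x x' y y' (g x) (g x') (g y) (g y')
  side-rel g l s (alone _) (alone _) = rel-self
  side-rel g l (s , _) (alone _) (freed h k) = proj₁ (s h k)
  side-rel g l s (alone h) (joined k) = clash′ l h k
  side-rel g l s (alone h) (joined⁻ k) = clash′ l h k
  side-rel g l (s , _) (freed h k) (alone _) = proj₂ (s h k)
  side-rel g l s (freed _ _) (freed _ _) = rel-self
  side-rel g l s (freed h k) (joined m) = clash h k m
  side-rel g l s (freed h k) (joined⁻ m) = clash h k m
  side-rel g l s (joined k) (alone h) = clash′ l h k
  side-rel g l s (joined m) (freed h k) = clash h k m
  side-rel g l s (joined _) (joined _) = rel-self
  side-rel g l s (joined _) (joined⁻ _) = rel-partner
  side-rel g l s (joined⁻ k) (alone h) = clash′ l h k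
  side-rel g l s (joined⁻ m) (freed h k) = clash h k m
  side-rel g l s (joined⁻ _) (joined _) = rel-partner
  side-rel g l s (joined⁻ _) (joined⁻ _) = rel-self

  side-desc : ∀ (g : ℕ → ℕ) → SideSelf _≺_ i a j (g j) (g a) → ∀ {x y} → Side _≺_ i a j x y → x < y → g y < g x
  side-desc g s (alone _) h = ⊥-elim (<-irrefl refl h)
  side-desc g s (freed _ _) h = ⊥-elim (<-irrefl refl h)
  side-desc g (_ , s) (joined m) h = proj₁ (s m) h
  side-desc g (_ , s) (joined⁻ m) h = proj₂ (s m) h

  side-old : ∀ (g : ℕ → ℕ) {c d C D} → SideOther _≺_ i a j c d (g j) (g a) C D → ∀ {x x'} →
    Side _≺_ i a j x x' → Rels x x' c d (g x) (g x') C D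
  side-old g (s , _) (alone (inj₁ refl)) = s (inj₁ (<-irrefl refl , <-irrefl refl))
  side-old g (s , _) (alone (inj₂ h)) = s (inj₂ h)
  side-old g (_ , s , _) (freed h k) = s h k
  side-old g (_ , _ , s) (joined m) = proj₁ (s m)
  side-old g (_ , _ , s) (joined⁻ m) = proj₂ (s m)

  -- If `i` is a fixed point then `a = i` is itself moved by the swap. In that case every clause
  -- mentioning the position of `a` is vacuous, so its value may be replaced.
  module _ (l : i ≺ j) {J A A' : ℕ} (moved : i ≢ a → A ≡ A') where

    private
      apart-< : ∀ {X : Set} → (i ≢ a → X) → i ≺ a → X
      apart-< g h = g λ e → ≺-irrefl (subst (i ≺_) (sym e) h)

      apart-⊎ : ∀ {X : Set} → (i ≢ a → X) → a ≺ i ⊎ j ≺ a → X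
      apart-⊎ g (inj₁ h) = g λ e → ≺-irrefl (subst (_≺ i) (sym e) h)
      apart-⊎ g (inj₂ h) = g λ e → ≺-asym l (subst (j ≺_) (sym e) h)

    side-self-moved : SideSelf _≺_ i a j J A → SideSelf _≺_ i a j J A'
    side-self-moved (s , t) = (λ h k → apart-< (λ ne → subst (λ X → Rels j j a a J J X X) (moved ne) (s h k)) h) ,
      λ h → apart-⊎ (λ ne → subst (λ X → (j < a → X < J) × (a < j → J < X)) (moved ne) (t h)) h

    side-other-moved : ∀ {c d C D} → SideOther _≺_ i a j c d J A C D → SideOther _≺_ i a j c d J A' C D
    side-other-moved {c} {d} {C} {D} (r , s , t) = r , (λ h k → apart-< (λ ne → subst (λ X → Rels a a c d X X C D) (moved ne) (s h k)) h) ,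
      λ h → apart-⊎ (λ ne → subst (λ X → Rels j a c d J X C D × Rels a j c d X J C D) (moved ne) (t h)) h

<-cmp⊎ : ∀ x y → x < y ⊎ x ≡ y ⊎ y < x
<-cmp⊎ x y with <-cmp x y
... | tri< h _ _ = inj₁ h
... | tri≈ _ e _ = inj₂ (inj₁ e)
... | tri> _ _ h = inj₂ (inj₂ h)

>-cmp⊎ : ∀ x y → x > y ⊎ x ≡ y ⊎ y > x
>-cmp⊎ x y with <-cmp x y
... | tri< h _ _ = inj₂ (inj₂ h)
... | tri≈ _ e _ = inj₂ (inj₁ e)
... | tri> _ _ h = inj₁ h

module _ {n : ℕ} {blk : ℕ → ℕ} (blk-mono : ∀ {x y} → x ≤ y → blk x ≤ blk y) {z : ℕ → ℕ} {i j : ℕ}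
  (i<j : i < j) (zi≢j : z i ≢ j) (zj≢i : z j ≢ i) where

  private
    module S₁ = SideProperties _<_ (<-irrefl refl) <-asym <-cmp⊎ {i} {z i} {j} zi≢j
    module S₂ = SideProperties _>_ (<-irrefl refl) <-asym >-cmp⊎ {j} {z j} {i} zj≢i

    New : ℕ → ℕ → Set
    New x y = Side _<_ i (z i) j x y ⊎ Side _>_ j (z j) i x y

    data Four (v : ℕ) : Set where
      is-i : v ≡ i → Four v
      is-j : v ≡ j → Four v
      is-zi : v ≡ z i → Four v
      is-zj : v ≡ z j → Four v

    four-new : ∀ {v} → Four v → Σ ℕ (New v)
    four-new (is-i refl) = _ , inj₂ (proj₂ S₂.side-at-j)
    four-new (is-j refl) = _ , inj₁ (proj₂ S₁.side-at-j)
    four-new (is-zi refl) with i ≟ z i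
    ... | yes e = subst (λ v → Σ ℕ (New v)) e (_ , inj₂ (proj₂ S₂.side-at-j))
    ... | no ne = _ , inj₁ (proj₂ (S₁.side-at-a ne))
    four-new (is-zj refl) with j ≟ z j
    ... | yes e = subst (λ v → Σ ℕ (New v)) e (_ , inj₁ (proj₂ S₁.side-at-j))
    ... | no ne = _ , inj₂ (proj₂ (S₂.side-at-a ne))

    new-four : ∀ {v w} → New v w → Four v
    new-four (inj₁ h) with S₁.side-domain i<j h
    ... | inj₁ e = is-j e
    ... | inj₂ (e , _) = is-zi e
    new-four (inj₂ h) with S₂.side-domain i<j h
    ... | inj₁ e = is-i e
    ... | inj₂ (e , _) = is-zj e

    new? : ∀ v → Dec (Σ ℕ (New v))
    new? v with v ≟ i | v ≟ j | v ≟ z i | v ≟ z j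
    ... | yes e | _ | _ | _ = yes (four-new (is-i e))
    ... | _ | yes e | _ | _ = yes (four-new (is-j e))
    ... | _ | _ | yes e | _ = yes (four-new (is-zi e))
    ... | _ | _ | _ | yes e = yes (four-new (is-zj e))
    ... | no p | no q | no r | no s = no λ { (_ , h) → none (new-four h) }
      where
      none : ¬ Four v
      none (is-i e) = p e
      none (is-j e) = q e
      none (is-zi e) = r e
      none (is-zj e) = s e

  -- The two blocks do not interact, so each is treated as a block in which one value has replaced
  -- another at the same position, and nested cycles do no harm. A partner of `i` between `i` and
  -- `j` precedes the position taken over by `j`, which is the wrong order for a cycle, so the two
  -- become fixed points.
  exchange-across : ∃ λ z' → ∀ {P : Perm n} → Atom blk P z → (hi : i < n) (hj : j < n) → blk (to P i) < blk (to P j) →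
    IsCover P i j → Atom blk (mulʳ P i j hi hj) z'
  exchange-across = renew z new? , go
    where
    go : ∀ {P : Perm n} → Atom blk P z → (hi : i < n) (hj : j < n) → blk (to P i) < blk (to P j) →
      IsCover P i j → Atom blk (mulʳ P i j hi hj) (renew z new?)
    go {P} A hi hj blk-< (_ , cover) = renew-atom blk-mono A Q new? functional (λ { (inj₁ h) → inj₁ (S₁.side-sym h) ; (inj₂ h) → inj₂ (S₂.side-sym h) })
      (λ v h k → h (four-new (four-z (new-four (proj₂ k)))))
      (λ v h → cong f (swap-other (λ e → h (four-new (is-i e))) (λ e → h (four-new (is-j e)))))
      (λ h → bound (new-four h))
      (λ { (inj₁ h) → trans (block₁ (S₁.side-sym h)) (sym (block₁ h)) ; (inj₂ h) → trans (block₂ (S₂.side-sym h)) (sym (block₂ h)) })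
      (λ { (inj₁ h) → S₁.side-desc (to Q) self₁ h ; (inj₂ h) → S₂.side-desc (to Q) self₂ h })
      (λ { (inj₁ h) (inj₁ k) s → S₁.side-rel (to Q) i<j self₁ h k
         ; (inj₂ h) (inj₂ k) s → S₂.side-rel (to Q) i<j self₂ h k
         ; (inj₁ h) (inj₂ k) s → ⊥-elim (<⇒≢ blk-< (trans (sym (block₁ h)) (trans s (block₂ k))))
         ; (inj₂ h) (inj₁ k) s → ⊥-elim (<⇒≢ blk-< (trans (sym (block₁ k)) (trans (sym s) (block₂ h)))) })
      (λ { c (inj₁ h) k s → S₁.side-old (to Q) (other₁ c (λ t → k (four-new t)) (trans (sym (block₁ h)) s)) h
         ; c (inj₂ h) k s → S₂.side-old (to Q) (other₂ c (λ t → k (four-new t)) (trans (sym (block₂ h)) s)) h })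
      where
      f : ℕ → ℕ
      f = to P
      Q : Perm n
      Q = mulʳ P i j hi hj
      Qj : to Q j ≡ f i
      Qj = cong f (swap-right i j)
      Qi : to Q i ≡ f j
      Qi = cong f (swap-left i j)
      four-z : ∀ {v} → Four (z v) → Four v
      four-z (is-i e) = is-zi (trans (sym (invol A _)) (cong z e))
      four-z (is-j e) = is-zj (trans (sym (invol A _)) (cong z e))
      four-z (is-zi e) = is-i (z-injective A e)
      four-z (is-zj e) = is-j (z-injective A e)
      bound : ∀ {v} → Four v → v < n
      bound (is-i refl) = hi
      bound (is-j refl) = hj
      bound (is-zi refl) = z-bounded A hi
      bound (is-zj refl) = z-bounded A hj
      moved₁ : i ≢ z i → f (z i) ≡ to Q (z i)
      moved₁ ne = cong f (sym (swap-other (λ e → ne (sym e)) zi≢j))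
      moved₂ : j ≢ z j → f (z j) ≡ to Q (z j)
      moved₂ ne = cong f (sym (swap-other zj≢i (λ e → ne (sym e))))
      block₁ : ∀ {x y} → Side _<_ i (z i) j x y → blk (to Q x) ≡ blk (f i)
      block₁ h with S₁.side-domain i<j h
      ... | inj₁ refl = cong blk Qj
      ... | inj₂ (refl , ne) = trans (cong blk (sym (moved₁ λ e → ne (sym e)))) (colour A i)
      block₂ : ∀ {x y} → Side _>_ j (z j) i x y → blk (to Q x) ≡ blk (f j)
      block₂ h with S₂.side-domain i<j h
      ... | inj₁ refl = cong blk Qi
      ... | inj₂ (refl , ne) = trans (cong blk (sym (moved₂ λ e → ne (sym e)))) (colour A j)
      functional : ∀ {x y y'} → New x y → New x y' → y ≡ y'
      functional (inj₁ h) (inj₁ k) = S₁.side-functional i<j h k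
      functional (inj₂ h) (inj₂ k) = S₂.side-functional i<j h k
      functional (inj₁ h) (inj₂ k) = ⊥-elim (<⇒≢ blk-< (trans (sym (block₁ h)) (block₂ k)))
      functional (inj₂ h) (inj₁ k) = ⊥-elim (<⇒≢ blk-< (trans (sym (block₁ k)) (block₂ h)))
      -- A value of the block of `i` cannot be positioned beyond `f j`, so only one alternative of
      -- the cover condition remains.
      before : ∀ x → blk (f i) ≡ blk (f x) → i < x → x < j → f x < f i
      before x s h k with cover x h k
      ... | inj₁ l = l
      ... | inj₂ l = ⊥-elim (<⇒≱ blk-< (subst (blk (f j) ≤_) (sym s) (blk-mono (<⇒≤ l))))
      after : ∀ x → blk (f j) ≡ blk (f x) → i < x → x < j → f j < f x
      after x s h k with cover x h k
      ... | inj₂ l = l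
      ... | inj₁ l = ⊥-elim (<⇒≱ blk-< (subst (_≤ blk (f i)) (sym s) (blk-mono (<⇒≤ l))))
      self₁ : SideSelf _<_ i (z i) j (to Q j) (to Q (z i))
      self₁ = subst (λ J → SideSelf _<_ i (z i) j J (to Q (z i))) (sym Qj) (S₁.side-self-moved i<j moved₁
        (sideUp-self (env (i ∷ z i ∷ j ∷ 0 ∷ 0 ∷ f i ∷ f (z i) ∷ [])) (≢⇒<⊎> zi≢j)
          (i<j , cycle A refl , before (z i) (sym (colour A i)))))
      self₂ : SideSelf _>_ j (z j) i (to Q i) (to Q (z j))
      self₂ = subst (λ J → SideSelf _>_ j (z j) i J (to Q (z j))) (sym Qi) (S₂.side-self-moved i<j moved₂
        (sideDown-self (env (j ∷ z j ∷ i ∷ 0 ∷ 0 ∷ f j ∷ f (z j) ∷ [])) (≢⇒<⊎> zj≢i)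
          (i<j , cycle A refl , λ h k → after (z j) (sym (colour A j)) k h)))
      apart : ∀ {c v} → ¬ Four c → Four v → c < v ⊎ v < c
      apart h k = ≢⇒<⊎> λ e → h (subst Four (sym e) k)
      four-z⁻ : ∀ {c} → ¬ Four c → ¬ Four (z c)
      four-z⁻ h k = h (four-z k)
      other₁ : ∀ c → ¬ Four c → blk (f i) ≡ blk (f c) → SideOther _<_ i (z i) j c (z c) (to Q j) (to Q (z i)) (f c) (f (z c))
      other₁ c t s = subst (λ J → SideOther _<_ i (z i) j c (z c) J (to Q (z i)) (f c) (f (z c))) (sym Qj) (S₁.side-other-moved i<j moved₁
        (sideUp-other (env (i ∷ z i ∷ j ∷ c ∷ z c ∷ f i ∷ f (z i) ∷ f c ∷ f (z c) ∷ [])) (≢⇒<⊎> zi≢j)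
          (i<j , cycle A refl , before (z i) (sym (colour A i)))
          (((apart t (is-i refl) , apart t (is-zi refl) , apart t (is-j refl)) ,
            (apart (four-z⁻ t) (is-i refl) , apart (four-z⁻ t) (is-zi refl) , apart (four-z⁻ t) (is-j refl))) , cycle A refl ,
            before c s , before (z c) (trans s (sym (colour A c))) , cycles A refl refl s)))
      other₂ : ∀ c → ¬ Four c → blk (f j) ≡ blk (f c) → SideOther _>_ j (z j) i c (z c) (to Q i) (to Q (z j)) (f c) (f (z c))
      other₂ c t s = subst (λ J → SideOther _>_ j (z j) i c (z c) J (to Q (z j)) (f c) (f (z c))) (sym Qi) (S₂.side-other-moved i<j moved₂
        (sideDown-other (env (j ∷ z j ∷ i ∷ c ∷ z c ∷ f j ∷ f (z j) ∷ f c ∷ f (z c) ∷ [])) (≢⇒<⊎> zj≢i)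
          (i<j , cycle A refl , λ h k → after (z j) (sym (colour A j)) k h)
          (((apart t (is-j refl) , apart t (is-zj refl) , apart t (is-i refl)) ,
            (apart (four-z⁻ t) (is-j refl) , apart (four-z⁻ t) (is-zj refl) , apart (four-z⁻ t) (is-i refl))) , cycle A refl ,
            (λ h k → after c s k h) , (λ h k → after (z c) (trans s (sym (colour A c))) k h) , cycles A refl refl s)))

module _ {n : ℕ} {blk : ℕ → ℕ} (blk-mono : ∀ {x y} → x ≤ y → blk x ≤ blk y) {z z' : ℕ → ℕ}
  {V : Perm n} (A : Atom blk V z) {i j : ℕ} (hi : i < n) (hj : j < n) (i<j : i < j) (cov : IsCover V i j)
  (A' : Atom blk (mulʳ V i j hi hj) z') where

  -- `V` and its swap only serve to exclude nested cycles. The involution found depends on `z`, `i`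
  -- and `j`.
  exchange-within : blk (to V i) ≡ blk (to V j) → ∃ λ z'' → ExchangedAtom {n} blk z z'' i j
  exchange-within s = go (≤-total i (z i)) (≤-total j (z j))
    where
    ne-partner : z i ≢ j
    ne-partner e = <-asym (proj₁ cov) (subst (λ v → to V v < to V i) e (desc A i (subst (i <_) (sym e) i<j)))
    zj≢i : z j ≢ i
    zj≢i e = ne-partner (trans (cong z (sym e)) (invol A j))
    no-max : z j < i → z j < z i → ⊥
    no-max = cover-not-nested-max A {i} {j} {hi} {hj} A' i<j s (proj₁ cov)
    no-min : j < z i → z j < z i → ⊥
    no-min = cover-not-nested-min A {i} {j} {hi} {hj} A' i<j s (proj₁ cov)
    zi≢zj : z i ≢ z j
    zi≢zj e = <⇒≢ i<j (z-injective A e)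
    lt : ∀ {a b} → a ≢ b → ¬ (b < a) → a < b
    lt ne h = ≤∧≢⇒< (≮⇒≥ h) ne
    go : i ≤ z i ⊎ z i ≤ i → j ≤ z j ⊎ z j ≤ j → ∃ λ z'' → ExchangedAtom {n} blk z z'' i j
    -- In every case `i` and its partner are named so that `p ≤ q`, likewise for `j`; the
    -- inequalities `p < p'` and `q < q'` are what the excluded nestings leave over.
    go (inj₁ h) (inj₂ k) = exchange-chosen blk-mono refl (invol A j) h k
      (lt (λ e → zj≢i (sym e)) λ l → no-max l (<-≤-trans l h))
      (lt ne-partner λ l → no-min l (≤-<-trans k l)) (λ e → zi≢zj e) pq'
    go (inj₁ h) (inj₁ k) with m≤n⇒m<n∨m≡n k
    ... | inj₁ k' = exchange-chosen blk-mono refl refl h k i<j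
            (lt zi≢zj λ l → no-min (<-trans k' l) l) ne-partner (pp' k')
    ... | inj₂ e = exchange-chosen blk-mono refl (sym e) h ≤-refl i<j
            (lt ne-partner λ l → no-min l (subst (_< z i) e l)) ne-partner pq'
    go (inj₂ h) (inj₂ k) with m≤n⇒m<n∨m≡n h
    ... | inj₁ h' = exchange-chosen blk-mono (invol A i) (invol A j) h k
            (lt zi≢zj λ l → no-max (<-trans l h') l) i<j (λ e → zj≢i (sym e)) (qq' h')
    ... | inj₂ e = exchange-chosen blk-mono e (invol A j) ≤-refl k
            (lt (λ e' → zj≢i (sym e')) λ l → no-max l (subst (z j <_) (sym e) l)) i<j (λ e' → zj≢i (sym e')) pq'
    go (inj₂ h) (inj₁ k) with m≤n⇒m<n∨m≡n h | m≤n⇒m<n∨m≡n k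
    ... | inj₁ h' | inj₁ k' = _ , λ B hi hj _ s cov → crossing-atom blk-mono (invol A i) refl h k (<-trans h' i<j) (<-trans i<j k') h' k' i<j B hi hj i<j s cov
    ... | inj₂ e | inj₁ k' = exchange-chosen blk-mono e refl ≤-refl k i<j (<-trans i<j k') (<⇒≢ i<j) (pp' k')
    ... | inj₂ e | inj₂ e' = exchange-chosen blk-mono e (sym e') ≤-refl ≤-refl i<j i<j (<⇒≢ i<j) pq'
    ... | inj₁ h' | inj₂ e' = exchange-chosen blk-mono (invol A i) (sym e') h ≤-refl (<-trans h' i<j) i<j (<⇒≢ i<j) (qq' h')

  -- The constructed involution works for `V`, where uniqueness identifies it with `z'`, and by
  -- construction it works for `W` as well.
  exchange : ∀ {W : Perm n} → Atom blk W z → (∀ v → blk (to W v) ≡ blk (to V v)) → IsCover W i j → Atom blk (mulʳ W i j hi hj) z'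
  exchange {W} B same cov' with blk (to V i) <? blk (to V j)
  ... | yes l = conclude (exchange-across blk-mono {z} i<j
            (λ e → <⇒≢ l (trans (sym (colour A i)) (cong (λ v → blk (to V v)) e)))
            (λ e → <⇒≢ l (trans (cong (λ v → blk (to V v)) (sym e)) (colour A j))))
    where
    conclude : (∃ λ z'' → ∀ {P : Perm n} → Atom blk P z → (hi : i < n) (hj : j < n) → blk (to P i) < blk (to P j) →
      IsCover P i j → Atom blk (mulʳ P i j hi hj) z'') → Atom blk (mulʳ W i j hi hj) z'
    conclude (z'' , f) = Atom-cong (λ _ → refl) (λ v → sym (atom-unique (f A hi hj l cov) A' v))
      (f B hi hj (subst₂ _<_ (sym (same i)) (sym (same j)) l) cov')
  ... | no l = conclude (exchange-within s)
    where
    s : blk (to V i) ≡ blk (to V j)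
    s = ≤-antisym (blk-mono (<⇒≤ (proj₁ cov))) (≮⇒≥ l)
    conclude : (∃ λ z'' → ExchangedAtom {n} blk z z'' i j) → Atom blk (mulʳ W i j hi hj) z'
    conclude (z'' , f) = Atom-cong (λ _ → refl) (λ v → sym (atom-unique (f A hi hj i<j s cov) A' v))
      (f B hi hj i<j (trans (same i) (trans s (sym (same j)))) cov')

-- Moves between the atoms of a μ-involution

Ascentˡ Descentˡ : ∀ {n} → Perm n → ℕ → Set
Ascentˡ P = Ascent (inverse P)
Descentˡ P = Descent (inverse P)

module _ {n : ℕ} {V W : Perm n} (i : ℕ) (hi : i < n) (hj : suc i < n) (V⊑W : V ⊑ W) where

  private
    inv : inverse V ⊑ inverse W
    inv = ⊑-inverse {V = V} {W} V⊑W

  lower-bothˡ : Descentˡ V i → stepˡ V i hi hj ⊑ stepˡ W i hi hj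
  lower-bothˡ h = ⊑-inverse (lower-both i hi hj inv h)

  lower-rightˡ : Ascentˡ V i → V ⊑ stepˡ W i hi hj
  lower-rightˡ h = below (rank-≥ (⊑-inverse {V = inverse V} (lower-right i hi hj inv h)))

  raise-bothˡ : Ascentˡ W i → stepˡ V i hi hj ⊑ stepˡ W i hi hj
  raise-bothˡ h = ⊑-inverse (raise-both i hi hj inv h)

⊑-raiseˡ : ∀ {n} (V : Perm n) i hi hj → Ascentˡ V i → V ⊑ stepˡ V i hi hj
⊑-raiseˡ V i hi hj h = below (rank-≥ (⊑-inverse {V = inverse V} (⊑-raise (inverse V) i hi hj h)))

braid : ∀ k x → swapℕ k (suc k) (swapℕ (suc k) (suc (suc k)) (swapℕ k (suc k) x)) ≡
  swapℕ (suc k) (suc (suc k)) (swapℕ k (suc k) (swapℕ (suc k) (suc (suc k)) x))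
braid k x = trans lhs (sym rhs)
  where
  s t : ℕ → ℕ
  s = swapℕ k (suc k)
  t = swapℕ (suc k) (suc (suc k))
  lhs : s (t (s x)) ≡ swapℕ k (suc (suc k)) x
  lhs = trans (swap-conj (swap-injective k (suc k)) (suc k) (suc (suc k)) (s x))
    (trans (cong₂ (λ a b → swapℕ a b (s (s x))) (swap-right k (suc k)) (swap-other (λ e → <⇒≢ (s≤s (n≤1+n k)) (sym e)) (λ e → 1+n≢n e)))
      (cong (swapℕ k (suc (suc k))) (swap-involutive k (suc k) x)))
  rhs : t (s (t x)) ≡ swapℕ k (suc (suc k)) x
  rhs = trans (swap-conj (swap-injective (suc k) (suc (suc k))) k (suc k) (t x))
    (trans (cong₂ (λ a b → swapℕ a b (t (t x))) (swap-other (λ e → 1+n≢n (sym e)) (<⇒≢ (s≤s (n≤1+n k)))) (swap-left (suc k) (suc (suc k))))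
      (cong (swapℕ k (suc (suc k))) (swap-involutive (suc k) (suc (suc k)) x)))

module _ {n : ℕ} (i : ℕ) (hi : i < n) (hi' : suc i < n) (j : ℕ) (hj : j < n) (hj' : suc j < n) where

  private
    s t : Perm n → Perm n
    s P = stepˡ P i hi hi'
    t P = stepˡ P j hj hj'

    s-s : ∀ (P : Perm n) k → to (s (s P)) k ≡ to P k
    s-s P k = swap-involutive i (suc i) (to P k)

  -- For W = (b c a) in positions k, k+1, k+2 and {i , j} = {k , k+1} the last
  -- permutation is (c a b), or conversely.
  transfer : ∀ {V W : Perm n} → Descentˡ W i → Descentˡ (s W) j → Ascentˡ (t (s W)) i → Ascentˡ (s (t (s W))) j →
    V ⊑ W → V ⊑ t (s (t (s W))) ⊎ (Descentˡ V i × Descentˡ (s V) j × t (s (t (s V))) ⊑ t (s (t (s W))))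
  transfer {V} {W} dW dsW aW asW V⊑W with ascent⊎descent (inverse V) i
  -- The path from `W` makes two steps down and two up, and `V` follows it as long as it descends.
  -- An ascent of `V` on the way down leaves it below the next permutation already, and the way up
  -- ends above it.
  ... | inj₁ a = inj₁ (⊑-trans (⊑-trans (lower-rightˡ i hi hi' V⊑W a)
          (⊑-≗ λ k → sym (swap-involutive j (suc j) _)))
          (raise-bothˡ j hj hj' (⊑-raiseˡ (t (s W)) i hi hi' aW) asW))
  ... | inj₂ d with ascent⊎descent (inverse (s V)) j
  ...   | inj₁ a = inj₁ (⊑-trans (⊑-≗ λ k → sym (s-s V k)) (⊑-trans
            (raise-bothˡ i hi hi' (lower-rightˡ j hj hj' (lower-bothˡ i hi hi' V⊑W d) a) aW)
            (⊑-raiseˡ (s (t (s W))) j hj hj' asW)))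
  ...   | inj₂ d' = inj₂ (d , d' , raise-bothˡ j hj hj' (raise-bothˡ i hi hi' (lower-bothˡ j hj hj' (lower-bothˡ i hi hi' V⊑W d) d') aW) asW)

private
  adjacentCycleᶠ : Formula
  adjacentCycleᶠ = 0 <ᶠ 2 ⇒ᶠ 6 <ᶠ 4 ⇒ᶠ apartᶠ 1 2 ⇒ᶠ apartᶠ 3 0 ⇒ᶠ 5 <ᶠ 6 ∨ᶠ 4 ≤ᶠ 5 ⇒ᶠ 7 ≤ᶠ 6 ∨ᶠ 4 <ᶠ 7 ⇒ᶠ
    cycleᶠ 0 1 4 5 ⇒ᶠ cycleᶠ 2 3 6 7 ⇒ᶠ cyclesᶠ 0 1 2 3 4 5 6 7 ⇒ᶠ 2 <ᶠ 0

  adjacent-valid : Valid ((0 ∷ 1 ∷ 2 ∷ 3 ∷ []) ∷ (4 ∷ 5 ∷ 6 ∷ 7 ∷ []) ∷ []) adjacentCycleᶠ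
  adjacent-valid = refl

between : ∀ {a b x} → b ≡ suc a → x ≢ a → x ≢ b → x < a ⊎ b < x
between {a} {b} {x} refl p q with <-cmp x a
... | tri< h _ _ = inj₁ h
... | tri≈ _ e _ = ⊥-elim (p e)
... | tri> _ _ h = inj₂ (≤∧≢⇒< h λ e → q (sym e))

module _ {n : ℕ} {blk : ℕ → ℕ} {P : Perm n} {z : ℕ → ℕ} (A : Atom blk P z) where

  private
    f : ℕ → ℕ
    f = to P

  -- No position is free between consecutive letters, so other partners of `a` and `c` would lie
  -- outside the pair. The conditions between the two cycles then force `c < a`.
  adjacent-descent-cycle : ∀ {c a} → a < c → f a ≡ suc (f c) → blk (f a) ≡ blk (f c) → z a ≡ c
  adjacent-descent-cycle {c} {a} h e s with z a ≟ c
  ... | yes p = p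
  ... | no ne = ⊥-elim (<-asym h (by-order ((0 ∷ 1 ∷ 2 ∷ 3 ∷ []) ∷ (4 ∷ 5 ∷ 6 ∷ 7 ∷ []) ∷ []) adjacentCycleᶠ adjacent-valid
        (env (a ∷ z a ∷ c ∷ z c ∷ f a ∷ f (z a) ∷ f c ∷ f (z c) ∷ []))
        h (≤-reflexive (sym e)) (≢⇒<⊎> ne) (≢⇒<⊎> λ q → ne (trans (cong z (sym q)) (invol A c))) za zc (cycle A refl) (cycle A refl) (cycles A refl refl s)))
    where
    za : f (z a) < f c ⊎ ¬ (f (z a) < f a)
    za with between {x = f (z a)} e (λ q → ne (injective P q))
    ... | b with z a ≟ a
    ...   | yes q = inj₂ (<-irrefl (cong f q))
    ...   | no q = Data.Sum.map₂ (λ l → <⇒≯ l) (b λ r → q (injective P r))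
    zc : ¬ (f c < f (z c)) ⊎ f a < f (z c)
    zc with z c ≟ c
    ... | yes q = inj₁ (<-irrefl (cong f (sym q)))
    ... | no q = Data.Sum.map₁ (λ l → <⇒≯ l) (between e (λ r → q (injective P r)) λ r → ne (trans (cong z (sym (injective P r))) (invol A c)))

module Move {n : ℕ} {blk : ℕ → ℕ} (blk-mono : ∀ {x y} → x ≤ y → blk x ≤ blk y) (k : ℕ) (h₀ : k < n) (h₁ : suc k < n) (h₂ : suc (suc k) < n)
  (level : blk k ≡ blk (suc (suc k))) where

  level₁ : blk k ≡ blk (suc k)
  level₁ = ≤-antisym (blk-mono (n≤1+n k)) (subst (blk (suc k) ≤_) (sym level) (blk-mono (n≤1+n (suc k))))

  level₂ : blk (suc k) ≡ blk (suc (suc k))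
  level₂ = trans (sym level₁) level

  s t : Perm n → Perm n
  s P = stepˡ P k h₀ h₁
  t P = stepˡ P (suc k) h₁ h₂

  σ τ : ℕ → ℕ
  σ = swapℕ k (suc k)
  τ = swapℕ (suc k) (suc (suc k))

  σ-k : σ k ≡ suc k
  σ-k = swap-left k (suc k)
  σ-1 : σ (suc k) ≡ k
  σ-1 = swap-right k (suc k)
  σ-2 : σ (suc (suc k)) ≡ suc (suc k)
  σ-2 = swap-other (λ e → <⇒≢ (s≤s (n≤1+n k)) (sym e)) (λ e → 1+n≢n e)
  τ-k : τ k ≡ k
  τ-k = swap-other (λ e → 1+n≢n (sym e)) (<⇒≢ (s≤s (n≤1+n k)))
  τ-1 : τ (suc k) ≡ suc (suc k)
  τ-1 = swap-left (suc k) (suc (suc k))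
  τ-2 : τ (suc (suc k)) ≡ suc k
  τ-2 = swap-right (suc k) (suc (suc k))

  block-σ : ∀ v → blk (σ v) ≡ blk v
  block-σ v with swapView k (suc k) v
  ... | is-left refl e = trans (cong blk e) (sym level₁)
  ... | is-right refl e = trans (cong blk e) level₁
  ... | is-other _ _ e = cong blk e

  block-τ : ∀ v → blk (τ v) ≡ blk v
  block-τ v with swapView (suc k) (suc (suc k)) v
  ... | is-left refl e = trans (cong blk e) (sym level₂)
  ... | is-right refl e = trans (cong blk e) level₂
  ... | is-other _ _ e = cong blk e

  IsBca : Perm n → Set
  IsBca P = from P (suc (suc k)) < from P k × from P k < from P (suc k)

  rotate rotate⁻ : Perm n → Perm n
  rotate P = t (s P)
  rotate⁻ P = s (t P)

  -- The middle one of three decreasing letters would be the partner of both neighbours.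
  no-decreasing : ∀ {P : Perm n} {z} → Atom blk P z → ¬ (from P (suc k) < from P k × from P (suc (suc k)) < from P (suc k))
  no-decreasing {P} {z} A (p , q) = <-irrefl (trans (sym za) zb) (<-trans q p)
    where
    placed : ∀ m → to P (from P m) ≡ m
    placed = to-from P
    zb : z (from P (suc k)) ≡ from P k
    zb = adjacent-descent-cycle A p (trans (placed (suc k)) (cong suc (sym (placed k)))) (trans (cong blk (placed (suc k))) (trans (sym level₁) (cong blk (sym (placed k)))))
    za : z (from P (suc k)) ≡ from P (suc (suc k))
    za = trans (cong z (sym (adjacent-descent-cycle A q (trans (placed (suc (suc k))) (cong suc (sym (placed (suc k))))) (trans (cong blk (placed (suc (suc k)))) (trans (sym level₂) (cong blk (sym (placed (suc k)))))))))
      (invol A _)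

  swap-mono : ∀ i {u v} → u < v → swapℕ i (suc i) u < swapℕ i (suc i) v ⊎ (u ≡ i × v ≡ suc i)
  swap-mono i {u} {v} l with adjacent-< i (subst₂ _<_ (sym (swap-involutive i (suc i) u)) (sym (swap-involutive i (suc i) v)) l)
  ... | inj₁ m = inj₁ m
  ... | inj₂ (p , q) = inj₂ (trans (sym (swap-involutive i (suc i) u)) (trans (cong (swapℕ i (suc i)) p) (swap-right i (suc i))) ,
    trans (sym (swap-involutive i (suc i) v)) (trans (cong (swapℕ i (suc i)) q) (swap-left i (suc i))))

  module _ {P : Perm n} {z : ℕ → ℕ} (A : Atom blk P z) {a b c : ℕ} (a<b : a < b) (b<c : b < c) where

    private
      f : ℕ → ℕ
      f = to P

      moved-atom : (g : Perm n) → (∀ v → blk (to g v) ≡ blk (f v)) → z a ≡ c →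
        (∀ v → v < z v → to g (z v) < to g v) →
        (∀ x y → blk (f x) ≡ blk (f y) → x < y → z x < z y → to g x < to g (z y)) →
        (∀ u x → u < x → x < z u → to g x < to g (z u) ⊎ to g u < to g x) → Atom blk g z
      moved-atom g same zac d m gp = record
        { invol = invol A ; outside = outside A
        ; colour = λ v → trans (same (z v)) (trans (colour A v) (sym (same v)))
        ; desc = d ; mono = λ x y e → m x y (trans (sym (same x)) (trans e (same y))) ; gap = gp }

      flip : ∀ {x y} → z x ≡ y → x ≡ z y
      flip {x} e = trans (sym (invol A x)) (cong z e)

    -- The consecutive descent `c`, `a` is a cycle and `b` is a value inside it, so `gap` allows `b`
    -- on either side of the descending pair. No other relative position changes.
    rotate-atom : f b ≡ k → f c ≡ suc k → f a ≡ suc (suc k) → Atom blk (rotate P) z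
    rotate-atom fb fc fa = moved-atom (rotate P) (λ v → trans (block-τ _) (block-σ _)) zac d m gp
      where
      g : ℕ → ℕ
      g = to (rotate P)
      ga : g a ≡ suc k
      ga = trans (cong (λ x → τ (σ x)) fa) (trans (cong τ σ-2) τ-2)
      gb : g b ≡ suc (suc k)
      gb = trans (cong (λ x → τ (σ x)) fb) (trans (cong τ σ-k) τ-1)
      gc : g c ≡ k
      gc = trans (cong (λ x → τ (σ x)) fc) (trans (cong τ σ-1) τ-k)
      blk-fb : blk (f b) ≡ blk (f a)
      blk-fb = trans (cong blk fb) (trans level (cong blk (sym fa)))
      zac : z a ≡ c
      zac = adjacent-descent-cycle A (<-trans a<b b<c) (trans fa (cong suc (sym fc)))
        (trans (cong blk fa) (trans (sym level₂) (cong blk (sym fc))))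
      zca : z c ≡ a
      zca = sym (flip zac)
      pick : ∀ {x v w} → f x ≡ v → f w ≡ v → x ≡ w
      pick p q = injective P (trans p (sym q))
      change : ∀ {x y} → f x < f y → g x < g y ⊎ (x ≡ b × (y ≡ c ⊎ y ≡ a))
      change {x} {y} l with swap-mono k l
      ... | inj₂ (p , q) = inj₂ (pick p fb , inj₁ (pick q fc))
      ... | inj₁ l' with swap-mono (suc k) l'
      ...   | inj₁ l'' = inj₁ l''
      ...   | inj₂ (p , q) = inj₂ (pick (trans (sym (swap-involutive k (suc k) (f x))) (trans (cong σ p) σ-1)) fb ,
              inj₂ (pick (trans (sym (swap-involutive k (suc k) (f y))) (trans (cong σ q) σ-2)) fa))
      nested : ¬ (z b < a)
      nested l = <⇒≱ (subst (f (z b) <_) fc (subst (λ w → f (z b) < f w) zac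
          (mono A (z b) a (trans (colour A b) blk-fb) l (subst₂ _<_ (sym (invol A b)) (sym zac) b<c))))
        (subst (_< f (z b)) fb (subst (λ w → f w < f (z b)) (invol A b) (desc A (z b) (subst (z b <_) (sym (invol A b)) (<-trans l a<b)))))
      nested' : ¬ (c < z b)
      nested' l = <-asym (mono A a b (sym blk-fb) a<b (subst (_< z b) (sym zac) l)) (<-trans (desc A b (<-trans b<c l))
        (subst₂ _<_ (sym fb) (sym fa) (s≤s (n≤1+n k))))
      d : ∀ v → v < z v → g (z v) < g v
      d v h with change (desc A v h)
      ... | inj₁ l = l
      ... | inj₂ (p , inj₁ refl) = ⊥-elim (<⇒≢ a<b (trans (sym zca) p))
      ... | inj₂ (p , inj₂ refl) = ⊥-elim (<⇒≢ b<c (trans (sym p) zac))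
      m : ∀ x y → blk (f x) ≡ blk (f y) → x < y → z x < z y → g x < g (z y)
      m x y e h h' with change (mono A x y e h h')
      ... | inj₁ l = l
      ... | inj₂ (refl , inj₁ q) = ⊥-elim (<-asym h (subst (_< b) (trans (sym zca) (sym (flip q))) a<b))
      ... | inj₂ (refl , inj₂ q) = ⊥-elim (nested (subst (z b <_) q h'))
      gp : ∀ u x → u < x → x < z u → g x < g (z u) ⊎ g u < g x
      gp u x h h' with gap A u x h h'
      gp u x h h' | inj₁ l with change l
      ... | inj₁ l' = inj₁ l'
      ... | inj₂ (refl , inj₁ q) = inj₂ (subst₂ _<_ (sym (trans (cong g (trans (flip q) zca)) ga)) (sym gb) ≤-refl)
      ... | inj₂ (refl , inj₂ q) = ⊥-elim (<-asym h' (subst (_< b) (sym q) a<b))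
      gp u x h h' | inj₂ l with change l
      ... | inj₁ l' = inj₂ l'
      ... | inj₂ (refl , inj₁ refl) = ⊥-elim (nested' h')
      ... | inj₂ (refl , inj₂ refl) = ⊥-elim (<-asym h a<b)

    rotate⁻-atom : f c ≡ k → f a ≡ suc k → f b ≡ suc (suc k) → Atom blk (rotate⁻ P) z
    rotate⁻-atom fc fa fb = moved-atom (rotate⁻ P) (λ v → trans (block-σ _) (block-τ _)) zac d m gp
      where
      g : ℕ → ℕ
      g = to (rotate⁻ P)
      ga : g a ≡ suc (suc k)
      ga = trans (cong (λ x → σ (τ x)) fa) (trans (cong σ τ-1) σ-2)
      gb : g b ≡ k
      gb = trans (cong (λ x → σ (τ x)) fb) (trans (cong σ τ-2) σ-1)
      gc : g c ≡ suc k
      gc = trans (cong (λ x → σ (τ x)) fc) (trans (cong σ τ-k) σ-k)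
      blk-fb : blk (f b) ≡ blk (f a)
      blk-fb = trans (cong blk fb) (trans (sym level₂) (cong blk (sym fa)))
      zac : z a ≡ c
      zac = adjacent-descent-cycle A (<-trans a<b b<c) (trans fa (cong suc (sym fc)))
        (trans (cong blk fa) (trans (sym level₁) (cong blk (sym fc))))
      zca : z c ≡ a
      zca = sym (flip zac)
      pick : ∀ {x v w} → f x ≡ v → f w ≡ v → x ≡ w
      pick p q = injective P (trans p (sym q))
      change : ∀ {x y} → f x < f y → g x < g y ⊎ ((x ≡ c ⊎ x ≡ a) × y ≡ b)
      change {x} {y} l with swap-mono (suc k) l
      ... | inj₂ (p , q) = inj₂ (inj₂ (pick p fa) , pick q fb)
      ... | inj₁ l' with swap-mono k l'
      ...   | inj₁ l'' = inj₁ l''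
      ...   | inj₂ (p , q) = inj₂ (inj₁ (pick (trans (sym (swap-involutive (suc k) (suc (suc k)) (f x))) (trans (cong τ p) τ-k)) fc) ,
              pick (trans (sym (swap-involutive (suc k) (suc (suc k)) (f y))) (trans (cong τ q) τ-1)) fb)
      nested : ¬ (c < z b)
      nested l = <⇒≱ (subst (_< f (z b)) fa (mono A a b (sym blk-fb) a<b (subst (_< z b) (sym zac) l)))
        (≤-pred (subst (f (z b) <_) fb (desc A b (<-trans b<c l))))
      d : ∀ v → v < z v → g (z v) < g v
      d v h with change (desc A v h)
      ... | inj₁ l = l
      ... | inj₂ (inj₁ p , refl) = ⊥-elim (<⇒≢ a<b (trans (sym zca) (sym (flip p))))
      ... | inj₂ (inj₂ p , refl) = ⊥-elim (<⇒≢ b<c (trans (flip p) zac))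
      m : ∀ x y → blk (f x) ≡ blk (f y) → x < y → z x < z y → g x < g (z y)
      m x y e h h' with change (mono A x y e h h')
      ... | inj₁ l = l
      ... | inj₂ (inj₁ refl , q) = ⊥-elim (nested (subst (c <_) (flip q) h))
      ... | inj₂ (inj₂ refl , q) = ⊥-elim (<-asym (subst₂ _<_ zac q h') b<c)
      gp : ∀ u x → u < x → x < z u → g x < g (z u) ⊎ g u < g x
      gp u x h h' with gap A u x h h'
      gp u x h h' | inj₁ l with change l
      ... | inj₁ l' = inj₁ l'
      ... | inj₂ (inj₁ refl , q) = ⊥-elim (<-asym (subst (c <_) q h') b<c)
      ... | inj₂ (inj₂ refl , q) = inj₂ (subst₂ _<_ (sym gu) (sym ga) (<-trans fu (s≤s (n≤1+n k))))
        where
        fu : f u < k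
        fu = subst (f u <_) (trans (cong f zac) fc) (mono A u a
          (trans (sym (colour A u)) (trans (cong (λ w → blk (f w)) q) blk-fb)) h (subst₂ _<_ (sym q) (sym zac) b<c))
        gu : g u ≡ f u
        gu = trans (cong σ (swap-other (<⇒≢ (<-trans fu ≤-refl)) (<⇒≢ (<-trans fu (s≤s (n≤1+n k)))))) (swap-other (<⇒≢ fu) (<⇒≢ (<-trans fu ≤-refl)))
      gp u x h h' | inj₂ l with change l
      ... | inj₁ l' = inj₂ l'
      ... | inj₂ (inj₁ refl , refl) = ⊥-elim (<-asym h b<c)
      ... | inj₂ (inj₂ refl , refl) = inj₁ (subst₂ _<_ (sym gb) (sym (trans (cong g zac) gc)) ≤-refl)

-- Sorting an atom by rotations

sum< : ℕ → (ℕ → ℕ) → ℕ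
sum< zero F = 0
sum< (suc n) F = sum< n F + F n

sum<-cong : ∀ n {F G : ℕ → ℕ} → (∀ v → F v ≡ G v) → sum< n F ≡ sum< n G
sum<-cong zero h = refl
sum<-cong (suc n) h = cong₂ _+_ (sum<-cong n h) (h n)

sum<-+ : ∀ n (F G : ℕ → ℕ) → sum< n (λ v → F v + G v) ≡ sum< n F + sum< n G
sum<-+ zero F G = refl
sum<-+ (suc n) F G = trans (cong (_+ (F n + G n)) (sum<-+ n F G)) (interchange (sum< n F) (sum< n G) (F n) (G n))
  where
  interchange : ∀ a b c d → (a + b) + (c + d) ≡ (a + c) + (b + d)
  interchange a b c d = trans (+-assoc a b (c + d)) (trans (cong (a +_) (trans (sym (+-assoc b c d))
    (trans (cong (_+ d) (+-comm b c)) (+-assoc c b d)))) (sym (+-assoc a c (b + d))))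

only : ℕ → ℕ → ℕ → ℕ
only x m v with v ≟ x
... | yes _ = m
... | no _ = 0

sum<-zero : ∀ n x m → n ≤ x → sum< n (only x m) ≡ 0
sum<-zero zero x m h = refl
sum<-zero (suc n) x m h with n ≟ x
... | yes refl = ⊥-elim (<-irrefl refl h)
... | no _ = trans (+-identityʳ _) (sum<-zero n x m (≤-trans (n≤1+n n) h))

sum<-only : ∀ n x m → x < n → sum< n (only x m) ≡ m
sum<-only (suc n) x m h with n ≟ x
... | yes refl = cong (_+ m) (sum<-zero n x m ≤-refl)
... | no ne = trans (+-identityʳ _) (sum<-only n x m (≤∧≢⇒< (≤-pred h) λ e → ne (sym e)))

-- Sorting by key lists the cycles by their minima, the larger element first.
key : (ℕ → ℕ) → ℕ → ℕ
key z v with z v <? v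
... | yes _ = z v + z v
... | no _ = suc (v + v)

key-large : ∀ z {v} → z v < v → key z v ≡ z v + z v
key-large z {v} h with z v <? v
... | yes _ = refl
... | no k = ⊥-elim (k h)

key-small : ∀ z {v} → v ≤ z v → key z v ≡ suc (v + v)
key-small z {v} h with z v <? v
... | yes k = ⊥-elim (<⇒≱ k h)
... | no _ = refl

double-≢ : ∀ a b → a + a ≢ suc (b + b)
double-≢ zero b ()
double-≢ (suc a) zero e with trans (sym (cong suc (+-suc a a))) e
... | ()
double-≢ (suc a) (suc b) e = double-≢ a b (suc-injective (suc-injective (trans (sym (cong suc (+-suc a a))) (trans e (cong (λ x → suc (suc x)) (+-suc b b))))))

double-< : ∀ {a b} → a + a < b + b → a < b
double-< {a} {b} h with a <? b
... | yes l = l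
... | no l = ⊥-elim (<⇒≱ h (+-mono-≤ (≮⇒≥ l) (≮⇒≥ l)))

double-≤ : ∀ {a b} → a + a ≤ suc (b + b) → a ≤ b
double-≤ {a} {b} h with a ≤? b
... | yes l = l
... | no l = ⊥-elim (<⇒≱ (≤-trans (≤-reflexive (cong suc (sym (+-suc b b)))) (+-mono-≤ (≰⇒> l) (≰⇒> l))) h)

key-injective : ∀ {z : ℕ → ℕ} → (∀ {x y} → z x ≡ z y → x ≡ y) → ∀ {x y} → key z x ≡ key z y → x ≡ y
key-injective {z} inj {x} {y} e with z x <? x | z y <? y
... | yes _ | yes _ = inj (≤-antisym (double-≤ (≤-trans (≤-reflexive e) (n≤1+n _))) (double-≤ (≤-trans (≤-reflexive (sym e)) (n≤1+n _))))
... | yes _ | no _ = ⊥-elim (double-≢ (z x) y e)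
... | no _ | yes _ = ⊥-elim (double-≢ (z y) x (sym e))
... | no _ | no _ = ≤-antisym (double-≤ (≤-trans (n≤1+n _) (≤-reflexive e))) (double-≤ (≤-trans (n≤1+n _) (≤-reflexive (sym e))))

key-≤ : ∀ z v → key z v ≤ suc (v + v)
key-≤ z v with z v <? v
... | yes h = ≤-trans (+-mono-≤ (<⇒≤ h) (<⇒≤ h)) (n≤1+n _)
... | no _ = ≤-refl

key-< : ∀ z {v a} → v < a ⊎ z v < a → key z v < a + a
key-< z {v} {a} h with z v <? v
key-< z {v} {a} (inj₁ l) | yes k = +-mono-< (<-trans k l) (<-trans k l)
key-< z {v} {a} (inj₂ l) | yes k = +-mono-< l l
key-< z {v} {a} h | no k = ≤-trans (≤-reflexive (cong suc (sym (+-suc v v)))) (+-mono-≤ (below-a h) (below-a h))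
  where
  below-a : v < a ⊎ z v < a → v < a
  below-a (inj₁ l) = l
  below-a (inj₂ l) = ≤-<-trans (≮⇒≥ k) l

key-> : ∀ z {v a} → a < v → a < z v → suc (a + a) < key z v
key-> z {v} {a} h k with z v <? v
... | yes _ = ≤-trans (≤-reflexive (cong suc (sym (+-suc a a)))) (+-mono-≤ k k)
... | no _ = s≤s (+-mono-< h h)

compose-perm : ∀ {n} → Perm n → Perm n → Perm n
compose-perm P Q = record
  { to = λ k → to P (to Q k) ; from = λ k → from Q (from P k)
  ; to-from = λ k → trans (cong (to P) (to-from Q _)) (to-from P k)
  ; from-to = λ k → trans (cong (from Q) (from-to P _)) (from-to Q k)
  ; fixes = λ k h → trans (cong (to P) (fixes Q k h)) (fixes P k h) }

same-order : ∀ {n} (P Q : Perm n) → (∀ x y → to P x < to P y → to Q x < to Q y) → ∀ v → to P v ≡ to Q v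
same-order {n} P Q h v with descent⊎identity (compose-perm Q (inverse P))
... | inj₁ (i , _ , d) = ⊥-elim (<-asym d (h _ _ (subst₂ _<_ (sym (to-from P i)) (sym (to-from P (suc i))) ≤-refl)))
... | inj₂ e = trans (sym (e (to P v))) (cong (to Q) (from-to P v))

module Connected {n : ℕ} {blk : ℕ → ℕ} (blk-mono : ∀ {x y} → x ≤ y → blk x ≤ blk y) where

  data Linked : Perm n → Perm n → Set where
    pointwise : ∀ {P Q} → (∀ v → to P v ≡ to Q v) → Linked P Q
    rotation : ∀ {P} k (h₀ : k < n) (h₁ : suc k < n) (h₂ : suc (suc k) < n) (level : blk k ≡ blk (suc (suc k))) →
      Move.IsBca blk-mono k h₀ h₁ h₂ level P → Linked P (Move.rotate blk-mono k h₀ h₁ h₂ level P)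
    symmetric : ∀ {P Q} → Linked P Q → Linked Q P
    transitive : ∀ {P Q R} → Linked P Q → Linked Q R → Linked P R

  module _ {z : ℕ → ℕ} where

    BadPair : Perm n → ℕ → Set
    BadPair P k = suc k < n × blk k ≡ blk (suc k) × key z (from P (suc k)) < key z (from P k)

    Sorted : Perm n → Set
    Sorted P = ∀ k → ¬ BadPair P k

    -- For `v < n` the key is less than `n + n`, so the truncated subtraction is exact and reverses
    -- the order of the keys.
    weight : ℕ → ℕ
    weight v = (n + n) ∸ key z v

    -- The termination measure of sorting: exchanging adjacent letters so that the smaller key comes
    -- first changes the sum by a difference of two weights, which is negative.
    potential : Perm n → ℕ
    potential P = sum< n λ v → to P v * weight v

    weight-< : ∀ x y → x < n → key z y < key z x → weight x < weight y
    weight-< x y h l = ∸-monoʳ-< l (≤-trans (key-≤ z x) (≤-trans (≤-reflexive (sym (+-suc x x))) (+-mono-≤ (<⇒≤ h) h)))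

    potential-< : ∀ P k (h₀ : k < n) (h₁ : suc k < n) → key z (from P (suc k)) < key z (from P k) →
      potential (stepˡ P k h₀ h₁) < potential P
    potential-< P k h₀ h₁ l = +-cancelʳ-< (weight y) (potential (stepˡ P k h₀ h₁)) (potential P)
      (subst (_< potential P + weight y) (sym balance) (+-monoʳ-< (potential P) (weight-< x y (bounded (inverse P) h₀) l)))
      where
      x y : ℕ
      x = from P k
      y = from P (suc k)
      σ : ℕ → ℕ
      σ = swapℕ k (suc k)
      balanced-at : ∀ v → σ (to P v) * weight v + only y (weight y) v ≡ to P v * weight v + only x (weight x) v
      balanced-at v with v ≟ x | v ≟ y
      ... | yes refl | yes e = ⊥-elim (1+n≢n (sym (injective (inverse P) e)))
      ... | yes refl | no _ rewrite to-from P k | swap-left k (suc k) = trans (+-identityʳ _) (+-comm (weight x) (k * weight x))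
      ... | no _ | yes refl rewrite to-from P (suc k) | swap-right k (suc k) = trans (+-comm (k * weight y) (weight y)) (sym (+-identityʳ _))
      ... | no p | no q = cong (λ u → u * weight v + 0) (swap-other
              (λ e → p (trans (sym (from-to P v)) (cong (from P) e))) (λ e → q (trans (sym (from-to P v)) (cong (from P) e))))
      balance : potential (stepˡ P k h₀ h₁) + weight y ≡ potential P + weight x
      balance = begin
        potential (stepˡ P k h₀ h₁) + weight y
          ≡⟨ cong (potential (stepˡ P k h₀ h₁) +_) (sym (sum<-only n y (weight y) (bounded (inverse P) h₁))) ⟩
        potential (stepˡ P k h₀ h₁) + sum< n (only y (weight y))
          ≡⟨ sum<-+ n (λ v → σ (to P v) * weight v) (only y (weight y)) ⟨
        sum< n (λ v → σ (to P v) * weight v + only y (weight y) v)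
          ≡⟨ sum<-cong n balanced-at ⟩
        sum< n (λ v → to P v * weight v + only x (weight x) v)
          ≡⟨ sum<-+ n (λ v → to P v * weight v) (only x (weight x)) ⟩
        potential P + sum< n (only x (weight x))
          ≡⟨ cong (potential P +_) (sum<-only n x (weight x) (bounded (inverse P) h₀)) ⟩
        potential P + weight x ∎
        where open ≡-Reasoning

    record Rotatable (P : Perm n) : Set where
      field
        k : ℕ
        h₂ : suc (suc k) < n
        level : blk k ≡ blk (suc (suc k))
        is-bca : from P (suc (suc k)) < from P k × from P k < from P (suc k)
        key-c : key z (from P (suc k)) < key z (from P k)
        key-a : key z (from P (suc (suc k))) < key z (from P k)

    module _ {P : Perm n} (A : Atom blk P z) where

      private
        f : ℕ → ℕ
        f = to P
        module F = Up.Facts (upFacts A)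

      key-above : ∀ {x a} → a + a < key z x → a ≢ x → a < x × a < z x
      key-above {x} {a} l ne with z x <? x
      ... | yes q = <-trans (double-< l) q , double-< l
      ... | no q = a<x , <-≤-trans a<x (≮⇒≥ q)
        where
        a<x : a < x
        a<x = ≤∧≢⇒< (double-≤ (<⇒≤ l)) ne

      -- If `y` were fixed or the smaller end of its cycle, `z y` would have to be positioned
      -- between the adjacent letters `x` and `y`. So `y` is the larger end, and its cycle encloses
      -- `x`.
      nested-pair : ∀ {x y} → f y ≡ suc (f x) → blk (f x) ≡ blk (f y) → key z y < key z x → z y < y × z y < x × z y < z x × x < y
      nested-pair {x} {y} e s l = go (z y <? y)
        where
        fx<fy : f x < f y
        fx<fy = subst (f x <_) (sym e) ≤-refl
        go : Dec (z y < y) → z y < y × z y < x × z y < z x × x < y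
        go (no p) = ⊥-elim (<⇒≱ (subst (f (z y) <_) e (desc A y (<-trans (proj₁ y<) (proj₁ inner)))) (proj₂ inner))
          where
          y<′ : y + y < key z x
          y<′ = <-trans ≤-refl (subst (_< key z x) (key-small z (≮⇒≥ p)) l)
          y< : y < x × y < z x
          y< = key-above y<′ λ q → 1+n≢n (trans (sym e) (cong f q))
          inner : x < z y × f x < f (z y)
          inner = F.nested-before y x s (proj₁ y<) (proj₂ y<) (λ q → <-irrefl (sym (trans (cong z q) (invol A y))) (proj₂ y<)) fx<fy
        go (yes p) = p , proj₁ a< , proj₂ a< , subst (x <_) (invol A y) (proj₁ (F.nested-before (z y) x (trans s (sym (colour A y))) (proj₁ a<) (proj₂ a<)
            (λ w → 1+n≢n (sym (trans (cong f (trans w (invol A y))) e))) (<-trans fx<fy fy<)))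
          where
          fy< : f y < f (z y)
          fy< = subst (λ w → f w < f (z y)) (invol A y) (desc A (z y) (subst (z y <_) (sym (invol A y)) p))
          a< : z y < x × z y < z x
          a< = key-above (subst (_< key z x) (key-large z p) l) λ q → <-asym fx<fy (subst (λ w → f y < f w) q fy<)

      -- By `nested-pair` the letters `x`, `y` are the `b` and `c` of a pattern whose `a` is `z y`,
      -- somewhere to the right. If `a` is not the next letter, the next letter is positioned inside
      -- the descending pair and therefore has a smaller key than `y`, so it forms a bad pair with
      -- `y` further to the right.
      find-rotation : ∀ m k → n ∸ k ≤ m → BadPair P k → Rotatable P
      find-rotation zero k h (hk , _) = ⊥-elim (<⇒≱ (<-trans ≤-refl hk) (m∸n≡0⇒m≤n (n≤0⇒n≡0 h)))
      find-rotation (suc m) k h (hk , s , l) = go (f a ≟ suc (suc k))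
        where
        x y a : ℕ
        x = from P k
        y = from P (suc k)
        a = z y
        fx : f x ≡ k
        fx = to-from P k
        fy : f y ≡ suc k
        fy = to-from P (suc k)
        nested : a < y × a < x × a < z x × x < y
        nested = nested-pair (trans fy (cong suc (sym fx))) (trans (cong blk fx) (trans s (cong blk (sym fy)))) l
        fy<fa : suc k < f a
        fy<fa = subst (_< f a) (trans (cong f (invol A y)) fy) (desc A a (subst (a <_) (sym (invol A y)) (proj₁ nested)))
        h₂ : suc (suc k) < n
        h₂ = ≤-<-trans fy<fa (bounded P (z-bounded A (bounded (inverse P) hk)))
        s₂ : blk (suc k) ≡ blk (suc (suc k))
        s₂ = ≤-antisym (blk-mono (n≤1+n (suc k))) (≤-trans (blk-mono fy<fa) (≤-reflexive (trans (colour A y) (cong blk fy))))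
        go : Dec (f a ≡ suc (suc k)) → Rotatable P
        go (yes e) = record
          { k = k ; h₂ = h₂ ; level = trans s s₂
          ; is-bca = subst (_< x) (sym from-a) (proj₁ (proj₂ nested)) , proj₂ (proj₂ (proj₂ nested))
          ; key-c = l
          ; key-a = subst (λ w → key z w < key z x) (sym from-a) (subst (_< key z x) (sym (key-small z (subst (a ≤_) (sym (invol A y)) (<⇒≤ (proj₁ nested)))))
              (key-> z (proj₁ (proj₂ nested)) (proj₁ (proj₂ (proj₂ nested))))) }
          where
          from-a : from P (suc (suc k)) ≡ a
          from-a = trans (cong (from P) (sym e)) (from-to P a)
        go (no ne) = find-rotation m (suc k) (≤-pred (≤-trans (∸-monoʳ-< ≤-refl (<⇒≤ hk)) h))
          (h₂ , s₂ , subst (key z t <_) (sym (key-large z (proj₁ nested))) (key-< z low))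
          where
          t : ℕ
          t = from P (suc (suc k))
          ft : f t ≡ suc (suc k)
          ft = to-from P (suc (suc k))
          ft<fa : f t < f a
          ft<fa = subst (_< f a) (sym ft) (≤∧≢⇒< fy<fa λ e → ne (sym e))
          t≢y : t ≢ y
          t≢y e = 1+n≢n (trans (sym ft) (trans (cong f e) fy))
          low : t < a ⊎ z t < a
          low with <-cmp t a | <-cmp (z t) a
          ... | tri< p _ _ | _ = inj₁ p
          ... | _ | tri< p _ _ = inj₂ p
          ... | tri≈ _ p _ | _ = ⊥-elim (<-irrefl (cong f p) ft<fa)
          ... | _ | tri≈ _ p _ = ⊥-elim (t≢y (trans (sym (invol A t)) (trans (cong z p) (invol A y))))
          ... | tri> _ _ p | tri> _ _ q = ⊥-elim (<⇒≱ (subst₂ _<_ ft (trans (cong f (invol A y)) fy)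
                  (proj₂ (F.nested-before a t (trans (cong blk ft) (trans (sym s₂) (trans (cong blk (sym fy)) (sym (colour A y))))) p q
                    (λ e → t≢y (trans e (invol A y))) ft<fa))) (n≤1+n (suc k)))

    badPair? : ∀ P k → Dec (BadPair P k)
    badPair? P k with suc k <? n | blk k ≟ blk (suc k) | key z (from P (suc k)) <? key z (from P k)
    ... | yes p | yes q | yes r = yes (p , q , r)
    ... | no p | _ | _ = no λ h → p (proj₁ h)
    ... | _ | no p | _ = no λ h → p (proj₁ (proj₂ h))
    ... | _ | _ | no p = no λ h → p (proj₂ (proj₂ h))

    badPair⊎sorted : ∀ P → (∃ λ k → BadPair P k) ⊎ Sorted P
    badPair⊎sorted P = finish (search n)
      where
      search : ∀ m → (∃ λ k → BadPair P k) ⊎ (∀ k → k < m → ¬ BadPair P k)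
      search zero = inj₂ λ k ()
      search (suc m) with search m | badPair? P m
      ... | inj₁ b | _ = inj₁ b
      ... | _ | yes b = inj₁ (m , b)
      ... | inj₂ f | no b = inj₂ λ k l → Data.Sum.[ f k , (λ e → subst (λ w → ¬ BadPair P w) (sym e) b) ]′ (m≤n⇒m<n∨m≡n (≤-pred l))
      finish : (∃ λ k → BadPair P k) ⊎ (∀ k → k < n → ¬ BadPair P k) → (∃ λ k → BadPair P k) ⊎ Sorted P
      finish (inj₁ b) = inj₁ b
      finish (inj₂ f) = inj₂ λ k b → f k (<-trans ≤-refl (proj₁ b)) b

    record Normal (P : Perm n) : Set where
      field
        form : Perm n
        linked : Linked P form
        atom : Atom blk form z
        blocks-same : ∀ v → blk (to form v) ≡ blk (to P v)
        sorted : Sorted form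

    normalise : ∀ P → Atom blk P z → Normal P
    normalise P A = <-rec Claim step (potential P) P A refl
      where
      Claim : ℕ → Set
      Claim m = ∀ P → Atom blk P z → potential P ≡ m → Normal P
      step : ∀ m → (∀ {m'} → m' < m → Claim m') → Claim m
      step m ih P A refl = go (badPair⊎sorted P)
        where
        go : (∃ λ k → BadPair P k) ⊎ Sorted P → Normal P
        go (inj₂ s) = record { form = P ; linked = pointwise λ _ → refl ; atom = A ; blocks-same = λ _ → refl ; sorted = s }
        go (inj₁ (k , b)) = record
          { form = Normal.form rec ; linked = transitive (rotation k′ h₀ h₁ h₂ level is-bca) (Normal.linked rec) ; atom = Normal.atom rec
          ; blocks-same = λ v → trans (Normal.blocks-same rec v) (trans (M.block-τ _) (M.block-σ _)) ; sorted = Normal.sorted rec }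
          where
          rot : Rotatable P
          rot = find-rotation A n k (m∸n≤m n k) b
          open Rotatable rot renaming (k to k′)
          h₁ : suc k′ < n
          h₁ = <-trans ≤-refl h₂
          h₀ : k′ < n
          h₀ = <-trans ≤-refl h₁
          module M = Move blk-mono k′ h₀ h₁ h₂ level
          smaller : potential (M.rotate P) < potential P
          smaller = <-trans (potential-< (M.s P) (suc k′) h₁ h₂
              (subst₂ (λ u v → key z (from P u) < key z (from P v)) (sym M.σ-2) (sym M.σ-1) key-a))
            (potential-< P k′ h₀ h₁ key-c)
          rec : Normal (M.rotate P)
          rec = ih smaller (M.rotate P) (M.rotate-atom A (proj₁ is-bca) (proj₂ is-bca) (to-from P k′) (to-from P (suc k′)) (to-from P (suc (suc k′)))) refl

    Precedes : (ℕ → ℕ) → ℕ → ℕ → Set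
    Precedes c x y = c x < c y ⊎ (c x ≡ c y × key z x < key z y)

    precedes-trans : ∀ c x y w → Precedes c x y → Precedes c y w → Precedes c x w
    precedes-trans c x y w (inj₁ h) (inj₁ k) = inj₁ (<-trans h k)
    precedes-trans c x y w (inj₁ h) (inj₂ (e , _)) = inj₁ (subst (c x <_) e h)
    precedes-trans c x y w (inj₂ (e , _)) (inj₁ k) = inj₁ (subst (_< c w) (sym e) k)
    precedes-trans c x y w (inj₂ (e , h)) (inj₂ (e' , k)) = inj₂ (trans e e' , <-trans h k)

    precedes-asym : ∀ c x y → Precedes c x y → ¬ Precedes c y x
    precedes-asym c x y (inj₁ h) (inj₁ k) = <-asym h k
    precedes-asym c x y (inj₁ h) (inj₂ (e , _)) = <-irrefl (sym e) h
    precedes-asym c x y (inj₂ (e , _)) (inj₁ k) = <-irrefl (sym e) k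
    precedes-asym c x y (inj₂ (_ , h)) (inj₂ (_ , k)) = <-asym h k

    module _ {P : Perm n} (A : Atom blk P z) (sorted : Sorted P) where

      private
        c : ℕ → ℕ
        c v = blk (to P v)

      precedes-next : ∀ k → suc k < n → Precedes c (from P k) (from P (suc k))
      precedes-next k h with m≤n⇒m<n∨m≡n (blk-mono (n≤1+n k))
      ... | inj₁ l = inj₁ (subst₂ _<_ (cong blk (sym (to-from P k))) (cong blk (sym (to-from P (suc k)))) l)
      ... | inj₂ e = inj₂ (trans (cong blk (to-from P k)) (trans e (cong blk (sym (to-from P (suc k))))) ,
        ≤∧≢⇒< (≮⇒≥ λ l → sorted k (h , e , l)) λ q → 1+n≢n (sym (injective (inverse P) (key-injective (z-injective A) q))))

      precedes-later : ∀ k m → m < n → k < m → Precedes c (from P k) (from P m)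
      precedes-later k (suc m) h l with m≤n⇒m<n∨m≡n (≤-pred l)
      ... | inj₂ refl = precedes-next k h
      ... | inj₁ l' = precedes-trans c _ (from P m) _ (precedes-later k m (<-trans ≤-refl h) l') (precedes-next m h)

      order-precedes : ∀ x y → y < n → to P x < to P y → Precedes c x y
      order-precedes x y h l = subst₂ (Precedes c) (from-to P x) (from-to P y) (precedes-later _ _ (bounded P h) l)

    -- The letters of a sorted atom are ordered by colour and then by key, and neither depends on
    -- the atom.
    sorted-unique : ∀ {P Q} → Atom blk P z → Atom blk Q z → (∀ v → blk (to P v) ≡ blk (to Q v)) → Sorted P → Sorted Q → ∀ v → to P v ≡ to Q v
    sorted-unique {P} {Q} A B same sP sQ = same-order P Q order
      where
      transport : ∀ {x y} → Precedes (λ v → blk (to P v)) x y → Precedes (λ v → blk (to Q v)) x y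
      transport {x} {y} (inj₁ h) = inj₁ (subst₂ _<_ (same x) (same y) h)
      transport {x} {y} (inj₂ (e , h)) = inj₂ (trans (sym (same x)) (trans e (same y)) , h)
      order : ∀ x y → to P x < to P y → to Q x < to Q y
      order x y l with y <? n
      ... | no h = subst (to Q x <_) (sym (fixes Q y (≮⇒≥ h))) (outside-case (x <? n))
        where
        outside-case : Dec (x < n) → to Q x < y
        outside-case (yes k) = <-≤-trans (bounded Q k) (≮⇒≥ h)
        outside-case (no k) = subst (_< y) (sym (fixes Q x (≮⇒≥ k))) (subst₂ _<_ (fixes P x (≮⇒≥ k)) (fixes P y (≮⇒≥ h)) l)
      ... | yes h with <-cmp (to Q x) (to Q y)
      ...   | tri< m _ _ = m
      ...   | tri≈ _ e _ = ⊥-elim (<-irrefl (cong (to P) (injective Q e)) l)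
      ...   | tri> _ _ m = ⊥-elim (precedes-asym (λ v → blk (to Q v)) x y (transport {x} {y} (order-precedes A sP x y h l)) (order-precedes B sQ y x x<n m))
        where
        x<n : x < n
        x<n with x <? n
        ... | yes k = k
        ... | no k = ⊥-elim (<⇒≱ (<-trans l (bounded P h)) (subst (n ≤_) (sym (fixes P x (≮⇒≥ k))) (≮⇒≥ k)))

    connected : ∀ {P Q} → Atom blk P z → Atom blk Q z → (∀ v → blk (to P v) ≡ blk (to Q v)) → Linked P Q
    connected {P} {Q} A B same = transitive (linked N) (transitive (pointwise forms) (symmetric (linked M)))
      where
      open Normal
      N : Normal P
      N = normalise P A
      M : Normal Q
      M = normalise Q B
      forms : ∀ v → to (form N) v ≡ to (form M) v
      forms = sorted-unique (atom N) (atom M) (λ v → trans (blocks-same N v) (trans (same v) (sym (blocks-same M v)))) (sorted N) (sorted M)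

  -- Bruhat comparisons carried along moves

  Refines : (ℕ → ℕ) → Perm n → Perm n → Set
  Refines z P Q = ∀ {V} → Atom blk V z → V ⊑ P → Σ (Perm n) λ V' → Atom blk V' z × (∀ v → blk (to V' v) ≡ blk (to V v)) × V' ⊑ Q

  module _ {z : ℕ → ℕ} (k : ℕ) (h₀ : k < n) (h₁ : suc k < n) (h₂ : suc (suc k) < n) (level : blk k ≡ blk (suc (suc k))) where

    private
      module M = Move blk-mono k h₀ h₁ h₂ level
      open M using (s; t; σ; τ)

      -- The braid relation gives `(στ)² = (στ)⁻¹`. The two steps of `rotate` pass through the
      -- decreasing arrangement c b a; the four steps pass through a b c, thus down and up again,
      -- which is the form that `transfer` requires.
      four-steps : ∀ x → σ (τ (σ (τ x))) ≡ τ (σ x)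
      four-steps x = trans (braid k (τ x)) (cong (λ y → τ (σ y)) (swap-involutive (suc k) (suc (suc k)) x))

      four-steps⁻ : ∀ x → τ (σ (τ (σ x))) ≡ σ (τ x)
      four-steps⁻ x = trans (sym (braid k (σ x))) (cong (λ y → σ (τ y)) (swap-involutive k (suc k) x))

    module _ {W : Perm n} (bca : M.IsBca W) where

      private
        w : ℕ → ℕ
        w = from W
        a<b : w (suc (suc k)) < w k
        a<b = proj₁ bca
        b<c : w k < w (suc k)
        b<c = proj₂ bca
        a<c : w (suc (suc k)) < w (suc k)
        a<c = <-trans a<b b<c
        values : ∀ {u v u' v'} → u ≡ u' → v ≡ v' → w u' < w v' → w u < w v
        values refl refl h = h

      -- If `V` is not already below the target, it has both descents of the path. Three decreasing
      -- letters being impossible, `V` itself shows the pattern b c a at these positions, and it is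
      -- rotated together with `W`.
      refines-rotate : Refines z W (M.rotate W)
      refines-rotate {V} A V⊑W with transfer (suc k) h₁ h₂ k h₀ h₁ {V} {W} a<c
        (values M.τ-1 M.τ-k a<b) (values (trans (cong τ M.σ-1) M.τ-k) (trans (cong τ M.σ-2) M.τ-2) b<c)
        (values (trans (cong (λ x → τ (σ x)) M.τ-k) (trans (cong τ M.σ-k) M.τ-1))
            (trans (cong (λ x → τ (σ x)) M.τ-1) (trans (cong τ M.σ-2) M.τ-2)) a<c) V⊑W
      ... | inj₁ h = V , A , (λ _ → refl) , ⊑-trans h (⊑-≗ λ x → four-steps (to W x))
      ... | inj₂ (d , d' , h) with <-cmp (from V k) (from V (suc k))
      ...   | tri< l _ _ = M.rotate V , M.rotate-atom A z<x l (to-from V k) (to-from V (suc k)) (to-from V (suc (suc k))) ,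
              (λ v → trans (M.block-τ _) (M.block-σ _)) ,
              ⊑-trans (⊑-≗ λ x → sym (four-steps (to V x))) (⊑-trans h (⊑-≗ λ x → four-steps (to W x)))
        where
        z<x : from V (suc (suc k)) < from V k
        z<x = subst₂ _<_ (cong (from V) M.τ-1) (cong (from V) M.τ-k) d'
      ...   | tri≈ _ e _ = ⊥-elim (1+n≢n (sym (injective (inverse V) e)))
      ...   | tri> _ _ l = ⊥-elim (M.no-decreasing A (l , d))

      rotate-refines : Refines z (M.rotate W) W
      rotate-refines {V} A V⊑U with transfer k h₀ h₁ (suc k) h₁ h₂ {V} {M.rotate W}
        (values (trans (cong σ M.τ-1) M.σ-2) (trans (cong σ M.τ-k) M.σ-k) a<c)
        (values (trans (cong (λ x → σ (τ x)) M.σ-2) (trans (cong σ M.τ-2) M.σ-1)) (trans (cong (λ x → σ (τ x)) M.σ-1) (trans (cong σ M.τ-k) M.σ-k)) b<c)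
        (values (trans (four-steps k) (trans (cong τ M.σ-k) M.τ-1)) (trans (four-steps (suc k)) (trans (cong τ M.σ-1) M.τ-k)) a<b)
        (values (trans (four-steps (σ (suc k))) (trans (cong τ (swap-involutive k (suc k) (suc k))) M.τ-1))
            (trans (four-steps (σ (suc (suc k)))) (trans (cong τ (swap-involutive k (suc k) (suc (suc k)))) M.τ-2)) a<c) V⊑U
      ... | inj₁ h = V , A , (λ _ → refl) , ⊑-trans h (⊑-≗ back)
        where
        back : ∀ x → τ (σ (τ (σ (τ (σ (to W x)))))) ≡ to W x
        back x = trans (four-steps⁻ (τ (σ (to W x)))) (trans (cong σ (swap-involutive (suc k) (suc (suc k)) (σ (to W x)))) (swap-involutive k (suc k) (to W x)))
      ... | inj₂ (d , d' , h) with <-cmp (from V (suc k)) (from V (suc (suc k)))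
      ...   | tri< l _ _ = M.rotate⁻ V , M.rotate⁻-atom A l z<x (to-from V k) (to-from V (suc k)) (to-from V (suc (suc k))) ,
              (λ v → trans (M.block-σ _) (M.block-τ _)) ,
              ⊑-trans (⊑-≗ λ x → sym (four-steps⁻ (to V x))) (⊑-trans h (⊑-≗ back))
        where
        back : ∀ x → τ (σ (τ (σ (τ (σ (to W x)))))) ≡ to W x
        back x = trans (four-steps⁻ (τ (σ (to W x)))) (trans (cong σ (swap-involutive (suc k) (suc (suc k)) (σ (to W x)))) (swap-involutive k (suc k) (to W x)))
        z<x : from V (suc (suc k)) < from V k
        z<x = subst₂ _<_ (cong (from V) M.σ-2) (cong (from V) M.σ-1) d'
      ...   | tri≈ _ e _ = ⊥-elim (1+n≢n (sym (injective (inverse V) e)))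
      ...   | tri> _ _ l = ⊥-elim (M.no-decreasing A (d , l))

  linked-refines : ∀ {z P Q} → Linked P Q → Refines z P Q × Refines z Q P
  linked-refines (pointwise e) = (λ {V} A h → V , A , (λ _ → refl) , ⊑-trans h (⊑-≗ e)) ,
    λ {V} A h → V , A , (λ _ → refl) , ⊑-trans h (⊑-≗ λ v → sym (e v))
  linked-refines (rotation k h₀ h₁ h₂ level bca) = refines-rotate k h₀ h₁ h₂ level bca , rotate-refines k h₀ h₁ h₂ level bca
  linked-refines (symmetric l) with linked-refines l
  ... | f , g = g , f
  linked-refines {z} (transitive {P} {Q} {R} l m) with linked-refines {z} l | linked-refines {z} m
  ... | f , g | f' , g' = both-steps {P} {Q} {R} f f' , both-steps {R} {Q} {P} g' g
    where
    both-steps : ∀ {P Q R} → Refines z P Q → Refines z Q R → Refines z P R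
    both-steps f g A h with f A h
    ... | V' , A' , e , h' with g A' h'
    ...   | V'' , A'' , e' , h'' = V'' , A'' , (λ v → trans (e' v) (e v)) , h''

-- Words and lengths

applyUpTo-cong : ∀ {f g : ℕ → ℕ} n → (∀ k → k < n → f k ≡ g k) → applyUpTo f n ≡ applyUpTo g n
applyUpTo-cong zero h = refl
applyUpTo-cong (suc n) h = cong₂ _∷_ (h 0 (s≤s z≤n)) (applyUpTo-cong n λ k l → h (suc k) (s≤s l))

map-upTo-cong : ∀ {f g : ℕ → ℕ} n → (∀ k → k < n → f k ≡ g k) → map f (upTo n) ≡ map g (upTo n)
map-upTo-cong {f} {g} n h = trans (map-upTo f n) (trans (applyUpTo-cong n h) (sym (map-upTo g n)))

at-applyUpTo : ∀ (f : ℕ → ℕ) n k → k < n → at (applyUpTo f n) k ≡ f k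
at-applyUpTo f (suc n) zero h = refl
at-applyUpTo f (suc n) (suc k) h = at-applyUpTo (λ x → f (suc x)) n k (≤-pred h)

at-map-upTo : ∀ (f : ℕ → ℕ) n k → k < n → at (map f (upTo n)) k ≡ f k
at-map-upTo f n k h = trans (cong (λ w → at w k) (map-upTo f n)) (at-applyUpTo f n k h)

applyUpTo-++ : ∀ (f : ℕ → ℕ) a b → applyUpTo f (a + b) ≡ applyUpTo f a ++ applyUpTo (λ k → f (a + k)) b
applyUpTo-++ f zero b = refl
applyUpTo-++ f (suc a) b = cong (f 0 ∷_) (applyUpTo-++ (λ k → f (suc k)) a b)

word : ∀ {n} → Perm n → List ℕ
word {n} P = map (to P) (upTo n)

length-word : ∀ {n} (P : Perm n) → length (word P) ≡ n
length-word {n} P = trans (length-map (to P) (upTo n)) (length-upTo n)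

word-injective : ∀ {n} (P Q : Perm n) → word P ≡ word Q → ∀ v → to P v ≡ to Q v
word-injective {n} P Q e v with v <? n
... | yes h = trans (sym (at-map-upTo (to P) n v h)) (trans (cong (λ w → at w v) e) (at-map-upTo (to Q) n v h))
... | no h = trans (fixes P v (≮⇒≥ h)) (sym (fixes Q v (≮⇒≥ h)))

swapPos-word : ∀ {n} (P : Perm n) i j hi hj → swapPos i j (word P) ≡ word (mulʳ P i j hi hj)
swapPos-word {n} P i j hi hj = trans (cong (λ m → map (λ k → at (word P) (swapℕ i j k)) (upTo m)) (length-word P))
  (map-upTo-cong n λ k h → at-map-upTo (to P) n (swapℕ i j k) (swap-< hi hj h))

one : Bool → ℕ
one b = if b then 1 else 0

cntLess-++ : ∀ x xs ys → cntLess x (xs ++ ys) ≡ cntLess x xs + cntLess x ys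
cntLess-++ x [] ys = refl
cntLess-++ x (y ∷ xs) ys = trans (cong (one (y <ᵇ x) +_) (cntLess-++ x xs ys)) (sym (+-assoc (one (y <ᵇ x)) _ _))

cntGreater : ℕ → List ℕ → ℕ
cntGreater x [] = 0
cntGreater x (y ∷ ys) = one (x <ᵇ y) + cntGreater x ys

module _ where
  open Data.Nat.Solver.+-*-Solver

  cntLess-insert : ∀ x M b Y → cntLess x (M ++ b ∷ Y) ≡ one (b <ᵇ x) + cntLess x (M ++ Y)
  cntLess-insert x M b Y rewrite cntLess-++ x M (b ∷ Y) | cntLess-++ x M Y =
    solve 3 (λ m o y → m :+ (o :+ y) := o :+ (m :+ y)) refl (cntLess x M) (one (b <ᵇ x)) (cntLess x Y)

  ℓ-insert : ∀ M b Y → ℓ (M ++ b ∷ Y) ≡ cntGreater b M + cntLess b Y + ℓ (M ++ Y)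
  ℓ-insert [] b Y = refl
  ℓ-insert (m ∷ M) b Y rewrite cntLess-insert m M b Y | ℓ-insert M b Y =
    solve 5 (λ o c g y l → (o :+ c) :+ (g :+ y :+ l) := (o :+ g) :+ y :+ (c :+ l)) refl
      (one (b <ᵇ m)) (cntLess m (M ++ Y)) (cntGreater b M) (cntLess b Y) (ℓ (M ++ Y))

  ℓ-prefix : ∀ m X {L L'} → (∀ x → cntLess x L ≡ cntLess x L') → ℓ L' ≡ m + ℓ L → ℓ (X ++ L') ≡ m + ℓ (X ++ L)
  ℓ-prefix m [] h e = e
  ℓ-prefix m (x ∷ X) {L} {L'} h e rewrite ℓ-prefix m X {L} {L'} h e | cntLess-++ x X L | cntLess-++ x X L' | h x =
    solve 4 (λ a b c d → (a :+ b) :+ (c :+ d) := c :+ ((a :+ b) :+ d)) refl (cntLess x X) (cntLess x L') m (ℓ (X ++ L))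

  -- k counts the entries of M strictly between a and b.
  between-count : ∀ {a b} → a < b → ∀ M → All (λ m → m ≢ a × m ≢ b) M →
    Σ ℕ λ k → cntLess b M ≡ cntLess a M + k × cntGreater a M ≡ cntGreater b M + k × (k ≡ 0 → All (λ m → m < a ⊎ b < m) M)
  between-count h [] [] = 0 , refl , refl , λ _ → []
  between-count {a} {b} h (m ∷ M) ((p , q) ∷ ps) with between-count h M ps | <-cmp m a | <-cmp m b
  ... | _ | tri≈ _ e _ | _ = ⊥-elim (p e)
  ... | _ | _ | tri≈ _ e _ = ⊥-elim (q e)
  ... | k , u , v , w | tri< l _ _ | tri> _ _ r = ⊥-elim (<-asym l (<-trans h r))
  ... | k , u , v , w | tri< l _ _ | tri< r _ _ rewrite <ᵇ-true l | <ᵇ-true r | <ᵇ-false (<⇒≯ l) | <ᵇ-false (<⇒≯ r) =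
    k , cong suc u , v , λ e → inj₁ l ∷ w e
  ... | k , u , v , w | tri> _ _ l | tri> _ _ r rewrite <ᵇ-true l | <ᵇ-true r | <ᵇ-false (<⇒≯ l) | <ᵇ-false (<⇒≯ r) =
    k , u , cong suc v , λ e → inj₂ r ∷ w e
  ... | k , u , v , w | tri> _ _ l | tri< r _ _ rewrite <ᵇ-true l | <ᵇ-true r | <ᵇ-false (<⇒≯ l) | <ᵇ-false (<⇒≯ r) =
    suc k , trans (cong suc u) (sym (+-suc _ k)) , trans (cong suc v) (sym (+-suc _ k)) , λ ()

  -- The exchanged pair contributes one new inversion and every entry of `M` between `a` and `b`
  -- contributes two. An increase by exactly one therefore leaves no such entry.
  ℓ-transpose : ∀ X {a b} M Y → a < b → All (λ m → m ≢ a × m ≢ b) M →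
    Σ ℕ λ k → ℓ (X ++ b ∷ M ++ a ∷ Y) ≡ suc (k + k) + ℓ (X ++ a ∷ M ++ b ∷ Y) × (k ≡ 0 → All (λ m → m < a ⊎ b < m) M)
  ℓ-transpose X {a} {b} M Y h ps with between-count h M ps
  ... | k , u , v , w = k , ℓ-prefix (suc (k + k)) X {a ∷ M ++ b ∷ Y} {b ∷ M ++ a ∷ Y} counts lengths , w
    where
    counts : ∀ x → cntLess x (a ∷ M ++ b ∷ Y) ≡ cntLess x (b ∷ M ++ a ∷ Y)
    counts x rewrite cntLess-insert x M b Y | cntLess-insert x M a Y =
      solve 3 (λ p q r → p :+ (q :+ r) := q :+ (p :+ r)) refl (one (a <ᵇ x)) (one (b <ᵇ x)) (cntLess x (M ++ Y))
    lengths : ℓ (b ∷ M ++ a ∷ Y) ≡ suc (k + k) + ℓ (a ∷ M ++ b ∷ Y)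
    lengths rewrite ℓ-insert M a Y | ℓ-insert M b Y | cntLess-insert a M b Y | cntLess-insert b M a Y | cntLess-++ a M Y | cntLess-++ b M Y
      | u | v | <ᵇ-true h | <ᵇ-false (<⇒≯ h) =
      solve 6 (λ cl cg k ya yb l → (con 1 :+ (cl :+ k :+ yb)) :+ ((cg :+ k) :+ ya :+ l) := con 1 :+ (k :+ k) :+ ((con 0 :+ (cl :+ ya)) :+ (cg :+ yb :+ l)))
        refl (cntLess a M) (cntGreater b M) k (cntLess a Y) (cntLess b Y) (ℓ (M ++ Y))

interval : (ℕ → ℕ) → ℕ → ℕ → List ℕ
interval f i m = applyUpTo (λ k → f (i + suc k)) m

word-split : ∀ (f : ℕ → ℕ) i m r → map f (upTo (i + suc (m + suc r))) ≡
  applyUpTo f i ++ f i ∷ interval f i m ++ f (i + suc m) ∷ interval f (i + suc m) r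
word-split f i m r = trans (map-upTo f _) (trans (applyUpTo-++ f i (suc (m + suc r))) (cong (applyUpTo f i ++_)
  (cong₂ _∷_ (cong f (+-identityʳ i)) (trans (applyUpTo-++ (λ k → f (i + suc k)) m (suc r)) (cong (interval f i m ++_)
    (cong₂ _∷_ (cong (λ x → f (i + suc x)) (+-identityʳ m)) (applyUpTo-cong r λ k _ → cong f
      (trans (cong (i +_) (sym (cong suc refl))) (sym (+-assoc i (suc m) (suc k)))))))))))

module _ {n : ℕ} (P : Perm n) {i j : ℕ} (i<j : i < j) (hi : i < n) (hj : j < n) where

  private
    f : ℕ → ℕ
    f = to P

  record Splitting : Set where
    field
      X M Y : List ℕ
      before-swap : word P ≡ X ++ f i ∷ M ++ f j ∷ Y
      after-swap : word (mulʳ P i j hi hj) ≡ X ++ f j ∷ M ++ f i ∷ Y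
      apart : All (λ m → m ≢ f i × m ≢ f j) M
      adjacent : j ≡ suc i → M ≡ []
      middle : ∀ x → i < x → x < j → f x ∈ M

  splitting : Splitting
  splitting = go (m≤n⇒∃[o]m+o≡n i<j) (m≤n⇒∃[o]m+o≡n hj)
    where
    go : (∃ λ m → suc i + m ≡ j) → (∃ λ r → suc j + r ≡ n) → Splitting
    go (m , ej) (r , en) = record
      { X = applyUpTo f i ; M = interval f i m ; Y = interval f j r
      ; before-swap = trans (cong (λ x → map f (upTo x)) en′) (trans (word-split f i m r)
          (cong (λ x → applyUpTo f i ++ f i ∷ interval f i m ++ f x ∷ interval f x r) ej′))
      ; after-swap = trans (cong (λ x → map g (upTo x)) en′) (trans (word-split g i m r)
          (trans (cong (λ x → applyUpTo g i ++ g i ∷ interval g i m ++ g x ∷ interval g x r) ej′)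
            (cong₂ _++_ (applyUpTo-cong i λ k l → other (<⇒≢ l) (<⇒≢ (<-trans l i<j)))
              (cong₂ _∷_ (cong f (swap-left i j)) (cong₂ _++_ (applyUpTo-cong m λ k l → other (λ e → <⇒≢ (inside k l .proj₁) (sym e)) (<⇒≢ (inside k l .proj₂)))
                (cong₂ _∷_ (cong f (swap-right i j)) (applyUpTo-cong r λ k l → other (λ e → <⇒≢ (<-trans i<j (j< k)) (sym e)) (λ e → <⇒≢ (j< k) (sym e)))))))))
      ; apart = All.applyUpTo⁺₁ _ m λ {k} l → (λ e → <⇒≢ (inside k l .proj₁) (sym (injective P e))) , λ e → <⇒≢ (inside k l .proj₂) (injective P e)
      ; adjacent = λ q → cong (interval f i) (+-cancelˡ-≡ (suc i) m 0 (trans ej (trans q (sym (+-identityʳ (suc i))))))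
      ; middle = λ x l l' → find (m≤n⇒∃[o]m+o≡n l) l' }
      where
      g : ℕ → ℕ
      g = to (mulʳ P i j hi hj)
      ej′ : i + suc m ≡ j
      ej′ = trans (+-suc i m) ej
      en′ : n ≡ i + suc (m + suc r)
      en′ = trans (sym en) (trans (cong (λ x → suc (x + r)) (sym ej)) (solve 3 (λ i m r → con 1 :+ ((con 1 :+ (i :+ m)) :+ r) := i :+ (con 1 :+ (m :+ (con 1 :+ r)))) refl i m r))
        where open Data.Nat.Solver.+-*-Solver
      other : ∀ {v} → v ≢ i → v ≢ j → g v ≡ f v
      other p q = cong f (swap-other p q)
      inside : ∀ k → k < m → i < i + suc k × i + suc k < j
      inside k l = subst (suc i ≤_) (sym (+-suc i k)) (s≤s (m≤m+n i k)) , subst (i + suc k <_) ej′ (+-monoʳ-< i (s≤s l))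
      j< : ∀ k → j < j + suc k
      j< k = subst (suc j ≤_) (sym (+-suc j k)) (s≤s (m≤m+n j k))
      find : ∀ {x} → (∃ λ k → suc i + k ≡ x) → x < j → f x ∈ interval f i m
      find (k , refl) l = subst (λ v → f v ∈ interval f i m) (+-suc i k) (Membership.∈-applyUpTo⁺ (λ k → f (i + suc k))
        (+-cancelˡ-< (suc i) k m (subst (suc (i + k) <_) (sym ej) l)))

  ℓ-cover : ℓ (word (mulʳ P i j hi hj)) ≡ suc (ℓ (word P)) → IsCover P i j
  ℓ-cover e = go (<-cmp (f i) (f j))
    where
    open Splitting splitting
    e′ : ℓ (X ++ f j ∷ M ++ f i ∷ Y) ≡ suc (ℓ (X ++ f i ∷ M ++ f j ∷ Y))
    e′ = subst₂ (λ u v → ℓ u ≡ suc (ℓ v)) after-swap before-swap e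
    go : _ → IsCover P i j
    go (tri≈ _ q _) = ⊥-elim (<⇒≢ i<j (injective P q))
    go (tri> _ _ h) with ℓ-transpose X M Y h (AllBase.map (λ p → proj₂ p , proj₁ p) apart)
    ... | k , q , _ = ⊥-elim (<-irrefl refl (≤-trans (m≤n+m (suc (ℓ (X ++ f i ∷ M ++ f j ∷ Y))) (suc (k + k))) (≤-reflexive e″)))
      where
      e″ : suc (k + k + suc (ℓ (X ++ f i ∷ M ++ f j ∷ Y))) ≡ ℓ (X ++ f i ∷ M ++ f j ∷ Y)
      e″ = sym (trans q (cong (λ x → suc (k + k) + x) e′))
    go (tri< h _ _) with ℓ-transpose X M Y h apart
    ... | k , q , w = h , λ x l l' → AllBase.lookup (w (zero-k k (+-cancelʳ-≡ (ℓ (X ++ f i ∷ M ++ f j ∷ Y)) (k + k) 0 (suc-injective (trans (sym q) e′))))) (middle x l l')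
      where
      zero-k : ∀ k → k + k ≡ 0 → k ≡ 0
      zero-k zero _ = refl

ℓ-adjacent : ∀ X {a b} Y → a < b → ℓ (X ++ b ∷ a ∷ Y) ≡ suc (ℓ (X ++ a ∷ b ∷ Y))
ℓ-adjacent X Y h = proj₁ (proj₂ (ℓ-transpose X [] Y h []))

module _ {n : ℕ} (P : Perm n) (i : ℕ) (hi : i < n) (hj : suc i < n) where

  ℓ-ascent : Ascent P i → ℓ (word (stepʳ P i hi hj)) ≡ suc (ℓ (word P))
  ℓ-ascent h = trans (cong ℓ (after [] (adjacent refl) after-swap)) (trans (ℓ-adjacent X Y h) (cong (λ w → suc (ℓ w)) (sym (after [] (adjacent refl) before-swap))))
    where
    open Splitting (splitting P ≤-refl hi hj)
    after : ∀ M' {a b w} → M ≡ M' → w ≡ X ++ a ∷ M ++ b ∷ Y → w ≡ X ++ a ∷ M' ++ b ∷ Y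
    after _ refl e = e

ℓ-descent : ∀ {n} (P : Perm n) i (hi : i < n) (hj : suc i < n) → Descent P i → ℓ (word P) ≡ suc (ℓ (word (stepʳ P i hi hj)))
ℓ-descent {n} P i hi hj h = trans (cong ℓ (map-upTo-cong n λ k _ → sym (stepʳ-stepʳ P i hi hj k)))
  (ℓ-ascent (stepʳ P i hi hj) i hi hj (stepʳ-ascent P i hi hj h))

-- The left action applies to π, which is a list and not a `Perm`; whether it rises is decided by
-- the order in which two consecutive values occur there.
data Before (a b : ℕ) : List ℕ → Set where
  here : ∀ {xs} → b ∈ xs → Before a b (a ∷ xs)
  there : ∀ {x xs} → Before a b xs → Before a b (x ∷ xs)

before-map : ∀ (f : ℕ → ℕ) {a b xs} → Before a b xs → Before (f a) (f b) (map f xs)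
before-map f (here h) = here (Membership.∈-map⁺ f h)
before-map f (there h) = there (before-map f h)

before-++ʳ : ∀ {a b} xs {ys} → Before a b ys → Before a b (xs ++ ys)
before-++ʳ [] h = h
before-++ʳ (x ∷ xs) h = there (before-++ʳ xs h)

before-++ : ∀ {a b xs ys} → a ∈ xs → b ∈ ys → Before a b (xs ++ ys)
before-++ {xs = x ∷ xs} (here refl) k = here (Membership.∈-++⁺ʳ xs k)
before-++ (there h) k = there (before-++ h k)

before-sorted : ∀ {a b xs} → AllPairs _<_ xs → a ∈ xs → b ∈ xs → a < b → Before a b xs
before-sorted (_ ∷ _) (here refl) (here refl) l = ⊥-elim (<-irrefl refl l)
before-sorted (_ ∷ _) (here refl) (there k) l = here k
before-sorted (h ∷ _) (there p) (here refl) l = ⊥-elim (<-asym l (AllBase.lookup h p))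
before-sorted (_ ∷ s) (there p) (there q) l = there (before-sorted s p q l)

upTo-sorted : ∀ n → AllPairs _<_ (upTo n)
upTo-sorted n = AllPairsProperties.applyUpTo⁺₁ (λ k → k) n λ l _ → l

module Values (k : ℕ) where

  private
    σ : ℕ → ℕ
    σ = swapℕ k (suc k)

  σ-< : ∀ {x y} → ¬ (x ≡ k × y ≡ suc k) → x < y → σ x < σ y
  σ-< {x} {y} ne l with adjacent-< k (subst₂ _<_ (sym (swap-involutive k (suc k) x)) (sym (swap-involutive k (suc k) y)) l)
  ... | inj₁ m = m
  ... | inj₂ (p , q) = ⊥-elim (ne (trans (sym (swap-involutive k (suc k) x)) (trans (cong σ p) (swap-right k (suc k))) ,
    trans (sym (swap-involutive k (suc k) y)) (trans (cong σ q) (swap-left k (suc k)))))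

  σ-<ᵇ : ∀ {x y} → ¬ (x ≡ k × y ≡ suc k) → ¬ (y ≡ k × x ≡ suc k) → (σ x <ᵇ σ y) ≡ (x <ᵇ y)
  σ-<ᵇ {x} {y} p q with x <? y
  ... | yes l = trans (<ᵇ-true (σ-< p l)) (sym (<ᵇ-true l))
  ... | no l with <-cmp x y
  ...   | tri< m _ _ = ⊥-elim (l m)
  ...   | tri≈ _ refl _ = trans (<ᵇ-false (<-irrefl {σ x} refl)) (sym (<ᵇ-false l))
  ...   | tri> _ _ m = trans (<ᵇ-false (<⇒≯ (σ-< q m))) (sym (<ᵇ-false l))

  cntLess-σ : ∀ x ys → ¬ (x ≡ k × suc k ∈ ys) → ¬ (x ≡ suc k × k ∈ ys) → cntLess (σ x) (map σ ys) ≡ cntLess x ys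
  cntLess-σ x [] p q = refl
  cntLess-σ x (y ∷ ys) p q = cong₂ _+_ (cong one (σ-<ᵇ {y} {x} (λ { (refl , refl) → q (refl , here refl) }) λ { (refl , refl) → p (refl , here refl) }))
    (cntLess-σ x ys (λ { (e , h) → p (e , there h) }) λ { (e , h) → q (e , there h) })

  ℓ-σ : ∀ xs → k ∉ xs ⊎ suc k ∉ xs → ℓ (map σ xs) ≡ ℓ xs
  ℓ-σ [] h = refl
  ℓ-σ (x ∷ xs) (inj₁ h) = cong₂ _+_ (cntLess-σ x xs (λ { (refl , _) → h (here refl) }) λ { (_ , m) → h (there m) }) (ℓ-σ xs (inj₁ λ m → h (there m)))
  ℓ-σ (x ∷ xs) (inj₂ h) = cong₂ _+_ (cntLess-σ x xs (λ { (_ , m) → h (there m) }) λ { (refl , _) → h (here refl) }) (ℓ-σ xs (inj₂ λ m → h (there m)))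

  cntLess-σ-left : ∀ ys → Unique ys → k ∉ ys → suc k ∈ ys → cntLess (σ k) (map σ ys) ≡ suc (cntLess k ys)
  cntLess-σ-left (y ∷ ys) (u ∷ us) h (here refl) rewrite swap-right k (suc k) | swap-left k (suc k) | <ᵇ-true {k} {suc k} ≤-refl | <ᵇ-false {suc k} {k} (<⇒≯ ≤-refl) =
    cong suc (trans (cong (λ x → cntLess x (map σ ys)) (sym (swap-left k (suc k)))) (cntLess-σ k ys (λ { (_ , m) → AllBase.lookup u m refl }) λ { (e , _) → 1+n≢n (sym e) }))
  cntLess-σ-left (y ∷ ys) (u ∷ us) h (there m) = trans (cong₂ _+_ (cong one (σ-<ᵇ {y} {k} (λ { (e , _) → h (here (sym e)) }) λ { (_ , e) → AllBase.lookup u m e })) (cntLess-σ-left ys us (λ q → h (there q)) m))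
    (+-suc (one (y <ᵇ k)) _)

  ℓ-swapVal : ∀ w → Unique w → Before k (suc k) w → ℓ (swapVal k (suc k) w) ≡ suc (ℓ w)
  ℓ-swapVal (.k ∷ w) (u ∷ us) (here m) = cong₂ _+_ (cntLess-σ-left w us k∉ m) (ℓ-σ w (inj₁ k∉))
    where
    k∉ : k ∉ w
    k∉ q = AllBase.lookup u q refl
  ℓ-swapVal (x ∷ w) (u ∷ us) (there b) = trans (cong₂ _+_ (cntLess-σ x w
      (λ { (e , _) → AllBase.lookup u (proj₁ (both b)) e }) (λ { (e , _) → AllBase.lookup u (proj₂ (both b)) e })) (ℓ-swapVal w us b)) (+-suc (cntLess x w) (ℓ w))
    where
    both : ∀ {a b xs} → Before a b xs → a ∈ xs × b ∈ xs
    both (here m) = here refl , there m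
    both (there h) = there (proj₁ (both h)) , there (proj₂ (both h))

  unswapVal : ∀ w → swapVal k (suc k) (swapVal k (suc k) w) ≡ w
  unswapVal [] = refl
  unswapVal (x ∷ w) = cong₂ _∷_ (swap-involutive k (suc k) x) (unswapVal w)

  unique-swapVal : ∀ {w} → Unique w → Unique (swapVal k (suc k) w)
  unique-swapVal = UniqueProperties.map⁺ (swap-injective k (suc k))

  ℓ-swapVal⁻ : ∀ w → Unique w → Before (suc k) k w → ℓ w ≡ suc (ℓ (swapVal k (suc k) w))
  ℓ-swapVal⁻ w u b = trans (cong ℓ (sym (unswapVal w))) (ℓ-swapVal (swapVal k (suc k) w) (unique-swapVal u)
    (subst₂ (λ a b → Before a b (map σ w)) (swap-right k (suc k)) (swap-left k (suc k)) (before-map σ b)))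

  heckeL-rise : ∀ w → Unique w → Before k (suc k) w → heckeL k w ≡ swapVal k (suc k) w
  heckeL-rise w u b rewrite ℓ-swapVal w u b | <ᵇ-true {ℓ w} {suc (ℓ w)} ≤-refl = refl

  heckeL-fall : ∀ w → Unique w → Before (suc k) k w → heckeL k w ≡ w
  heckeL-fall w u b rewrite <ᵇ-false {ℓ w} {ℓ (swapVal k (suc k) w)} (λ l → <⇒≱ l (≤-trans (n≤1+n _) (≤-reflexive (sym (ℓ-swapVal⁻ w u b))))) = refl

unique-word : ∀ {n} (P : Perm n) → Unique (word P)
unique-word {n} P = UniqueProperties.map⁺ (injective P) (UniqueProperties.upTo⁺ n)

ℓ-ascentˡ : ∀ {n} (P : Perm n) k (hk : k < n) (hk' : suc k < n) → Ascentˡ P k → ℓ (word (stepˡ P k hk hk')) ≡ suc (ℓ (word P))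
ℓ-ascentˡ {n} P k hk hk' h = trans (cong ℓ (map-∘ (upTo n))) (Values.ℓ-swapVal k (word P) (unique-word P)
  (subst₂ (λ a b → Before a b (word P)) (to-from P k) (to-from P (suc k)) (before-map (to P)
    (before-sorted (upTo-sorted n) (Membership.∈-upTo⁺ (bounded (inverse P) hk)) (Membership.∈-upTo⁺ (bounded (inverse P) hk')) h))))

ℓ-identity : ∀ n → ℓ (upTo n) ≡ 0
ℓ-identity n = sorted-zero (upTo n) (upTo-sorted n)
  where
  none : ∀ x ys → All (x <_) ys → cntLess x ys ≡ 0
  none x [] [] = refl
  none x (y ∷ ys) (h ∷ hs) rewrite <ᵇ-false (<⇒≯ h) = none x ys hs
  sorted-zero : ∀ xs → AllPairs _<_ xs → ℓ xs ≡ 0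
  sorted-zero [] [] = refl
  sorted-zero (x ∷ xs) (h ∷ hs) = cong₂ _+_ (none x xs h) (sorted-zero xs hs)

-- Blocks and the 0-Hecke action

set⇒↭ : ∀ {xs ys : List ℕ} → Unique xs → Unique ys → (∀ {v} → v ∈ xs → v ∈ ys) → (∀ {v} → v ∈ ys → v ∈ xs) → xs ↭ ys
set⇒↭ u u' f g = BagSet.∼bag⇒↭ (MembershipK.unique∧set⇒bag u u' (mk⇔ f g))

unique-map : ∀ (f : ℕ → ℕ) {xs} → Unique xs → (∀ {x y} → x ∈ xs → y ∈ xs → f x ≡ f y → x ≡ y) → Unique (map f xs)
unique-map f [] inj = []
unique-map f (u ∷ us) inj = All.map⁺ (AllBase.tabulate λ m e → AllBase.lookup u m (inj (here refl) (there m) e)) ∷ unique-map f us λ p q → inj (there p) (there q)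

map-cong-∈ : ∀ {f g : ℕ → ℕ} xs → (∀ {v} → v ∈ xs → f v ≡ g v) → map f xs ≡ map g xs
map-cong-∈ xs h = map-cong-local (AllBase.tabulate h)

cntLess-↭ : ∀ x {xs ys} → xs ↭ ys → cntLess x xs ≡ cntLess x ys
cntLess-↭ x ↭.refl = refl
cntLess-↭ x (↭.prep y p) = cong (one (y <ᵇ x) +_) (cntLess-↭ x p)
cntLess-↭ x (↭.swap {xs} {ys} y w p) = trans (cong (λ t → one (y <ᵇ x) + (one (w <ᵇ x) + t)) (cntLess-↭ x p))
  (trans (sym (+-assoc (one (y <ᵇ x)) (one (w <ᵇ x)) (cntLess x ys))) (trans (cong (_+ cntLess x ys) (+-comm (one (y <ᵇ x)) (one (w <ᵇ x)))) (+-assoc (one (w <ᵇ x)) (one (y <ᵇ x)) (cntLess x ys))))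
cntLess-↭ x (↭.trans p q) = trans (cntLess-↭ x p) (cntLess-↭ x q)

elem-true : ∀ {x xs} → x ∈ xs → elem x xs ≡ true
elem-true {x} (here refl) rewrite ≡ᵇ-refl x = refl
elem-true {x} {y ∷ xs} (there h) with y ≡ᵇ x
... | true = refl
... | false = elem-true h

elem-false : ∀ {x} xs → x ∉ xs → elem x xs ≡ false
elem-false [] h = refl
elem-false {x} (y ∷ xs) h rewrite ≡ᵇ-false {y} {x} (λ e → h (here (sym e))) = elem-false xs λ m → h (there m)

one-≤ : ∀ {y v w} → v ≤ w → one (y <ᵇ v) ≤ one (y <ᵇ w)
one-≤ {y} {v} {w} h with y <? v
... | yes l rewrite <ᵇ-true l | <ᵇ-true (<-≤-trans l h) = ≤-refl
... | no l rewrite <ᵇ-false l = z≤n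

cntLess-≤ : ∀ {v w} → v ≤ w → ∀ xs → cntLess v xs ≤ cntLess w xs
cntLess-≤ h [] = ≤-refl
cntLess-≤ h (y ∷ xs) = +-mono-≤ (one-≤ h) (cntLess-≤ h xs)

cntLess-< : ∀ {v w xs} → v < w → v ∈ xs → cntLess v xs < cntLess w xs
cntLess-< {v} {w} {_ ∷ xs} h (here refl) rewrite <ᵇ-true h | <ᵇ-false (<-irrefl {v} refl) = s≤s (cntLess-≤ (<⇒≤ h) xs)
cntLess-< {v} {w} {y ∷ xs} h (there m) = +-mono-≤-< (one-≤ (<⇒≤ h)) (cntLess-< h m)

cntLess-injective : ∀ {xs v w} → v ∈ xs → w ∈ xs → cntLess v xs ≡ cntLess w xs → v ≡ w
cntLess-injective {xs} {v} {w} p q e with <-cmp v w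
... | tri< h _ _ = ⊥-elim (<-irrefl e (cntLess-< h p))
... | tri≈ _ e' _ = e'
... | tri> _ _ h = ⊥-elim (<-irrefl (sym e) (cntLess-< h q))

cntLess-none : ∀ x {ys} → All (x <_) ys → cntLess x ys ≡ 0
cntLess-none x [] = refl
cntLess-none x (h ∷ hs) rewrite <ᵇ-false (<⇒≯ h) = cntLess-none x hs

cntLess-all : ∀ x {ys} → All (_< x) ys → cntLess x ys ≡ length ys
cntLess-all x [] = refl
cntLess-all x (h ∷ hs) rewrite <ᵇ-true h = cong suc (cntLess-all x hs)

-- In an increasing list the rank of a value is its index.
at-sorted : ∀ (g : ℕ → ℕ) {S} → AllPairs _<_ S → ∀ {v} → v ∈ S → at (map g S) (cntLess v S) ≡ g v
at-sorted g {x ∷ S} (h ∷ s) (here refl) rewrite <ᵇ-false (<-irrefl {x} refl) | cntLess-none x h = refl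
at-sorted g (h ∷ s) (there m) rewrite <ᵇ-true (AllBase.lookup h m) = at-sorted g s m

ranks-sorted : ∀ {S} → AllPairs _<_ S → map (λ v → cntLess v S) S ≡ upTo (length S)
ranks-sorted [] = refl
ranks-sorted {x ∷ S} (h ∷ s) = cong₂ _∷_ (trans (cong (_+ cntLess x S) (cong one (<ᵇ-false (<-irrefl {x} refl)))) (cntLess-none x h))
  (trans (map-cong-∈ S λ {v} m → cong (λ t → one t + cntLess v S) (<ᵇ-true (AllBase.lookup h m)))
    (trans (map-∘ S) (trans (cong (map suc) (ranks-sorted s)) (map-upTo suc (length S)))))

sorted-unique-list : ∀ {S} → AllPairs _<_ S → Unique S
sorted-unique-list = AllPairsBase.map <⇒≢

swapℕ-suc : ∀ a b k → swapℕ (suc a) (suc b) (suc k) ≡ suc (swapℕ a b k)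
swapℕ-suc a b k with k ≡ᵇ a
... | true = refl
... | false with k ≡ᵇ b
...   | true = refl
...   | false = refl

swapPos-adjacent : ∀ X {a b} Y → swapPos (length X) (suc (length X)) (X ++ a ∷ b ∷ Y) ≡ X ++ b ∷ a ∷ Y
swapPos-adjacent [] {a} {b} Y = cong (λ t → b ∷ a ∷ t) (trans (cong (map _) (sym (map-upTo (λ k → suc (suc k)) (length Y)))) (trans (sym (map-∘ (upTo (length Y)))) (positions Y)))
  where
  positions : ∀ Y → map (at Y) (upTo (length Y)) ≡ Y
  positions [] = refl
  positions (y ∷ Y) = cong (y ∷_) (trans (cong (map _) (sym (map-upTo suc (length Y)))) (trans (sym (map-∘ (upTo (length Y)))) (positions Y)))
swapPos-adjacent (x ∷ X) {a} {b} Y = cong (x ∷_) (trans (cong (map _) (sym (map-upTo suc (length w))))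
  (trans (sym (map-∘ (upTo (length w)))) (trans (map-cong-∈ (upTo (length w)) λ {k} _ → cong (at (x ∷ w)) (swapℕ-suc (length X) (suc (length X)) k)) (swapPos-adjacent X Y))))
  where
  w : List ℕ
  w = X ++ a ∷ b ∷ Y

heckeR-rise : ∀ X {a b} Y → a < b → heckeR (X ++ a ∷ b ∷ Y) (length X) ≡ X ++ b ∷ a ∷ Y
heckeR-rise X {a} {b} Y h rewrite swapPos-adjacent X {a} {b} Y | ℓ-adjacent X Y h | <ᵇ-true {ℓ (X ++ a ∷ b ∷ Y)} {suc (ℓ (X ++ a ∷ b ∷ Y))} ≤-refl = refl

heckeR-fall : ∀ X {a b} Y → b < a → heckeR (X ++ a ∷ b ∷ Y) (length X) ≡ X ++ a ∷ b ∷ Y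
heckeR-fall X {a} {b} Y h rewrite swapPos-adjacent X {a} {b} Y | ℓ-adjacent X Y h
  | <ᵇ-false {suc (ℓ (X ++ b ∷ a ∷ Y))} {ℓ (X ++ b ∷ a ∷ Y)} (λ l → <⇒≱ l (n≤1+n _)) = refl

-- S is the set of values of one block, in increasing order.
module SortedBlock {S : List ℕ} (sorted : AllPairs _<_ S) (z : ℕ → ℕ) (z-closed : ∀ {v} → v ∈ S → z v ∈ S) (z-z : ∀ v → z (z v) ≡ v) where

  B : List ℕ
  B = map z S

  B↭S : B ↭ S
  B↭S = set⇒↭ (UniqueProperties.map⁺ (λ {x} {y} e → trans (sym (z-z x)) (trans (cong z e) (z-z y))) (sorted-unique-list sorted)) (sorted-unique-list sorted)
    (λ m → from-image (Membership.∈-map⁻ z m)) (λ {v} m → subst (_∈ B) (z-z v) (Membership.∈-map⁺ z (z-closed m)))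
    where
    from-image : ∀ {v} → (∃ λ x → x ∈ S × v ≡ z x) → v ∈ S
    from-image (x , m , refl) = z-closed m

  r : ℕ → ℕ
  r v = cntLess v S

  std-B : std B ≡ map r B
  std-B = map-cong-∈ B λ {v} _ → cntLess-↭ v B↭S

  -- `std B` is `z` carried over from values to ranks, so it squares to the identity because `z`
  -- does.
  std-involution : IsInvolution (std B)
  std-involution rewrite std-B = begin
    map (at (map r B)) (map r B)                          ≡⟨ cong (map (at (map r B))) (sym (map-∘ S)) ⟩
    map (at (map r B)) (map (λ v → r (z v)) S)            ≡⟨ map-∘ S ⟨
    map (λ v → at (map r B) (r (z v))) S                  ≡⟨ map-cong-∈ S (λ m → trans (cong (λ w → at w (r (z _))) (sym (map-∘ S))) (trans (at-sorted (λ v → r (z v)) sorted (z-closed m)) (cong r (z-z _)))) ⟩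
    map r S                                               ≡⟨ ranks-sorted sorted ⟩
    upTo (length S)                                       ≡⟨ cong upTo (sym (trans (length-map r B) (length-map z S))) ⟩
    upTo (length (map r B)) ∎
    where open ≡-Reasoning

  destd-ranks : ∀ Y → (∀ {v} → v ∈ Y → v ∈ S) → destd B (map r Y) ≡ Y
  destd-ranks Y h = trans (sym (map-∘ Y)) (trans (map-cong-∈ Y λ {v} m → value (h m) B (λ p → Perm↭.∈-resp-↭ B↭S p) (Perm↭.∈-resp-↭ (↭.↭-sym B↭S) (h m))) (map-id Y))
    where
    value : ∀ {v} → v ∈ S → ∀ xs → (∀ {x} → x ∈ xs → x ∈ S) → v ∈ xs → valOfRank B (r v) xs ≡ v
    value {v} vS (x ∷ xs) sub m rewrite cntLess-↭ x B↭S with r x ≡ᵇ r v in e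
    ... | true = cntLess-injective (sub (here refl)) vS (≡ᵇ-true (r x) (r v) e)
    value {v} vS (x ∷ xs) sub (here refl) | false = ⊥-elim (false≢true (trans (sym e) (≡ᵇ-refl (r v))))
      where
      false≢true : false ≢ true
      false≢true ()
    value {v} vS (x ∷ xs) sub (there m) | false = value vS xs (λ p → sub (there p)) m

  -- Consecutive values of one block are neighbours in its sorted value set. Hence their ranks are
  -- `length X` and its successor, and the same two numbers are the indices at which the right step
  -- of `blockStep` acts.
  module Step {i : ℕ} {X Y : List ℕ} (split : S ≡ X ++ i ∷ suc i ∷ Y) (below-X : All (_< i) X) (above-Y : All (suc i <_) Y) where

    j : ℕ
    j = suc i
    σ : ℕ → ℕ
    σ = swapℕ i j
    k : ℕ
    k = length X

    i∈ : i ∈ S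
    i∈ = subst (i ∈_) (sym split) (Membership.∈-++⁺ʳ X (here refl))
    j∈ : j ∈ S
    j∈ = subst (j ∈_) (sym split) (Membership.∈-++⁺ʳ X (there (here refl)))

    σ-closed : ∀ {v} → v ∈ S → σ v ∈ S
    σ-closed {v} m with swapView i j v
    ... | is-left _ e = subst (_∈ S) (sym e) j∈
    ... | is-right _ e = subst (_∈ S) (sym e) i∈
    ... | is-other _ _ e = subst (_∈ S) (sym e) m

    r-i : r i ≡ k
    r-i = trans (cong (cntLess i) split) (trans (cntLess-++ i X (i ∷ j ∷ Y)) (trans (cong₂ _+_ (cntLess-all i below-X)
      (cong₂ _+_ (cong one (<ᵇ-false (<-irrefl {i} refl))) (cntLess-none i (≤-refl ∷ AllBase.map (<-trans ≤-refl) above-Y)))) (+-identityʳ k)))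

    r-j : r j ≡ suc k
    r-j = trans (cong (cntLess j) split) (trans (cntLess-++ j X (i ∷ j ∷ Y)) (trans (cong₂ _+_ (cntLess-all j (AllBase.map (λ l → <-trans l ≤-refl) below-X))
      (cong₂ _+_ (cong one (<ᵇ-true {i} {j} ≤-refl)) (trans (cong (_+ cntLess j Y) (cong one (<ᵇ-false (<-irrefl {j} refl)))) (cntLess-none j above-Y)))) (+-comm k 1)))

    rank-B : cntLess i B ≡ k
    rank-B = trans (cntLess-↭ i B↭S) r-i

    blockStep-unfold : blockStep i B ≡ destd B (heckeR (heckeL k (map r B)) k)
    blockStep-unfold rewrite rank-B | std-B = refl

    unique-ranks : Unique (map r B)
    unique-ranks = unique-map r (UniqueProperties.map⁺ (λ {x} {y} e → trans (sym (z-z x)) (trans (cong z e) (z-z y))) (sorted-unique-list sorted))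
      λ p q → cntLess-injective (Perm↭.∈-resp-↭ B↭S p) (Perm↭.∈-resp-↭ B↭S q)

    before-rank : ∀ {a b} → a ∈ S → b ∈ S → z a < z b → Before (r a) (r b) (map r B)
    before-rank {a} {b} p q h = subst₂ (λ u v → Before (r u) (r v) (map r B)) (z-z a) (z-z b)
      (before-map r (before-map z (before-sorted sorted (z-closed p) (z-closed q) h)))

    map-split : ∀ (g : ℕ → ℕ) → map g S ≡ map g X ++ g i ∷ g j ∷ map g Y
    map-split g = trans (cong (map g) split) (map-++ g X (i ∷ j ∷ Y))

    map-σ-outside : ∀ (g : ℕ → ℕ) → map g X ++ g j ∷ g i ∷ map g Y ≡ map (λ v → g (σ v)) S
    map-σ-outside g = sym (trans (map-split (λ v → g (σ v))) (cong₂ _++_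
      (map-cong-∈ X λ m → cong g (swap-other (<⇒≢ (AllBase.lookup below-X m)) (<⇒≢ (<-trans (AllBase.lookup below-X m) ≤-refl))))
      (cong₂ _∷_ (cong g (swap-left i j)) (cong₂ _∷_ (cong g (swap-right i j))
        (map-cong-∈ Y λ m → cong g (swap-other (λ e → <⇒≢ (<-trans ≤-refl (AllBase.lookup above-Y m)) (sym e)) (λ e → <⇒≢ (AllBase.lookup above-Y m) (sym e))))))))

    heckeR-map-rise : ∀ (g : ℕ → ℕ) → g i < g j → heckeR (map g S) k ≡ map (λ v → g (σ v)) S
    heckeR-map-rise g h = trans (cong₂ heckeR (map-split g) (sym (length-map g X))) (trans (heckeR-rise (map g X) (map g Y) h) (map-σ-outside g))

    heckeR-map-fall : ∀ (g : ℕ → ℕ) → g j < g i → heckeR (map g S) k ≡ map g S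
    heckeR-map-fall g h = trans (cong₂ heckeR (map-split g) (sym (length-map g X))) (trans (heckeR-fall (map g X) (map g Y) h) (sym (map-split g)))

    swap-ranks : ∀ {v} → v ∈ S → swapℕ k (suc k) (r v) ≡ r (σ v)
    swap-ranks {v} m with swapView i j v
    ... | is-left refl e = trans (cong (swapℕ k (suc k)) r-i) (trans (swap-left k (suc k)) (trans (sym r-j) (cong r (sym e))))
    ... | is-right refl e = trans (cong (swapℕ k (suc k)) r-j) (trans (swap-right k (suc k)) (trans (sym r-i) (cong r (sym e))))
    ... | is-other p q e = trans (swap-other (λ h → p (cntLess-injective m i∈ (trans h (sym r-i)))) (λ h → q (cntLess-injective m j∈ (trans h (sym r-j))))) (cong r (sym e))

    heckeL-up : z i < z j → heckeL k (map r B) ≡ map (λ v → r (σ (z v))) S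
    heckeL-up h = trans (Values.heckeL-rise k (map r B) unique-ranks (subst₂ (λ a b → Before a b (map r B)) r-i r-j (before-rank i∈ j∈ h)))
      (trans (sym (map-∘ B)) (trans (sym (map-∘ S)) (map-cong-∈ S λ m → swap-ranks (z-closed m))))

    heckeL-down : z j < z i → heckeL k (map r B) ≡ map (λ v → r (z v)) S
    heckeL-down h = trans (Values.heckeL-fall k (map r B) unique-ranks (subst₂ (λ a b → Before a b (map r B)) r-j r-i (before-rank j∈ i∈ h))) (sym (map-∘ S))

    finish : ∀ (g : ℕ → ℕ) → (∀ {v} → v ∈ S → g v ∈ S) → destd B (map (λ v → r (g v)) S) ≡ map g S
    finish g h = trans (cong (destd B) (map-∘ S)) (destd-ranks (map g S) λ m → from-image (Membership.∈-map⁻ g m))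
      where
      from-image : ∀ {v} → (∃ λ x → x ∈ S × v ≡ g x) → v ∈ S
      from-image (x , m , refl) = h m

    step-conjugate : z i < z j → σ (z i) < σ (z j) → blockStep i B ≡ map (λ v → σ (z (σ v))) S
    step-conjugate h l = trans blockStep-unfold (trans (cong (λ w → destd B (heckeR w k)) (heckeL-up h))
      (trans (cong (destd B) (heckeR-map-rise (λ v → r (σ (z v))) (cntLess-< l (σ-closed (z-closed i∈))))) (finish (λ v → σ (z (σ v))) λ m → σ-closed (z-closed (σ-closed m)))))

    -- After the left step the two former fixed points form a descent, so the right step does
    -- nothing. This is why coupling multiplies on one side only.
    step-couple : z i ≡ i → z j ≡ j → blockStep i B ≡ map (λ v → σ (z v)) S
    step-couple p q = trans blockStep-unfold (trans (cong (λ w → destd B (heckeR w k)) (heckeL-up (subst₂ _<_ (sym p) (sym q) ≤-refl)))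
      (trans (cong (destd B) (heckeR-map-fall (λ v → r (σ (z v))) (subst₂ _<_ (cong r (trans (sym (swap-right i j)) (cong σ (sym q)))) (cong r (trans (sym (swap-left i j)) (cong σ (sym p)))) (cntLess-< ≤-refl i∈))))
        (finish (λ v → σ (z v)) λ m → σ-closed (z-closed m))))

    step-fall : z j < z i → blockStep i B ≡ B
    step-fall h = trans blockStep-unfold (trans (cong (λ w → destd B (heckeR w k)) (heckeL-down h))
      (trans (cong (destd B) (heckeR-map-fall (λ v → r (z v)) (cntLess-< h (z-closed j∈)))) (finish z z-closed)))

take-++ : ∀ (xs : List ℕ) {ys} → take (length xs) (xs ++ ys) ≡ xs
take-++ [] = refl
take-++ (x ∷ xs) = cong (x ∷_) (take-++ xs)

drop-++ : ∀ (xs : List ℕ) {ys} → drop (length xs) (xs ++ ys) ≡ ys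
drop-++ [] = refl
drop-++ (x ∷ xs) = drop-++ xs

blocks-concat : ∀ (Bs : List (List ℕ)) → blocks (map length Bs) (concat Bs) ≡ Bs
blocks-concat [] = refl
blocks-concat (B ∷ Bs) = cong₂ _∷_ (take-++ B) (trans (cong (blocks (map length Bs)) (drop-++ B)) (blocks-concat Bs))

any-true : ∀ {A : Set} (p : A → Bool) {x xs} → x ∈ xs → p x ≡ true → any p xs ≡ true
any-true p (here refl) e rewrite e = refl
any-true p {xs = y ∷ xs} (there m) e with p y
... | true = refl
... | false = any-true p m e

any-false : ∀ {A : Set} (p : A → Bool) xs → (∀ {x} → x ∈ xs → p x ≡ false) → any p xs ≡ false
any-false p [] h = refl
any-false p (x ∷ xs) h rewrite h (here refl) = any-false p xs λ m → h (there m)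

sorted-split : ∀ X {i Y} → AllPairs _<_ (X ++ i ∷ suc i ∷ Y) → All (_< i) X × All (suc i <_) Y
sorted-split [] (_ ∷ h ∷ _) = [] , h
sorted-split (x ∷ X) {i} (h ∷ s) with sorted-split X s
... | p , q = AllBase.lookup h (Membership.∈-++⁺ʳ X (here refl)) ∷ p , q

before-concat : ∀ (g : ℕ → List ℕ) {r r' xs} → Before r r' xs → ∀ {a b} → a ∈ g r → b ∈ g r' → Before a b (concat (map g xs))
before-concat g (here m) p q = before-++ p (Membership.∈-concat⁺′ q (Membership.∈-map⁺ g m))
before-concat g {xs = x ∷ xs} (there h) p q = before-++ʳ (g x) (before-concat g h p q)

module Encoding (n : ℕ) (μ : List ℕ) where

  m : ℕ
  m = length μ

  class : (ℕ → ℕ) → ℕ → List ℕ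
  class c r = filter (λ v → c v ≟ r) (upTo n)

  block : (c z : ℕ → ℕ) → ℕ → List ℕ
  block c z r = map z (class c r)

  -- The μ-involution whose r-th block has the values of colour r and standardises to z.
  encode : (c z : ℕ → ℕ) → List ℕ
  encode c z = concat (map (block c z) (upTo m))

  record State (c z : ℕ → ℕ) : Set where
    field
      involutive : ∀ v → z (z v) ≡ v
      in-range : ∀ {v} → v < n → z v < n
      preserves : ∀ v → c (z v) ≡ c v
      few-colours : ∀ {v} → v < n → c v < m
      sizes : map (λ r → length (class c r)) (upTo m) ≡ μ

  class-cong : ∀ {c c'} → (∀ {v} → v < n → c v ≡ c' v) → ∀ r → class c r ≡ class c' r
  class-cong {c} {c'} h r = go (upTo n) λ k → h (Membership.∈-upTo⁻ k)
    where
    go : ∀ xs → (∀ {v} → v ∈ xs → c v ≡ c' v) → filter (λ v → c v ≟ r) xs ≡ filter (λ v → c' v ≟ r) xs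
    go [] h = refl
    go (x ∷ xs) h = by-colour (c' x ≟ r)
      where
      by-colour : Dec (c' x ≡ r) → filter (λ v → c v ≟ r) (x ∷ xs) ≡ filter (λ v → c' v ≟ r) (x ∷ xs)
      by-colour (yes e) = trans (filter-accept (λ v → c v ≟ r) (trans (h (here refl)) e))
        (trans (cong (x ∷_) (go xs λ k → h (there k))) (sym (filter-accept (λ v → c' v ≟ r) e)))
      by-colour (no e) = trans (filter-reject (λ v → c v ≟ r) (λ e' → e (trans (sym (h (here refl))) e')))
        (trans (go xs λ k → h (there k)) (sym (filter-reject (λ v → c' v ≟ r) e)))

  encode-cong : ∀ {c c' z z'} → (∀ {v} → v < n → c v ≡ c' v) → (∀ v → z v ≡ z' v) → encode c z ≡ encode c' z'
  encode-cong {c} {c'} {z} {z'} h h' = cong concat (map-cong (λ r →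
    trans (cong (map z) (class-cong h r)) (map-cong-∈ (class c' r) λ {v} _ → h' v)) (upTo m))

  class-sorted : ∀ c r → AllPairs _<_ (class c r)
  class-sorted c r = AllPairsProperties.filter⁺ (λ v → c v ≟ r) (upTo-sorted n)

  ∈-class⁺ : ∀ {c v r} → v < n → c v ≡ r → v ∈ class c r
  ∈-class⁺ {c} {v} {r} h e = Membership.∈-filter⁺ (λ v → c v ≟ r) (Membership.∈-upTo⁺ h) e

  ∈-class⁻ : ∀ {c v r} → v ∈ class c r → v < n × c v ≡ r
  ∈-class⁻ {c} {v} {r} h with Membership.∈-filter⁻ (λ v → c v ≟ r) {xs = upTo n} h
  ... | k , e = Membership.∈-upTo⁻ k , e

  module _ {c z : ℕ → ℕ} (S : State c z) where

    open State S

    class-closed : ∀ {r v} → v ∈ class c r → z v ∈ class c r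
    class-closed {v = v} h with ∈-class⁻ {c} h
    ... | k , e = ∈-class⁺ (in-range k) (trans (preserves v) e)

    module SB r = SortedBlock (class-sorted c r) z class-closed involutive

    ∈-block⁺ : ∀ {v} → v < n → v ∈ block c z (c v)
    ∈-block⁺ {v} h = Perm↭.∈-resp-↭ (↭.↭-sym (SB.B↭S (c v))) (∈-class⁺ h refl)

    ∈-block⁻ : ∀ {v r} → v ∈ block c z r → v < n × c v ≡ r
    ∈-block⁻ {r = r} h = ∈-class⁻ {c} (Perm↭.∈-resp-↭ (SB.B↭S r) h)

    blocks-encode : blocks μ (encode c z) ≡ map (block c z) (upTo m)
    blocks-encode = trans (cong (λ κ → blocks κ (encode c z)) (sym (trans (sym (map-∘ (upTo m)))
      (trans (map-cong (λ r → length-map z (class c r)) (upTo m)) sizes)))) (blocks-concat (map (block c z) (upTo m)))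

    encode-unique : Unique (encode c z)
    encode-unique = UniqueProperties.concat⁺
      (All.map⁺ (AllBase.tabulate λ {r} _ → UniqueProperties.map⁺ (λ {x} {y} e → trans (sym (involutive x)) (trans (cong z e) (involutive y))) (sorted-unique-list (class-sorted c r))))
      (AllPairsProperties.map⁺ (AllPairsBase.map (λ l → λ { (p , q) → <⇒≢ l (trans (sym (proj₂ (∈-block⁻ p))) (proj₂ (∈-block⁻ q))) }) (upTo-sorted m)))

    encode-perm : IsPerm n (encode c z)
    encode-perm = set⇒↭ encode-unique (UniqueProperties.upTo⁺ n)
      (λ h → into (Membership.∈-concat⁻′ (map (block c z) (upTo m)) h))
      (λ h → Membership.∈-concat⁺′ (∈-block⁺ (Membership.∈-upTo⁻ h)) (Membership.∈-map⁺ (block c z) (Membership.∈-upTo⁺ (few-colours (Membership.∈-upTo⁻ h)))))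
      where
      into : ∀ {v} → (∃ λ B → v ∈ B × B ∈ map (block c z) (upTo m)) → v ∈ upTo n
      into (B , p , q) with Membership.∈-map⁻ (block c z) q
      ... | r , _ , refl = Membership.∈-upTo⁺ (proj₁ (∈-block⁻ p))

    encode-InvolMu : InvolMu n μ (encode c z)
    encode-InvolMu = encode-perm , subst (All (λ B → IsInvolution (std B))) (sym blocks-encode)
      (All.map⁺ (AllBase.tabulate λ {r} _ → SB.std-involution r))

    module _ (i : ℕ) (hj : suc i < n) where

      private
        j : ℕ
        j = suc i
        hi : i < n
        hi = <-trans ≤-refl hj
        σ : ℕ → ℕ
        σ = swapℕ i j
        module Sp = Splitting (splitting (identity n) ≤-refl hi hj)
        X Y : List ℕ
        X = Sp.X
        Y = Sp.Y
        upTo-split : upTo n ≡ X ++ i ∷ j ∷ Y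
        upTo-split = trans (sym (map-id (upTo n))) (trans Sp.before-swap (cong (λ M → X ++ i ∷ M ++ j ∷ Y) (Sp.adjacent refl)))
        ends : All (_< i) X × All (j <_) Y
        ends = sorted-split X (subst (AllPairs _<_) upTo-split (upTo-sorted n))

        both-true : c i ≡ c j → bothIn i (block c z (c i)) ≡ true
        both-true e rewrite elem-true (∈-block⁺ hi) | elem-true (subst (λ r → j ∈ block c z r) (sym e) (∈-block⁺ hj)) = refl

        i∉ : ∀ {r} → r ≢ c i → bothIn i (block c z r) ≡ false
        i∉ {r} ne rewrite elem-false {i} (block c z r) (λ h → ne (sym (proj₂ (∈-block⁻ h)))) = refl

        both-false : c i ≢ c j → ∀ r → bothIn i (block c z r) ≡ false
        both-false ne r with r ≟ c i
        ... | no ne' = i∉ ne'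
        ... | yes refl rewrite elem-false {j} (block c z (c i)) (λ h → ne (sym (proj₂ (∈-block⁻ h)))) = Data.Bool.Properties.∧-zeroʳ (elem i (block c z (c i)))

        F : List ℕ → List ℕ
        F B = if bothIn i B then blockStep i B else B

        act-within : c i ≡ c j → ∀ {c' z'} → (∀ {v} → v < n → c v ≡ c' v) → blockStep i (block c z (c i)) ≡ map z' (class c (c i)) →
          (∀ {v} → c v ≢ c i → z v ≡ z' v) → actMu μ (encode c z) i ≡ encode c' z'
        act-within e {c'} {z'} h st off rewrite blocks-encode
          | any-true (bothIn i) (Membership.∈-map⁺ (block c z) (Membership.∈-upTo⁺ (few-colours hi))) (both-true e) =
          cong concat (trans (sym (map-∘ (upTo m))) (map-cong (λ r → at-colour r) (upTo m)))
          where
          at-colour : ∀ r → F (block c z r) ≡ block c' z' r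
          at-colour r with r ≟ c i
          ... | yes refl rewrite both-true e = trans st (cong (map z') (class-cong h (c i)))
          ... | no ne rewrite i∉ ne = trans (map-cong-∈ (class c r) λ k → off λ e' → ne (trans (sym (proj₂ (∈-class⁻ {c} k))) e'))
                (cong (map z') (class-cong h r))

        all-false : c i ≢ c j → ∀ {B} → (∃ λ r → r ∈ upTo m × B ≡ block c z r) → bothIn i B ≡ false
        all-false ne (r , _ , refl) = both-false ne r

        act-across : c i ≢ c j → actMu μ (encode c z) i ≡ heckeL i (encode c z)
        act-across ne rewrite blocks-encode | any-false (bothIn i) (map (block c z) (upTo m))
          (λ h → all-false ne (Membership.∈-map⁻ (block c z) h)) = refl

        before-colours : ∀ {a b} → a < n → b < n → c a < c b → Before a b (encode c z)
        before-colours ha hb l = before-concat (block c z) (before-sorted (upTo-sorted m) (Membership.∈-upTo⁺ (few-colours ha)) (Membership.∈-upTo⁺ (few-colours hb)) l)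
          (∈-block⁺ ha) (∈-block⁺ hb)

        class-away : ∀ r xs → (∀ {v} → v ∈ xs → v ≢ i × v ≢ j) → filter (λ v → c (σ v) ≟ r) xs ≡ map σ (filter (λ v → c v ≟ r) xs)
        class-away r [] h = refl
        class-away r (x ∷ xs) h = by-colour (c x ≟ r)
          where
          σx : σ x ≡ x
          σx = swap-other (proj₁ (h (here refl))) (proj₂ (h (here refl)))
          by-colour : Dec (c x ≡ r) → filter (λ v → c (σ v) ≟ r) (x ∷ xs) ≡ map σ (filter (λ v → c v ≟ r) (x ∷ xs))
          by-colour (yes e) = trans (filter-accept (λ v → c (σ v) ≟ r) (trans (cong c σx) e))
            (trans (cong₂ _∷_ (sym σx) (class-away r xs λ k → h (there k))) (cong (map σ) (sym (filter-accept (λ v → c v ≟ r) e))))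
          by-colour (no e) = trans (filter-reject (λ v → c (σ v) ≟ r) (λ e' → e (trans (cong c (sym σx)) e')))
            (trans (class-away r xs λ k → h (there k)) (cong (map σ) (sym (filter-reject (λ v → c v ≟ r) e))))

        -- A class containing at most one of `i` and `j` remains increasing when they are exchanged,
        -- so it is still the filtered list.
        class-σ : c i ≢ c j → ∀ r → class (λ v → c (σ v)) r ≡ map σ (class c r)
        class-σ ne r = begin
          filter p' (upTo n)                              ≡⟨ cong (filter p') upTo-split ⟩
          filter p' (X ++ i ∷ j ∷ Y)                      ≡⟨ filter-++ p' X (i ∷ j ∷ Y) ⟩
          filter p' X ++ filter p' (i ∷ j ∷ Y)            ≡⟨ cong₂ _++_ (class-away r X λ k → <⇒≢ (AllBase.lookup (proj₁ ends) k) , <⇒≢ (<-trans (AllBase.lookup (proj₁ ends) k) ≤-refl)) middle ⟩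
          map σ (filter p X) ++ map σ (filter p (i ∷ j ∷ Y)) ≡⟨ map-++ σ (filter p X) _ ⟨
          map σ (filter p X ++ filter p (i ∷ j ∷ Y))      ≡⟨ cong (map σ) (sym (filter-++ p X (i ∷ j ∷ Y))) ⟩
          map σ (filter p (X ++ i ∷ j ∷ Y))               ≡⟨ cong (λ w → map σ (filter p w)) (sym upTo-split) ⟩
          map σ (filter p (upTo n)) ∎
          where
          open ≡-Reasoning
          p' = λ v → c (σ v) ≟ r
          p = λ v → c v ≟ r
          rest : filter p' Y ≡ map σ (filter p Y)
          rest = class-away r Y λ k → (λ e → <⇒≢ (<-trans ≤-refl (AllBase.lookup (proj₂ ends) k)) (sym e)) , λ e → <⇒≢ (AllBase.lookup (proj₂ ends) k) (sym e)
          middle : filter p' (i ∷ j ∷ Y) ≡ map σ (filter p (i ∷ j ∷ Y))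
          middle = by-colours (c i ≟ r) (c j ≟ r)
            where
            σi : ∀ {P : ℕ → Set} → P (c (σ i)) → P (c j)
            σi {P} = subst (λ v → P (c v)) (swap-left i j)
            σj : ∀ {P : ℕ → Set} → P (c (σ j)) → P (c i)
            σj {P} = subst (λ v → P (c v)) (swap-right i j)
            by-colours : Dec (c i ≡ r) → Dec (c j ≡ r) → filter p' (i ∷ j ∷ Y) ≡ map σ (filter p (i ∷ j ∷ Y))
            by-colours (yes a) (yes b) = ⊥-elim (ne (trans a (sym b)))
            by-colours (yes a) (no b) = trans (filter-reject p' (λ e → b (σi {_≡ r} e))) (trans (filter-accept p' (trans (cong c (swap-right i j)) a))
              (trans (cong₂ _∷_ (sym (swap-left i j)) rest) (cong (map σ) (sym (trans (filter-accept p a) (cong (i ∷_) (filter-reject p b)))))))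
            by-colours (no a) (yes b) = trans (filter-accept p' (trans (cong c (swap-left i j)) b)) (trans (cong (i ∷_) (filter-reject p' (λ e → a (σj {_≡ r} e))))
              (trans (cong₂ _∷_ (sym (swap-right i j)) rest) (cong (map σ) (sym (trans (filter-reject p a) (filter-accept p b))))))
            by-colours (no a) (no b) = trans (filter-reject p' (λ e → b (σi {_≡ r} e))) (trans (filter-reject p' (λ e → a (σj {_≡ r} e)))
              (trans rest (cong (map σ) (sym (trans (filter-reject p a) (filter-reject p b))))))

        module St (e : c i ≡ c j) = SB.Step (c i) {i} {filter (λ v → c v ≟ c i) X} {filter (λ v → c v ≟ c i) Y}
          (trans (cong (filter (λ v → c v ≟ c i)) upTo-split) (trans (filter-++ (λ v → c v ≟ c i) X (i ∷ j ∷ Y))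
            (cong (filter (λ v → c v ≟ c i) X ++_) (trans (filter-accept (λ v → c v ≟ c i) refl) (cong (i ∷_) (filter-accept (λ v → c v ≟ c i) (sym e)))))))
          (All.filter⁺ (λ v → c v ≟ c i) (proj₁ ends)) (All.filter⁺ (λ v → c v ≟ c i) (proj₂ ends))

        colour-σ : c i ≡ c j → ∀ {v} → v < n → c v ≡ c (σ v)
        colour-σ e {v} _ with swapView i j v
        ... | is-left refl q = trans e (cong c (sym q))
        ... | is-right refl q = trans (sym e) (cong c (sym q))
        ... | is-other _ _ q = cong c (sym q)

        off-i : ∀ {v} → c v ≢ c i → c i ≡ c j → σ v ≡ v
        off-i ne e = swap-other (λ q → ne (cong c q)) (λ q → ne (trans (cong c q) (sym e)))

      -- Inside a block the recoloured map `c ∘ σ` agrees with `c`, which lets the steps inside a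
      -- block and across blocks share one conclusion.
      act-rise : ∀ {z'} → Rise c z i z' → actMu μ (encode c z) i ≡ encode (λ v → c (σ v)) z'
      act-rise (across l) = trans (act-across (<⇒≢ l)) (trans (Values.heckeL-rise i (encode c z) encode-unique (before-colours hi hj l))
        (trans (sym (concat-map (map (block c z) (upTo m)))) (cong concat (trans (sym (map-∘ (upTo m))) (map-cong (λ r → at-colour r) (upTo m))))))
        where
        at-colour : ∀ r → map σ (block c z r) ≡ block (λ v → c (σ v)) (λ v → σ (z (σ v))) r
        at-colour r = trans (trans (sym (map-∘ (class c r))) (map-cong-∈ (class c r) λ {v} _ → cong (λ w → σ (z w)) (sym (swap-involutive i j v))))
          (trans (map-∘ (class c r)) (cong (map (λ v → σ (z (σ v)))) (sym (class-σ (<⇒≢ l) r))))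
      act-rise (conjugate e l nb) = act-within e (colour-σ e) (St.step-conjugate e l (Values.σ-< i nb l))
        λ {v} ne → sym (trans (cong (λ w → σ (z w)) (off-i ne e)) (off-i (λ q → ne (trans (sym (preserves v)) q)) e))
      act-rise (couple e p q) = act-within e (colour-σ e) (trans (St.step-couple e p q) (map-cong-∈ (class c (c i)) λ {v} _ → commute v))
        λ {v} ne → cong z (sym (off-i ne e))
        where
        commute : ∀ v → σ (z v) ≡ z (σ v)
        commute v with swapView i j v
        ... | is-left refl s = trans (cong σ p) (trans (swap-left i j) (trans (sym q) (cong z (sym s))))
        ... | is-right refl s = trans (cong σ q) (trans (swap-right i j) (trans (sym p) (cong z (sym s))))
        ... | is-other a b s = trans (swap-other (λ t → a (trans (sym (involutive v)) (trans (cong z t) p))) (λ t → b (trans (sym (involutive v)) (trans (cong z t) q)))) (cong z (sym s))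

      act-fall : Fall c z i → actMu μ (encode c z) i ≡ encode c z
      act-fall (across l) = trans (act-across (λ e → <⇒≢ l (sym e))) (Values.heckeL-fall i (encode c z) encode-unique (before-colours hj hi l))
      act-fall (within e l) = act-within e (λ _ → refl) (St.step-fall e l) λ _ → refl

  -- The block sizes are those of `μ`, so cutting the word recovers every block, and with it the
  -- colour and the partner of each value.
  encode-injective : ∀ {c z c' z'} → State c z → State c' z' → encode c z ≡ encode c' z' →
    (∀ {v} → v < n → c v ≡ c' v) × (∀ {v} → v < n → z v ≡ z' v)
  encode-injective {c} {z} {c'} {z'} S S' e = same-c , same-z
    where
    maps : map (block c z) (upTo m) ≡ map (block c' z') (upTo m)
    maps = trans (sym (blocks-encode S)) (trans (cong (blocks μ) e) (blocks-encode S'))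
    pointwise-eq : ∀ {A : Set} {f g : ℕ → A} xs → map f xs ≡ map g xs → ∀ {r} → r ∈ xs → f r ≡ g r
    pointwise-eq (x ∷ xs) h (here refl) = Data.List.Properties.∷-injectiveˡ h
    pointwise-eq (x ∷ xs) h (there k) = pointwise-eq xs (Data.List.Properties.∷-injectiveʳ h) k
    at-colour : ∀ {v} → v < n → block c z (c v) ≡ block c' z' (c v)
    at-colour h = pointwise-eq (upTo m) maps (Membership.∈-upTo⁺ (State.few-colours S h))
    same-c : ∀ {v} → v < n → c v ≡ c' v
    same-c {v} h = sym (proj₂ (∈-block⁻ S' (subst (v ∈_) (at-colour h) (∈-block⁺ S h))))
    same-z : ∀ {v} → v < n → z v ≡ z' v
    same-z {v} h = pointwise-eq (class c (c v)) (trans (at-colour h) (cong (map z') (sym (class-cong same-c (c v))))) (∈-class⁺ h refl)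

-- Atoms with a prescribed descent

module DescentAtom {n : ℕ} {blk : ℕ → ℕ} (blk-mono : ∀ {x y} → x ≤ y → blk x ≤ blk y) where

  open Connected {n} {blk} blk-mono

  record HasDescent (P : Perm n) (z : ℕ → ℕ) (i : ℕ) : Set where
    field
      perm : Perm n
      atom : Atom blk perm z
      blocks-same : ∀ v → blk (to perm v) ≡ blk (to P v)
      descent : Descent perm i

  module _ {z : ℕ → ℕ} {R : Perm n} (A : Atom blk R z) (sorted : Sorted {z} R) where

    private
      f : ℕ → ℕ
      f = to R

    key-order : ∀ {x y} → y < n → blk (f x) ≡ blk (f y) → f x < f y → key z x < key z y
    key-order {x} {y} h e l with order-precedes {z} {R} A sorted x y h l
    ... | inj₁ k = ⊥-elim (<⇒≢ k e)
    ... | inj₂ (_ , k) = k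

    consecutive : ∀ {x y} → y < n → blk (f x) ≡ blk (f y) → f x < f y →
      (∀ u → key z x < key z u → ¬ (key z u < key z y)) → f y ≡ suc (f x)
    consecutive {x} {y} h e l none with m≤n⇒m<n∨m≡n l
    ... | inj₂ q = sym q
    ... | inj₁ q = ⊥-elim (none u (key-order u<n bu (subst (f x <_) (sym fu) ≤-refl)) (key-order h (trans (sym bu) e) (subst (_< f y) (sym fu) q)))
      where
      u : ℕ
      u = from R (suc (f x))
      fu : f u ≡ suc (f x)
      fu = to-from R (suc (f x))
      u<n : u < n
      u<n = bounded (inverse R) (<-trans q (bounded R h))
      bu : blk (f x) ≡ blk (f u)
      bu = ≤-antisym (blk-mono (≤-trans (n≤1+n _) (≤-reflexive (sym fu)))) (≤-trans (blk-mono (≤-trans (≤-reflexive fu) l)) (≤-reflexive (sym e)))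

    module _ (i : ℕ) (hj : suc i < n) (same : blk (f i) ≡ blk (f (suc i))) (fall : z (suc i) < z i) (ascent : f i < f (suc i)) where

      private
        j : ℕ
        j = suc i
        hi : i < n
        hi = <-trans ≤-refl hj
        keys : key z i < key z j
        keys = key-order hj same ascent

        key-j-large : z j < j → ⊥
        key-j-large l with <-cmp (z i) i
        ... | tri< p _ _ = <-asym keys (subst₂ _<_ (sym (key-large z l)) (sym (key-large z p)) (+-mono-< fall fall))
        ... | tri≈ _ p _ = <-asym keys (subst₂ _<_ (sym (key-large z l)) (sym (key-small z (≤-reflexive (sym p)))) (<-trans (+-mono-< zj<i zj<i) ≤-refl))
          where
          zj<i : z j < i
          zj<i = subst (z j <_) p fall
        ... | tri> _ _ p = <-asym keys (subst₂ _<_ (sym (key-large z l)) (sym (key-small z (<⇒≤ p))) (<-trans (+-mono-< zj<i zj<i) ≤-refl))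
          where
          zj<i : z j < i
          zj<i = ≤∧≢⇒< (≤-pred l) λ e → <-asym ascent (subst (λ w → f w < f i) (trans (cong z (sym e)) (invol A j)) (desc A i p))

        j≤zj : j ≤ z j
        j≤zj = ≮⇒≥ key-j-large
        i<zi : i < z i
        i<zi = <-trans ≤-refl (≤-<-trans j≤zj fall)
        j<zi : j < z i
        j<zi = ≤-<-trans j≤zj fall

        key-i : key z i ≡ suc (i + i)
        key-i = key-small z (<⇒≤ i<zi)
        key-zi : key z (z i) ≡ i + i
        key-zi = trans (key-large z (subst (_< z i) (sym (invol A i)) i<zi)) (cong₂ _+_ (invol A i) (invol A i))
        key-j : key z j ≡ suc (j + j)
        key-j = key-small z j≤zj

        double-j : j + j ≡ suc (suc (i + i))
        double-j = cong suc (+-suc i i)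

        f-i : f i ≡ suc (f (z i))
        f-i = consecutive hi (colour A i) (desc A i i<zi) λ u p q → <⇒≱ (subst (_< key z u) key-zi p) (≤-pred (subst (key z u <_) key-i q))

        k : ℕ
        k = f (z i)

      -- The cycle of `j` is nested in that of `i`. No key that occurs lies between theirs, so in
      -- the sorted atom their letters are consecutive. Moving the descending pair `z i`, `i` past
      -- the letters of the inner cycle puts `j` in front of `i`.
      rotated : HasDescent R z i
      rotated with m≤n⇒m<n∨m≡n j≤zj
      -- One rotation turns `z i, i, j` into `j, z i, i`.
      ... | inj₂ j≡zj = record
        { perm = M.rotate⁻ R ; atom = M.rotate⁻-atom A ≤-refl j<zi refl f-i f-j ; blocks-same = λ v → trans (M.block-σ _) (M.block-τ _)
        ; descent = subst₂ _<_ (sym (trans (cong (λ p → M.σ (M.τ p)) f-j) (trans (cong M.σ M.τ-2) M.σ-1)))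
            (sym (trans (cong (λ p → M.σ (M.τ p)) f-i) (trans (cong M.σ M.τ-1) M.σ-2))) (<-trans ≤-refl ≤-refl) }
        where
        f-j : f j ≡ suc (suc k)
        f-j = trans (consecutive hj same ascent none) (cong suc f-i)
          where
          -- The only number in between is `j + j`; as a key it would belong to the larger end of
          -- the cycle of `j`, but `j` is fixed.
          none : ∀ u → key z i < key z u → ¬ (key z u < key z j)
          none u p q = case (z u <? u)
            where
            value : key z u ≡ j + j
            value = ≤-antisym (≤-pred (subst (key z u <_) key-j q)) (subst (_≤ key z u) (sym double-j) (subst (_< key z u) key-i p))
            case : Dec (z u < u) → ⊥
            case (yes l) = <-irrefl (trans zu (trans j≡zj (trans (cong z (sym zu)) (invol A u)))) l
              where
              zu : z u ≡ j
              zu = ≤-antisym (double-≤ (≤-trans (≤-reflexive (trans (sym (key-large z l)) value)) (n≤1+n _)))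
                (double-≤ (≤-trans (≤-reflexive (trans (sym value) (key-large z l))) (n≤1+n _)))
            case (no l) = double-≢ j u (trans (sym value) (key-small z (≮⇒≥ l)))
        h₂ : suc (suc k) < n
        h₂ = subst (_< n) f-j (bounded R hj)
        level : blk k ≡ blk (suc (suc k))
        level = trans (colour A i) (trans same (cong blk f-j))
        module M = Move {n} {blk} blk-mono k (<-trans ≤-refl (<-trans ≤-refl h₂)) (<-trans ≤-refl h₂) h₂ level
      -- Two rotations turn `z i, i, z j, j` into `z j, z i, i, j` and then into `z j, j, z i, i`.
      ... | inj₁ j<zj = record
        { perm = M'.rotate⁻ (M.rotate⁻ R) ; atom = M'.rotate⁻-atom A₁ ≤-refl j<zi f₁-zi f₁-i f₁-j
        ; blocks-same = λ v → trans (trans (M'.block-σ _) (M'.block-τ _)) (trans (M.block-σ _) (M.block-τ _))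
        ; descent = subst₂ _<_ (sym (trans (cong (λ p → M'.σ (M'.τ p)) f₁-j) (trans (cong M'.σ M'.τ-2) M'.σ-1)))
            (sym (trans (cong (λ p → M'.σ (M'.τ p)) f₁-i) (trans (cong M'.σ M'.τ-1) M'.σ-2))) (<-trans ≤-refl ≤-refl) }
        where
        zj<n : z j < n
        zj<n = z-bounded A hj
        key-zj : key z (z j) ≡ suc (suc (i + i))
        key-zj = trans (key-large z (subst (_< z j) (sym (invol A j)) j<zj)) (trans (cong₂ _+_ (invol A j) (invol A j)) double-j)
        same-zj : blk (f i) ≡ blk (f (z j))
        same-zj = trans same (sym (colour A j))
        fi<fzj : f i < f (z j)
        fi<fzj with <-cmp (f i) (f (z j))
        ... | tri< l _ _ = l
        ... | tri≈ _ e _ = ⊥-elim (<-irrefl (injective R e) (<-trans ≤-refl j<zj))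
        ... | tri> _ _ l = ⊥-elim (<⇒≱ (key-order hi (sym same-zj) l) (≤-trans (≤-reflexive key-i) (≤-trans (n≤1+n _) (≤-reflexive (sym key-zj)))))
        f-zj : f (z j) ≡ suc (suc k)
        f-zj = trans (consecutive zj<n same-zj fi<fzj λ u p q → <⇒≱ (subst (_< key z u) key-i p) (≤-pred (subst (key z u <_) key-zj q))) (cong suc f-i)
        f-j : f j ≡ suc (suc (suc k))
        f-j = trans (consecutive hj (colour A j) (desc A j j<zj) λ u p q → <⇒≱ (subst (_< key z u) key-zj p)
          (≤-pred (subst (key z u <_) (trans key-j (cong suc double-j)) q))) (cong suc f-zj)
        h₃ : suc (suc (suc k)) < n
        h₃ = subst (_< n) f-j (bounded R hj)
        h₂ : suc (suc k) < n
        h₂ = <-trans ≤-refl h₃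
        h₁ : suc k < n
        h₁ = <-trans ≤-refl h₂
        module M = Move {n} {blk} blk-mono k (<-trans ≤-refl h₁) h₁ h₂ (trans (colour A i) (trans same-zj (cong blk f-zj)))
        module M' = Move {n} {blk} blk-mono (suc k) h₁ h₂ h₃ (trans (cong blk (sym f-i)) (trans same (cong blk f-j)))
        A₁ : Atom blk (M.rotate⁻ R) z
        A₁ = M.rotate⁻-atom A (<-trans ≤-refl j<zj) fall refl f-i f-zj
        f₁-zi : to (M.rotate⁻ R) (z i) ≡ suc k
        f₁-zi = trans (cong M.σ M.τ-k) M.σ-k
        f₁-i : to (M.rotate⁻ R) i ≡ suc (suc k)
        f₁-i = trans (cong (λ p → M.σ (M.τ p)) f-i) (trans (cong M.σ M.τ-1) M.σ-2)
        f₁-j : to (M.rotate⁻ R) j ≡ suc (suc (suc k))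
        f₁-j = trans (cong (λ p → M.σ (M.τ p)) f-j) (trans (cong M.σ (swap-other (λ e → <⇒≢ (s≤s (s≤s (n≤1+n k))) (sym e)) (λ e → 1+n≢n e)))
          (swap-other (λ e → <⇒≢ (s≤s (≤-trans (n≤1+n k) (n≤1+n (suc k)))) (sym e)) (λ e → <⇒≢ (s≤s (s≤s (n≤1+n k))) (sym e))))

  -- Across blocks the colours impose the descent on every atom. Inside a block a given atom may
  -- ascend although the action is stationary, but its sorted form either descends or can be rotated
  -- until it does.
  descent-atom : ∀ {z P} → Atom blk P z → ∀ i → suc i < n → Fall (λ v → blk (to P v)) z i → HasDescent P z i
  descent-atom {z} {P} A i hj (across l) with ascent⊎descent P i
  ... | inj₂ d = record { perm = P ; atom = A ; blocks-same = λ _ → refl ; descent = d }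
  ... | inj₁ a = ⊥-elim (<⇒≱ l (blk-mono (<⇒≤ a)))
  descent-atom {z} {P} A i hj (within e l) = go (normalise {z} P A)
    where
    go : Normal {z} P → HasDescent P z i
    go N with ascent⊎descent (Normal.form N) i
    ... | inj₂ d = record { perm = Normal.form N ; atom = Normal.atom N ; blocks-same = Normal.blocks-same N ; descent = d }
    ... | inj₁ a = record
      { perm = HasDescent.perm H ; atom = HasDescent.atom H
      ; blocks-same = λ v → trans (HasDescent.blocks-same H v) (Normal.blocks-same N v) ; descent = HasDescent.descent H }
      where
      H : HasDescent (Normal.form N) z i
      H = rotated (Normal.atom N) (Normal.sorted N) i hj
        (trans (Normal.blocks-same N i) (trans e (sym (Normal.blocks-same N (suc i))))) l a

-- Reduced μ-words

blockIndex : List ℕ → ℕ → ℕ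
blockIndex [] p = 0
blockIndex (k ∷ μ) p with p <? k
... | yes _ = 0
... | no _ = suc (blockIndex μ (p ∸ k))

blockIndex-mono : ∀ μ {p q} → p ≤ q → blockIndex μ p ≤ blockIndex μ q
blockIndex-mono [] h = z≤n
blockIndex-mono (k ∷ μ) {p} {q} h with p <? k | q <? k
... | yes _ | _ = z≤n
... | no l | yes l' = ⊥-elim (l (≤-<-trans h l'))
... | no _ | no _ = s≤s (blockIndex-mono μ (∸-monoˡ-≤ k h))

blockIndex-bound : ∀ μ {p} → p < sum μ → blockIndex μ p < length μ
blockIndex-bound (k ∷ μ) {p} h with p <? k
... | yes _ = s≤s z≤n
... | no l = s≤s (blockIndex-bound μ (+-cancelˡ-< k (p ∸ k) (sum μ) (subst (_< k + sum μ) (sym (m+[n∸m]≡n (≮⇒≥ l))) h)))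

blockIndex-first : ∀ k μ {p} → p < k → blockIndex (k ∷ μ) p ≡ 0
blockIndex-first k μ {p} h with p <? k
... | yes _ = refl
... | no l = ⊥-elim (l h)

blockIndex-later : ∀ k μ p → blockIndex (k ∷ μ) (k + p) ≡ suc (blockIndex μ p)
blockIndex-later k μ p with k + p <? k
... | yes l = ⊥-elim (<⇒≱ l (m≤m+n k p))
... | no _ = cong (λ x → suc (blockIndex μ x)) (m+n∸m≡n k p)

blocks-map : ∀ (f : ℕ → ℕ) μ xs → blocks μ (map f xs) ≡ map (map f) (blocks μ xs)
blocks-map f [] xs = refl
blocks-map f (k ∷ μ) xs = cong₂ _∷_ (Data.List.Properties.take-map k xs) (trans (cong (blocks μ) (Data.List.Properties.drop-map k xs)) (blocks-map f μ (drop k xs)))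

concat-blocks : ∀ μ xs → length xs ≡ sum μ → concat (blocks μ xs) ≡ xs
concat-blocks [] [] h = refl
concat-blocks (k ∷ μ) xs h = trans (cong (take k xs ++_) (concat-blocks μ (drop k xs)
  (trans (Data.List.Properties.length-drop k xs) (trans (cong (_∸ k) h) (m+n∸m≡n k (sum μ)))))) (Data.List.Properties.take++drop≡id k xs)

length-blocks : ∀ μ xs → length xs ≡ sum μ → map length (blocks μ xs) ≡ μ
length-blocks [] xs h = refl
length-blocks (k ∷ μ) xs h = cong₂ _∷_ (trans (Data.List.Properties.length-take k xs) (m≤n⇒m⊓n≡m (subst (k ≤_) (sym h) (m≤m+n k (sum μ)))))
  (length-blocks μ (drop k xs) (trans (Data.List.Properties.length-drop k xs) (trans (cong (_∸ k) h) (m+n∸m≡n k (sum μ)))))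

upTo-++ : ∀ a b → upTo (a + b) ≡ upTo a ++ map (a +_) (upTo b)
upTo-++ a b = trans (applyUpTo-++ (λ k → k) a b) (cong (upTo a ++_) (sym (map-upTo (a +_) b)))

blocks-upTo : ∀ μ → blocks μ (upTo (sum μ)) ≡ map (λ r → filter (λ v → blockIndex μ v ≟ r) (upTo (sum μ))) (upTo (length μ))
blocks-upTo [] = refl
blocks-upTo (k ∷ μ) = trans (cong (blocks (k ∷ μ)) (upTo-++ k N)) (cong₂ _∷_ first-block later-blocks)
  where
  N : ℕ
  N = sum μ
  c : ℕ → ℕ
  c = blockIndex (k ∷ μ)
  L : List ℕ
  L = map (k +_) (upTo N)
  take-upTo : take k (upTo k ++ L) ≡ upTo k
  take-upTo = trans (cong (λ a → take a (upTo k ++ L)) (sym (length-upTo k))) (take-++ (upTo k))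
  drop-upTo : drop k (upTo k ++ L) ≡ L
  drop-upTo = trans (cong (λ a → drop a (upTo k ++ L)) (sym (length-upTo k))) (drop-++ (upTo k))
  split : ∀ r → filter (λ v → c v ≟ r) (upTo (k + N)) ≡ filter (λ v → c v ≟ r) (upTo k) ++ filter (λ v → c v ≟ r) L
  split r = trans (cong (filter (λ v → c v ≟ r)) (upTo-++ k N)) (filter-++ (λ v → c v ≟ r) (upTo k) L)
  zeros : All (λ v → c v ≡ 0) (upTo k)
  zeros = AllBase.tabulate λ h → blockIndex-first k μ (Membership.∈-upTo⁻ h)
  nonzeros : All (λ v → c v ≢ 0) L
  nonzeros = All.map⁺ (AllBase.tabulate λ {v} _ e → 1+n≢0 (trans (sym (blockIndex-later k μ v)) e))
  first-block : take k (upTo k ++ L) ≡ filter (λ v → c v ≟ 0) (upTo (k + N))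
  first-block = trans take-upTo (sym (trans (split 0) (trans (cong₂ _++_ (filter-all (λ v → c v ≟ 0) zeros) (filter-none (λ v → c v ≟ 0) nonzeros)) (Data.List.Properties.++-identityʳ (upTo k)))))
  shift : ∀ r xs → map (k +_) (filter (λ v → blockIndex μ v ≟ r) xs) ≡ filter (λ v → c v ≟ suc r) (map (k +_) xs)
  shift r [] = refl
  shift r (x ∷ xs) = by-colour (blockIndex μ x ≟ r)
    where
    by-colour : Dec (blockIndex μ x ≡ r) → map (k +_) (filter (λ v → blockIndex μ v ≟ r) (x ∷ xs)) ≡ filter (λ v → c v ≟ suc r) (k + x ∷ map (k +_) xs)
    by-colour (yes e) = trans (cong (map (k +_)) (filter-accept (λ v → blockIndex μ v ≟ r) e)) (trans (cong (k + x ∷_) (shift r xs))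
      (sym (filter-accept (λ v → c v ≟ suc r) (trans (blockIndex-later k μ x) (cong suc e)))))
    by-colour (no e) = trans (cong (map (k +_)) (filter-reject (λ v → blockIndex μ v ≟ r) e)) (trans (shift r xs)
      (sym (filter-reject (λ v → c v ≟ suc r) λ q → e (suc-injective (trans (sym (blockIndex-later k μ x)) q)))))
  later : ∀ r → map (k +_) (filter (λ v → blockIndex μ v ≟ r) (upTo N)) ≡ filter (λ v → c v ≟ suc r) (upTo (k + N))
  later r = trans (shift r (upTo N)) (sym (trans (split (suc r)) (cong (_++ filter (λ v → c v ≟ suc r) L)
    (filter-none (λ v → c v ≟ suc r) (AllBase.map (λ e q → 1+n≢0 (trans (sym q) e)) zeros)))))
  later-blocks : blocks μ (drop k (upTo k ++ L)) ≡ map (λ r → filter (λ v → c v ≟ r) (upTo (k + N))) (applyUpTo suc (length μ))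
  later-blocks = trans (cong (blocks μ) drop-upTo) (trans (blocks-map (k +_) μ (upTo N)) (trans (cong (map (map (k +_))) (blocks-upTo μ))
    (trans (sym (map-∘ (upTo (length μ)))) (trans (map-cong later (upTo (length μ))) (trans (map-∘ (upTo (length μ)))
      (cong (map (λ r → filter (λ v → c v ≟ r) (upTo (k + N)))) (map-upTo suc (length μ))))))))

word-perm : ∀ {n} (P : Perm n) → IsPerm n (word P)
word-perm {n} P = set⇒↭ (unique-word P) (UniqueProperties.upTo⁺ n) (λ h → into (Membership.∈-map⁻ (to P) h))
  (λ {v} h → subst (_∈ word P) (to-from P v) (Membership.∈-map⁺ (to P) (Membership.∈-upTo⁺ (bounded (inverse P) (Membership.∈-upTo⁻ h)))))
  where
  into : ∀ {v} → (∃ λ x → x ∈ upTo n × v ≡ to P x) → v ∈ upTo n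
  into (x , h , refl) = Membership.∈-upTo⁺ (bounded P (Membership.∈-upTo⁻ h))

module Words {n : ℕ} where

  extend : Perm n → ∀ a → ValidWord n a → Perm n
  extend P [] _ = P
  extend P (i ∷ a) (h ∷ hs) = extend (stepʳ P i (<-trans ≤-refl h) h) a hs

  Ascends : Perm n → ∀ a → ValidWord n a → Set
  Ascends P [] _ = ⊤
  Ascends P (i ∷ a) (h ∷ hs) = Ascent P i × Ascends (stepʳ P i (<-trans ≤-refl h) h) a hs

  extend-word : ∀ P a v → foldl (λ w k → swapPos k (suc k) w) (word P) a ≡ word (extend P a v)
  extend-word P [] _ = refl
  extend-word P (i ∷ a) (h ∷ hs) = trans (cong (λ w → foldl (λ w k → swapPos k (suc k) w) w a) (swapPos-word P i (suc i) (<-trans ≤-refl h) h))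
    (extend-word (stepʳ P i (<-trans ≤-refl h) h) a hs)

  prodWord-word : ∀ a v → prodWord n a ≡ word (extend (identity n) a v)
  prodWord-word a v = trans (cong (λ w → foldl (λ w k → swapPos k (suc k) w) w a) (sym (map-id (upTo n)))) (extend-word (identity n) a v)

  valid-∷ʳ : ∀ {a i} → ValidWord n a → suc i < n → ValidWord n (a ++ i ∷ [])
  valid-∷ʳ v h = All.++⁺ v (h ∷ [])

  extend-∷ʳ : ∀ P a i v v' h → ∀ k → to (extend P (a ++ i ∷ []) v') k ≡ to (stepʳ (extend P a v) i (<-trans ≤-refl h) h) k
  extend-∷ʳ P [] i [] (_ ∷ []) h k = refl
  extend-∷ʳ P (x ∷ a) i (_ ∷ v) (_ ∷ v') h k = extend-∷ʳ _ a i v v' h k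

  -- The elementary half of the subword property. Each letter of `a` ascends, so a skipped letter
  -- enlarges the upper side, and a common letter raises both sides.
  extend-⊑ : ∀ {P Q a b} v v' → b ⊆ a → Ascends Q a v → P ⊑ Q → extend P b v' ⊑ extend Q a v
  extend-⊑ [] [] [] _ h = h
  extend-⊑ {P} {Q} (hi ∷ v) v' (y ∷ʳ s) (asc , ascs) h = extend-⊑ v v' s ascs (⊑-trans h (⊑-raise Q y (<-trans ≤-refl hi) hi asc))
  extend-⊑ {P} {Q} (hi ∷ v) (hi' ∷ v') (refl ∷ s) (asc , ascs) h = extend-⊑ v v' s ascs
    (⊑-trans (⊑-≗ λ k → refl) (raise-both {V = P} {Q} _ (<-trans ≤-refl hi) hi h asc))

  ascends-∷ʳ : ∀ P a i v v' → Ascends P (a ++ i ∷ []) v' → Ascends P a v × Ascent (extend P a v) i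
  ascends-∷ʳ P [] i [] (_ ∷ []) (h , _) = tt , h
  ascends-∷ʳ P (x ∷ a) i (_ ∷ v) (_ ∷ v') (h , hs) with ascends-∷ʳ _ a i v v' hs
  ... | p , q = (h , p) , q

  -- A transposition is moved to the right end of a word by conjugating it with each letter it
  -- passes.
  swap-through : ∀ P Q {i j} (hi : i < n) (hj : j < n) → i ≢ j → (∀ k → to Q k ≡ to (mulʳ P i j hi hj) k) → ∀ a v →
    Σ ℕ λ i' → Σ ℕ λ j' → Σ (i' < n) λ hi' → Σ (j' < n) λ hj' → i' ≢ j' × (∀ k → to (extend Q a v) k ≡ to (mulʳ (extend P a v) i' j' hi' hj') k)
  swap-through P Q {i} {j} hi hj ne e [] [] = i , j , hi , hj , ne , e
  swap-through P Q {i} {j} hi hj ne e (x ∷ a) (h ∷ v) = swap-through _ _ (swap-< hx h hi) (swap-< hx h hj) (λ q → ne (swap-injective x (suc x) q))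
    (λ k → trans (e (swapℕ x (suc x) k)) (cong (to P) (sym (trans (swap-conj (swap-injective x (suc x)) (swapℕ x (suc x) i) (swapℕ x (suc x) j) k)
      (cong₂ (λ a b → swapℕ a b (swapℕ x (suc x) k)) (swap-involutive x (suc x) i) (swap-involutive x (suc x) j)))))) a v
    where
    hx : x < n
    hx = <-trans ≤-refl h

  full-sublist : ∀ {a b : List ℕ} → b ⊆ a → length a ≡ length b → b ≡ a
  full-sublist [] e = refl
  full-sublist {x ∷ a} (x ∷ʳ s) e = ⊥-elim (<⇒≱ (subst (length a <_) e ≤-refl) (Sublist.length-mono-≤ s))
  full-sublist (refl ∷ s) e = cong (_ ∷_) (full-sublist s (suc-injective e))

  deletion : ∀ P {a b} v v' → b ⊆ a → length a ≡ suc (length b) →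
    Σ ℕ λ i → Σ ℕ λ j → Σ (i < n) λ hi → Σ (j < n) λ hj → i ≢ j × (∀ k → to (extend P a v) k ≡ to (mulʳ (extend P b v') i j hi hj) k)
  deletion P v v' [] ()
  deletion P {x ∷ a} (h ∷ v) v' (x ∷ʳ s) e with full-sublist s (suc-injective e)
  ... | refl with AllBase.irrelevant <-irrelevant v v'
  ...   | refl = swap-through P _ (<-trans ≤-refl h) h (λ q → 1+n≢n (sym q)) (λ _ → refl) a v
  deletion P (h ∷ v) (h' ∷ v') (refl ∷ s) e with <-irrelevant h h'
  ... | refl = deletion _ v v' s (suc-injective e)

-- μ-involutions represented by their atoms

module MuInvolutions (μ : List ℕ) where

  n : ℕ
  n = sum μ

  blk : ℕ → ℕ
  blk = blockIndex μ

  blk-mono : ∀ {x y} → x ≤ y → blk x ≤ blk y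
  blk-mono = blockIndex-mono μ

  open Encoding n μ using (encode; class; class-cong; State; encode-cong; encode-injective; encode-InvolMu; act-rise; act-fall; ∈-class⁺; ∈-class⁻; class-sorted)
  open Words {n}
  open Connected {n} {blk} blk-mono
  open DescentAtom {n} {blk} blk-mono

  colours : Perm n → ℕ → ℕ
  colours P v = blk (to P v)

  L : Perm n → ℕ
  L P = ℓ (word P)

  L-cong : ∀ {P Q : Perm n} → (∀ k → to P k ≡ to Q k) → L P ≡ L Q
  L-cong e = cong ℓ (map-upTo-cong n λ k _ → e k)

  blocks-e : blocks μ (upTo n) ≡ map (class blk) (upTo (length μ))
  blocks-e = blocks-upTo μ

  encode-id : encode blk (λ v → v) ≡ e n
  encode-id = trans (cong concat (trans (map-cong (λ r → map-id (class blk r)) (upTo (length μ))) (sym blocks-e))) (concat-blocks μ (upTo n) (length-upTo n))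

  sizes-colours : ∀ P → map (λ r → length (class (colours P) r)) (upTo (length μ)) ≡ μ
  sizes-colours P = trans (map-cong same-size (upTo (length μ))) (trans (map-∘ (upTo (length μ))) (trans (cong (map length) (sym blocks-e)) (length-blocks μ (upTo n) (length-upTo n))))
    where
    same-size : ∀ r → length (class (colours P) r) ≡ length (class blk r)
    same-size r = trans (sym (length-map (to P) (class (colours P) r))) (Perm↭.↭-length (set⇒↭
      (UniqueProperties.map⁺ (injective P) (sorted-unique-list (class-sorted (colours P) r))) (sorted-unique-list (class-sorted blk r))
      (λ h → into (Membership.∈-map⁻ (to P) h)) back))
      where
      into : ∀ {v} → (∃ λ x → x ∈ class (colours P) r × v ≡ to P x) → v ∈ class blk r
      into (x , h , refl) with ∈-class⁻ {colours P} h
      ... | k , e = ∈-class⁺ (bounded P k) e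
      back : ∀ {v} → v ∈ class blk r → v ∈ map (to P) (class (colours P) r)
      back {v} h with ∈-class⁻ {blk} h
      ... | k , e = subst (_∈ map (to P) (class (colours P) r)) (to-from P v) (Membership.∈-map⁺ (to P) (∈-class⁺ (bounded (inverse P) k) (trans (cong blk (to-from P v)) e)))

  state : ∀ {P z} → Atom blk P z → State (colours P) z
  state {P} A = record { involutive = invol A ; in-range = z-bounded A ; preserves = colour A
    ; few-colours = λ h → blockIndex-bound μ (bounded P h) ; sizes = sizes-colours P }

  -- word P runs through 𝒜_μ(π), as InA⇒rep and rep⇒InA show.
  record Represents (π : List ℕ) (P : Perm n) : Set where
    constructor represents
    field
      {involution} : ℕ → ℕ
      atom : Atom blk P involution
      encoded : π ≡ encode (colours P) involution

  rep-cong : ∀ {π P Q} → (∀ k → to P k ≡ to Q k) → Represents π P → Represents π Q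
  rep-cong e (represents A q) = represents (Atom-cong e (λ _ → refl) A) (trans q (encode-cong (λ {v} _ → cong blk (e v)) λ _ → refl))

  rep-InvolMu : ∀ {π P} → Represents π P → InvolMu n μ π
  rep-InvolMu (represents A refl) = encode-InvolMu (state A)

  id-atom : Atom blk (identity n) (λ v → v)
  id-atom = record { invol = λ _ → refl ; outside = λ _ _ → refl ; colour = λ _ → refl ; desc = λ v h → ⊥-elim (<-irrefl refl h)
    ; mono = λ _ _ _ h _ → h ; gap = λ u x h k → ⊥-elim (<-asym h k) }

  rep-id : Represents (e n) (identity n)
  rep-id = represents id-atom (sym encode-id)

  rep-unique : ∀ {π π' P} → Represents π P → Represents π' P → π ≡ π'
  rep-unique (represents A p) (represents B q) = trans p (trans (encode-cong (λ _ → refl) λ v → atom-unique B A v) (sym q))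

  rep-of-id : ∀ {π P} → (∀ k → to P k ≡ k) → Represents π P → π ≡ e n
  rep-of-id e R = rep-unique (rep-cong e R) rep-id

  module _ {π P Q} (R : Represents π P) (R' : Represents π Q) where

    private
      module R = Represents R
      module R' = Represents R'
      eqs = encode-injective (state R.atom) (state R'.atom) (trans (sym R.encoded) R'.encoded)

    same-involution : ∀ v → R.involution v ≡ R'.involution v
    same-involution v with v <? n
    ... | yes h = proj₂ eqs h
    ... | no h = trans (outside R.atom v (≮⇒≥ h)) (sym (outside R'.atom v (≮⇒≥ h)))

    same-colours : ∀ v → colours P v ≡ colours Q v
    same-colours v with v <? n
    ... | yes h = proj₁ eqs h
    ... | no h = cong blk (trans (fixes P v (≮⇒≥ h)) (sym (fixes Q v (≮⇒≥ h))))

    atom′ : Atom blk Q R.involution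
    atom′ = Atom-cong (λ _ → refl) (λ v → sym (same-involution v)) R'.atom

    rep-linked : Linked P Q
    rep-linked = connected {R.involution} {P} {Q} R.atom atom′ same-colours

  -- The arrangements b c a and c a b both lie one step below c b a.
  linked-length : ∀ {P Q} → Linked P Q → L P ≡ L Q
  linked-length (pointwise {P} {Q} e) = L-cong {P} {Q} e
  linked-length (rotation {P} k h₀ h₁ h₂ level (p , q)) = suc-injective (trans (sym (ℓ-ascentˡ P k h₀ h₁ q))
    (trans (L-cong {M.s P} {M.t (M.rotate P)} λ x → sym (swap-involutive (suc k) (suc (suc k)) (M.σ (to P x)))) (ℓ-ascentˡ (M.rotate P) (suc k) h₁ h₂
      (subst₂ (λ u v → from P u < from P v) (sym (trans (cong M.σ M.τ-1) M.σ-2)) (sym (trans (cong M.σ M.τ-2) M.σ-1)) p))))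
    where module M = Move {n} {blk} blk-mono k h₀ h₁ h₂ level
  linked-length (symmetric l) = sym (linked-length l)
  linked-length (transitive l m) = trans (linked-length l) (linked-length m)

  rep-length : ∀ {π P Q} → Represents π P → Represents π Q → L P ≡ L Q
  rep-length R R' = linked-length (rep-linked R R')

  transport-rep : ∀ {π P} (R : Represents π P) {Q} → Atom blk Q (Represents.involution R) → (∀ v → colours Q v ≡ colours P v) → Represents π Q
  transport-rep R A same = represents A (trans (Represents.encoded R) (encode-cong (λ {v} _ → sym (same v)) λ _ → refl))

  module _ (i : ℕ) (h : suc i < n) where

    private
      hi : i < n
      hi = <-trans ≤-refl h

    -- When the action moves, the given atom rises with it. When it does not, the descent is
    -- exhibited in some atom of π, which may differ from `P`.
    step : ∀ {π P} → Represents π P → (Ascent P i × Represents (actMu μ π i) (stepʳ P i hi h)) ⊎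
      (actMu μ π i ≡ π × ∃ λ Q → Represents π Q × Descent Q i)
    step {P = P} R@(represents {z} A refl) with rise⊎fall (colours P) z i (z-injective A)
    ... | inj₁ (z' , r) with Steps.raise blk-mono A i hi h r
    ...   | a , A' = inj₁ (a , represents A' (act-rise (state A) i h r))
    step {P = P} R@(represents {z} A refl) | inj₂ f = inj₂ (act-fall (state A) i h f , HasDescent.perm D , transport-rep R (HasDescent.atom D) (HasDescent.blocks-same D) , HasDescent.descent D)
      where
      D : HasDescent P z i
      D = descent-atom A i h f

    lower-rep : ∀ {π P} → Represents π P → Descent P i → ∃ λ π₀ → Represents π₀ (stepʳ P i hi h) × actMu μ π₀ i ≡ π
    lower-rep {P = P} (represents A refl) d with Steps.lower blk-mono A i hi h d
    ... | z₀ , z₁ , A₀ , r , e = _ , represents A₀ refl , trans (act-rise (state A₀) i h r)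
      (encode-cong (λ {v} _ → cong blk (stepʳ-stepʳ P i hi h v)) e)

    lower-length : ∀ P → Descent P i → L P ≡ suc (L (stepʳ P i hi h))
    lower-length P = ℓ-descent P i hi h

    raise-length : ∀ P → Ascent P i → L (stepʳ P i hi h) ≡ suc (L P)
    raise-length P = ℓ-ascent P i hi h

  -- A letter at which the action does not move is wasted: the resulting atom is then shorter than
  -- the word allows. So a word that is short enough never stalls, and its product is an atom.
  run : ∀ a v {π P} → Represents π P →
    (Represents (applyMu μ π a) (extend P a v) × Ascends P a v × L (extend P a v) ≡ L P + length a) ⊎
    (∃ λ Q → Represents (applyMu μ π a) Q × L Q < L P + length a)
  run [] v {P = P} R = inj₁ (R , tt , sym (+-identityʳ (L P)))
  run (i ∷ a) (h ∷ v) {P = P} R with step i h R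
  ... | inj₁ (asc , R') with run a v R'
  ...   | inj₁ (R'' , ascs , e) = inj₁ (R'' , (asc , ascs) , trans e (trans (cong (_+ length a) (raise-length i h P asc)) (sym (+-suc (L P) (length a)))))
  ...   | inj₂ (Q , R'' , l) = inj₂ (Q , R'' , subst (L Q <_) (trans (cong (_+ length a) (raise-length i h P asc)) (sym (+-suc (L P) (length a)))) l)
  run (i ∷ a) (h ∷ v) {P = P} R | inj₂ (e , _) rewrite e with run a v R
  ... | inj₁ (R'' , _ , q) = inj₂ (_ , R'' , ≤-reflexive (trans (cong suc q) (sym (+-suc (L P) (length a)))))
  ... | inj₂ (Q , R'' , l) = inj₂ (Q , R'' , <-trans l (≤-reflexive (sym (+-suc (L P) (length a)))))

  L-id : L (identity n) ≡ 0
  L-id = trans (cong ℓ (map-id (upTo n))) (ℓ-identity n)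

  record WordOf (π : List ℕ) (P : Perm n) : Set where
    field
      letters : List ℕ
      valid : ValidWord n letters
      product : ∀ k → to (extend (identity n) letters valid) k ≡ to P k
      length-letters : length letters ≡ L P
      acts : applyMu μ (e n) letters ≡ π

  length-∷ʳ : ∀ (a : List ℕ) i → length (a ++ i ∷ []) ≡ suc (length a)
  length-∷ʳ a i = trans (length-++ a) (+-comm (length a) 1)

  applyMu-∷ʳ : ∀ a i π → applyMu μ π (a ++ i ∷ []) ≡ actMu μ (applyMu μ π a) i
  applyMu-∷ʳ a i π = foldl-∷ʳ (actMu μ) π i a

  empty-word : ∀ {π P} → Represents π P → (∀ k → to P k ≡ k) → WordOf π P
  empty-word {P = P} R e = record { letters = [] ; valid = [] ; product = λ k → sym (e k) ; length-letters = sym (trans (L-cong {P} {identity n} e) L-id) ; acts = sym (rep-of-id e R) }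

  append-letter : ∀ {π π₀ P} i (h : suc i < n) (d : Descent P i) → actMu μ π₀ i ≡ π → WordOf π₀ (stepʳ P i (<-trans ≤-refl h) h) → WordOf π P
  append-letter {P = P} i h d e W = record
    { letters = letters ++ i ∷ [] ; valid = valid-∷ʳ valid h
    ; product = λ k → trans (extend-∷ʳ (identity n) letters i valid (valid-∷ʳ valid h) h k) (trans (product _) (stepʳ-stepʳ P i (<-trans ≤-refl h) h k))
    ; length-letters = trans (length-∷ʳ letters i) (trans (cong suc length-letters) (sym (lower-length i h P d)))
    ; acts = trans (applyMu-∷ʳ letters i (upTo n)) (trans (cong (λ π → actMu μ π i) acts) e) }
    where open WordOf W

  word-of : ∀ {π P} → Represents π P → WordOf π P
  word-of {P = P} R = <-rec Claim claim (L P) R refl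
    where
    Claim : ℕ → Set
    Claim l = ∀ {π P} → Represents π P → L P ≡ l → WordOf π P
    claim : ∀ l → (∀ {l'} → l' < l → Claim l') → Claim l
    claim l ih {π} {P} R refl with descent⊎identity P
    ... | inj₂ e = empty-word R e
    ... | inj₁ (i , h , d) with lower-rep i h R d
    ...   | π₀ , R₀ , e = append-letter i h d e (ih (≤-reflexive (sym (lower-length i h P d))) R₀ refl)

  run-id : ∀ a v → (Represents (applyMu μ (e n) a) (extend (identity n) a v) × Ascends (identity n) a v × L (extend (identity n) a v) ≡ length a) ⊎
    (∃ λ Q → Represents (applyMu μ (e n) a) Q × L Q < length a)
  run-id a v with run a v rep-id
  ... | inj₁ (R , s , q) = inj₁ (R , s , trans q (cong (_+ length a) L-id))
  ... | inj₂ (Q , R , l) = inj₂ (Q , R , subst (L Q <_) (cong (_+ length a) L-id) l)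

  minimal : ∀ {π P} → Represents π P → ∀ b → ValidWord n b → applyMu μ (e n) b ≡ π → L P ≤ length b
  minimal R b v refl with run-id b v
  ... | inj₁ (R' , _ , q) = ≤-reflexive (trans (rep-length R R') q)
  ... | inj₂ (Q , R' , l) = ≤-trans (≤-reflexive (rep-length R R')) (<⇒≤ l)

  reduced : ∀ {π P} (R : Represents π P) (W : WordOf π P) → ReducedMu n μ π (WordOf.letters W)
  reduced R W = valid , acts , λ b v q → ≤-trans (≤-reflexive length-letters) (minimal R b v q)
    where open WordOf W

  shortest-rep : ∀ {π a} → (v : ValidWord n a) → applyMu μ (e n) a ≡ π → (∀ {Q} → Represents π Q → length a ≤ L Q) →
    Represents π (extend (identity n) a v) × Ascends (identity n) a v × L (extend (identity n) a v) ≡ length a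
  shortest-rep {a = a} v refl short with run-id a v
  ... | inj₁ r = r
  ... | inj₂ (Q , R , l) = ⊥-elim (<⇒≱ l (short R))

  reduced-rep : ∀ {π a} → (r : ReducedMu n μ π a) →
    Represents π (extend (identity n) a (proj₁ r)) × Ascends (identity n) a (proj₁ r) × L (extend (identity n) a (proj₁ r)) ≡ length a
  reduced-rep (v , q , short) = shortest-rep v q λ R → ≤-trans (short _ (WordOf.valid (word-of R)) (WordOf.acts (word-of R))) (≤-reflexive (WordOf.length-letters (word-of R)))

  InA⇒rep : ∀ {π w} → InA n μ π w → ∃ λ P → Represents π P × w ≡ word P
  InA⇒rep (_ , (a , (v , p , q) , acts) , (a' , r , q')) with reduced-rep r
  -- The length condition of 𝒜_μ(π) makes the reduced word of `w` as short as any atom of π, so the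
  -- action never stalls along it.
  ... | R' , _ , l' with shortest-rep v acts (λ R → ≤-reflexive (trans q (trans (sym q') (trans (sym l') (rep-length R' R)))))
  ...   | R , _ , _ = _ , R , trans (sym p) (prodWord-word a v)

  rep⇒InA : ∀ {π P} → Represents π P → InA n μ π (word P)
  rep⇒InA {π} {P} R = word-perm P , (letters , (valid , trans (prodWord-word letters valid) (map-upTo-cong n λ k _ → product k) , length-letters) , acts) ,
    (letters , reduced R W , length-letters)
    where
    W : WordOf π P
    W = word-of R
    open WordOf W

  -- The μ-Bruhat order as comparability of atoms

  Below : List ℕ → List ℕ → Set
  Below π τ = ∃ λ P → ∃ λ Q → Represents π P × Represents τ Q × P ⊑ Q

  -- The atoms of τ are linked by moves, and each move carries a comparison along, at the price of
  -- another atom of π.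
  below-at : ∀ {π τ Q} → Below π τ → Represents τ Q → ∃ λ P → Represents π P × P ⊑ Q
  below-at (P , Q , R , S , h) S' with proj₁ (linked-refines {Represents.involution R} (rep-linked S S')) (Represents.atom R) h
  ... | V , A , same , h' = V , transport-rep R A same , h'

  -- Letters are removed from the right. If `P` ascends at the last letter, lifting allows it to be
  -- skipped; if it descends, the letter is kept on both sides, and `lower-rep` shows that the rest
  -- of `P` is again an atom.
  subword : ∀ {π P} a (v : ValidWord n a) → Ascends (identity n) a v → Represents π P → P ⊑ extend (identity n) a v →
    Σ (WordOf π P) λ W → WordOf.letters W ⊆ a
  subword a v s = go (Reverse.reverseView a) v s
    where
    go : ∀ {a} → Reverse.Reverse a → (v : ValidWord n a) → Ascends (identity n) a v → ∀ {π P} → Represents π P → P ⊑ extend (identity n) a v →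
      Σ (WordOf π P) λ W → WordOf.letters W ⊆ a
    go Reverse.[] v s {P = P} R h = empty-word R (⊑id⇒≡id P (identity n) (λ _ → refl) (below (rank-≥ h))) , []
    go (a Reverse.∶ view ∶ʳ i) v s {P = P} R h = by-step (ascent⊎descent P i)
      where
      v₀ : ValidWord n a
      v₀ = All.++⁻ˡ a v
      hi : suc i < n
      hi = AllBase.head (All.++⁻ʳ a v)
      W : Perm n
      W = extend (identity n) a v₀
      s₀ : Ascends (identity n) a v₀ × Ascent W i
      s₀ = ascends-∷ʳ (identity n) a i v₀ v s
      h' : P ⊑ stepʳ W i (<-trans ≤-refl hi) hi
      h' = ⊑-trans h (⊑-≗ (extend-∷ʳ (identity n) a i v₀ v hi))
      back : stepʳ (stepʳ W i (<-trans ≤-refl hi) hi) i (<-trans ≤-refl hi) hi ⊑ W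
      back = ⊑-≗ (stepʳ-stepʳ W i (<-trans ≤-refl hi) hi)
      by-step : Ascent P i ⊎ Descent P i → Σ (WordOf _ P) λ W → WordOf.letters W ⊆ a ++ i ∷ []
      by-step (inj₁ asc) with go view v₀ (proj₁ s₀) R (⊑-trans (lower-right i (<-trans ≤-refl hi) hi h' asc) back)
      ... | W' , sub = W' , Sublist.++⁺ʳ (i ∷ []) sub
      by-step (inj₂ d) with lower-rep i hi R d
      ... | π₀ , R₀ , e with go view v₀ (proj₁ s₀) R₀ (⊑-trans (lower-both i (<-trans ≤-refl hi) hi h' d) back)
      ...   | W' , sub = append-letter i hi d e W' , Sublist.++⁺ sub (refl ∷ [])

  below⇒LeMu : ∀ {π τ} → Below π τ → LeMu n μ π τ
  below⇒LeMu {π} {τ} B a r = from-rep (reduced-rep r)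
    where
    from-word : ∀ {P} → Represents π P → (Σ (WordOf π P) λ W → WordOf.letters W ⊆ a) → Σ (List ℕ) λ b → b ⊆ a × ReducedMu n μ π b
    from-word R (W , sub) = WordOf.letters W , sub , reduced R W
    from-rep : Represents τ (extend (identity n) a (proj₁ r)) × Ascends (identity n) a (proj₁ r) × L (extend (identity n) a (proj₁ r)) ≡ length a →
      Σ (List ℕ) λ b → b ⊆ a × ReducedMu n μ π b
    from-rep (S , s , _) = from-below (below-at B S)
      where
      from-below : (∃ λ P → Represents π P × P ⊑ extend (identity n) a (proj₁ r)) → Σ (List ℕ) λ b → b ⊆ a × ReducedMu n μ π b
      from-below (P , R , h) = from-word R (subword a (proj₁ r) s R h)

  -- Induction along a descent `i` of an atom of τ, which leads down to `τ₀`. If the atom of π below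
  -- it ascends at `i`, then π lies below `τ₀`, which is the required element. Otherwise π descends
  -- to `π₀`, and the element `σ₀` found between `π₀` and `τ₀` is raised by `i`. If the action does
  -- not move `σ₀`, then π lies below `σ₀` and again `τ₀` will do.
  below-length : ∀ {π τ} → Below π τ → ∀ {P Q} → Represents π P → Represents τ Q → π ≢ τ →
    ∃ λ σ → Below π σ × Below σ τ × ∃ λ S → Represents σ S × suc (L S) ≡ L Q
  below-length B {Q = Q} R T ne = <-rec Claim claim (L Q) B T refl ne
    where
    Claim : ℕ → Set
    Claim l = ∀ {π τ Q} → Below π τ → Represents τ Q → L Q ≡ l → π ≢ τ →
      ∃ λ σ → Below π σ × Below σ τ × ∃ λ S → Represents σ S × suc (L S) ≡ L Q
    claim : ∀ l → (∀ {l'} → l' < l → Claim l') → Claim l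
    claim l ih {π} {τ} {W} B T refl ne = from-descent (descent⊎identity W) (below-at B T)
      where
      Goal : Set
      Goal = ∃ λ σ → Below π σ × Below σ τ × ∃ λ S → Represents σ S × suc (L S) ≡ L W
      from-descent : (Σ ℕ λ i → suc i < n × Descent W i) ⊎ (∀ k → to W k ≡ k) → (∃ λ V → Represents π V × V ⊑ W) → Goal
      from-descent (inj₂ e) (V , R , h) = ⊥-elim (ne (trans (rep-of-id (⊑id⇒≡id V W e h) R) (sym (rep-of-id e T))))
      from-descent (inj₁ (i , hi' , d)) (V , R , h) = from-lower (lower-rep i hi' T d)
        where
        hi : i < n
        hi = <-trans ≤-refl hi'
        W₀ : Perm n
        W₀ = stepʳ W i hi hi'
        W-back : stepʳ W₀ i hi hi' ⊑ W
        W-back = ⊑-≗ (stepʳ-stepʳ W i hi hi')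
        W₀⊑W : W₀ ⊑ W
        W₀⊑W = ⊑-trans (⊑-raise W₀ i hi hi' (stepʳ-ascent W i hi hi' d)) W-back
        from-lower : (∃ λ τ₀ → Represents τ₀ W₀ × actMu μ τ₀ i ≡ τ) → Goal
        from-lower (τ₀ , T₀ , eτ) = by-step (ascent⊎descent V i)
          where
          to-τ₀ : Below π τ₀ → Goal
          to-τ₀ B₀ = τ₀ , B₀ , (W₀ , W , T₀ , T , W₀⊑W) , W₀ , T₀ , sym (lower-length i hi' W d)
          from-both : Descent V i → (∃ λ π₀ → Represents π₀ (stepʳ V i hi hi') × actMu μ π₀ i ≡ π) → Goal
          from-both d' (π₀ , R₀ , eπ) = from-ih (ih (≤-reflexive (sym (lower-length i hi' W d)))
            (stepʳ V i hi hi' , W₀ , R₀ , T₀ , lower-both i hi hi' h d') T₀ refl λ e → ne (trans (sym eπ) (trans (cong (λ ρ → actMu μ ρ i) e) eτ)))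
            where
            rises : ∀ {V₀} → Represents π₀ V₀ → Represents π (stepʳ V₀ i hi hi')
            rises {V₀} R₁ = from-step (step i hi' R₁)
              where
              from-step : (Ascent V₀ i × Represents (actMu μ π₀ i) (stepʳ V₀ i hi hi')) ⊎ (actMu μ π₀ i ≡ π₀ × ∃ λ Q → Represents π₀ Q × Descent Q i) →
                Represents π (stepʳ V₀ i hi hi')
              from-step (inj₁ (_ , R₂)) = subst (λ ρ → Represents ρ (stepʳ V₀ i hi hi')) eπ R₂
              -- A stationary `π₀` would equal π, although their atoms differ in length by one.
              from-step (inj₂ (e , _)) = ⊥-elim (1+n≢n (trans (sym (lower-length i hi' V d'))
                (rep-length R (subst (λ ρ → Represents ρ (stepʳ V i hi hi')) (trans (sym e) eπ) R₀))))
            from-ih : (∃ λ σ → Below π₀ σ × Below σ τ₀ × ∃ λ S → Represents σ S × suc (L S) ≡ L W₀) → Goal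
            from-ih (σ₀ , B₁ , B₂ , S₀ , U₀ , lS) = from-step (step i hi' U₀)
              where
              -- Some atom of the stationary `σ₀` has a descent at `i`. An atom of `π₀` below it
              -- stays below it after being raised, and the raised one is an atom of π.
              via : ∀ {S'} → Represents σ₀ S' → Descent S' i → (∃ λ P → Represents π₀ P × P ⊑ S') → (∃ λ S₁ → Represents σ₀ S₁ × S₁ ⊑ W₀) → Below π τ₀
              via {S'} U' dS (P , R₁ , q) (S₁ , U₁ , q₁) = from-below (below-at (stepʳ P i hi hi' , S' , rises R₁ , U' , raise-left i hi hi' q dS) U₁)
                where
                from-below : (∃ λ P₁ → Represents π P₁ × P₁ ⊑ S₁) → Below π τ₀
                from-below (P₁ , R₂ , q₂) = P₁ , W₀ , R₂ , T₀ , ⊑-trans q₂ q₁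
              raised : Ascent S₀ i → Represents (actMu μ σ₀ i) (stepʳ S₀ i hi hi') → Goal
              raised a U = actMu μ σ₀ i , from-π (below-at B₁ U₀) , from-σ (below-at B₂ T₀) , stepʳ S₀ i hi hi' , U ,
                trans (cong suc (trans (raise-length i hi' S₀ a) lS)) (sym (lower-length i hi' W d))
                where
                from-π : (∃ λ P → Represents π₀ P × P ⊑ S₀) → Below π (actMu μ σ₀ i)
                from-π (P , R₁ , q) = stepʳ P i hi hi' , stepʳ S₀ i hi hi' , rises R₁ , U , raise-both i hi hi' q a
                from-σ : (∃ λ S → Represents σ₀ S × S ⊑ W₀) → Below (actMu μ σ₀ i) τ
                from-σ (S , U₁ , q) = ascending (step i hi' U₁)
                  where
                  ascending : (Ascent S i × Represents (actMu μ σ₀ i) (stepʳ S i hi hi')) ⊎ (actMu μ σ₀ i ≡ σ₀ × ∃ λ Q → Represents σ₀ Q × Descent Q i) →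
                    Below (actMu μ σ₀ i) τ
                  ascending (inj₁ (_ , U₂)) = stepʳ S i hi hi' , W , U₂ , T , ⊑-trans (raise-both i hi hi' q (stepʳ-ascent W i hi hi' d)) W-back
                  ascending (inj₂ (e , _)) = ⊥-elim (1+n≢n (trans (sym (raise-length i hi' S₀ a)) (rep-length (subst (λ ρ → Represents ρ (stepʳ S₀ i hi hi')) e U) U₀)))
              from-step : (Ascent S₀ i × Represents (actMu μ σ₀ i) (stepʳ S₀ i hi hi')) ⊎ (actMu μ σ₀ i ≡ σ₀ × ∃ λ Q → Represents σ₀ Q × Descent Q i) → Goal
              from-step (inj₁ (a , U)) = raised a U
              from-step (inj₂ (_ , S' , U' , dS)) = to-τ₀ (via U' dS (below-at B₁ U') (below-at B₂ T₀))
          by-step : Ascent V i ⊎ Descent V i → Goal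
          by-step (inj₁ a) = to-τ₀ (V , W₀ , R , T₀ , lower-right i hi hi' h a)
          by-step (inj₂ d') = from-both d' (lower-rep i hi' R d')

-- Atoms across a cover, in both directions

module Theorem (μ : List ℕ) {π τ : List ℕ} (cover : CoversMu (sum μ) μ π τ) where

  open MuInvolutions μ
  open Words {n}

  Transposed : List ℕ → Set
  Transposed u = Σ (List ℕ) λ w → Σ ℕ λ i → Σ ℕ λ j →
    i < j × j < n × InA n μ π w × TMu n μ i j π τ × ℓ (swapPos i j w) ≡ suc (ℓ w) × u ≡ swapPos i j w

  forward : ∀ {u} → InA n μ τ u → Transposed u
  forward {u} inA = from-rep (InA⇒rep inA)
    where
    from-rep : (∃ λ Q → Represents τ Q × u ≡ word Q) → Transposed u
    from-rep (Q , T , refl) = from-word (word-of T)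
     where
     from-word : WordOf τ Q → Transposed (word Q)
     from-word W = from-sublist (proj₁ cover letters (reduced T W))
      where
      open WordOf W
      A : Perm n
      A = extend (identity n) letters valid
      from-sublist : (Σ (List ℕ) λ b → b ⊆ letters × ReducedMu n μ π b) → Transposed (word Q)
      from-sublist (b , sub , red) = from-reps (reduced-rep red) (reduced-rep (reduced T W))
       where
       V : Perm n
       V = extend (identity n) b (proj₁ red)
       from-reps : Represents π V × Ascends (identity n) b (proj₁ red) × L V ≡ length b →
         Represents τ A × Ascends (identity n) letters valid × L A ≡ length letters → Transposed (word Q)
       from-reps (R , _ , length-V) (_ , ascends , _) = from-chain (below-length π≤τ R T (proj₁ (proj₂ cover)))
        where
        -- A single reduced word of τ with a subword for π already yields a comparable pair of
        -- atoms.
        π≤τ : Below π τ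
        π≤τ = V , A , R , rep-cong (λ k → sym (product k)) T ,
          extend-⊑ valid (proj₁ red) sub ascends ⊑-refl
        by-transposition : suc (L V) ≡ L Q → ∀ {i j} (hi : i < n) (hj : j < n) → i < j → (∀ k → to Q k ≡ to (mulʳ V i j hi hj) k) → Transposed (word Q)
        -- The product of the subword plays two parts: it is the atom `w` of the conclusion and the
        -- witness that `t^μ` takes π to τ.
        by-transposition l {i} {j} hi hj i<j q = word V , i , j , i<j , hj , rep⇒InA R ,
          inj₁ (rep-InvolMu T , word V , rep⇒InA R , length-up , subst (InA n μ τ) u≡ (rep⇒InA T)) , length-up , u≡
          where
          u≡ : word Q ≡ swapPos i j (word V)
          u≡ = trans (map-upTo-cong n λ k _ → q k) (sym (swapPos-word V i j hi hj))
          length-up : ℓ (swapPos i j (word V)) ≡ suc (ℓ (word V))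
          length-up = trans (cong ℓ (sym u≡)) (sym l)
        from-rank : suc (L V) ≡ L Q → Transposed (word Q)
        from-rank l = from-deletion (deletion (identity n) valid (proj₁ red) sub
          (trans length-letters (trans (sym l) (cong suc length-V))))
          where
          from-deletion : (Σ ℕ λ i → Σ ℕ λ j → Σ (i < n) λ hi → Σ (j < n) λ hj → i ≢ j × (∀ k → to A k ≡ to (mulʳ V i j hi hj) k)) → Transposed (word Q)
          from-deletion (i , j , hi , hj , ne , q) with <-cmp i j
          ... | tri< h _ _ = by-transposition l hi hj h λ k → trans (sym (product k)) (q k)
          ... | tri≈ _ h _ = ⊥-elim (ne h)
          ... | tri> _ _ h = by-transposition l hj hi h λ k → trans (sym (product k)) (trans (q k) (cong (to V) (swap-sym i j k)))
        from-chain : (∃ λ σ → Below π σ × Below σ τ × ∃ λ S → Represents σ S × suc (L S) ≡ L Q) → Transposed (word Q)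
        -- The element `σ` is one shorter than τ, so the cover relation identifies it with π. Hence
        -- the subword omits exactly one letter.
        from-chain (σ , B₁ , B₂ , S , U , l) = either (proj₂ (proj₂ cover) σ (rep-InvolMu U) (below⇒LeMu B₁) (below⇒LeMu B₂))
          where
          either : σ ≡ π ⊎ σ ≡ τ → Transposed (word Q)
          either (inj₁ e) = from-rank (trans (cong suc (rep-length R (subst (λ ρ → Represents ρ S) e U))) l)
          either (inj₂ e) = ⊥-elim (1+n≢n (trans l (rep-length T (subst (λ ρ → Represents ρ S) e U))))

  -- The operator `t^μ` provides some atom `v` of π whose swap is an atom of τ, while `w` is another
  -- atom of π with a covering swap; `exchange` transfers the conclusion from `v` to `w`.
  backward : ∀ {u} → Transposed u → InA n μ τ u
  -- The default value of `t^μ` is π itself, which a cover keeps apart from τ.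
  backward (w , i , j , i<j , hj , inA , inj₂ (_ , e) , _ , _) = ⊥-elim (proj₁ (proj₂ cover) (sym e))
  backward (w , i , j , i<j , hj , inA , inj₁ (_ , v , inA-v , up-v , inA-v') , up , refl) = conclude (InA⇒rep inA) (InA⇒rep inA-v) (InA⇒rep inA-v')
    where
    hi : i < n
    hi = <-trans i<j hj
    conclude : (∃ λ P → Represents π P × w ≡ word P) → (∃ λ V → Represents π V × v ≡ word V) →
      (∃ λ V' → Represents τ V' × swapPos i j v ≡ word V') → InA n μ τ (swapPos i j w)
    conclude (P , R , refl) (V , R' , refl) (V' , T , e) = subst (InA n μ τ) (sym (swapPos-word P i j hi hj)) (rep⇒InA T″)
      where
      T′ : Represents τ (mulʳ V i j hi hj)
      T′ = rep-cong (word-injective V' (mulʳ V i j hi hj) (trans (sym e) (swapPos-word V i j hi hj))) T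
      cover-of : ∀ (X : Perm n) → ℓ (swapPos i j (word X)) ≡ suc (ℓ (word X)) → IsCover X i j
      cover-of X l = ℓ-cover X i<j hi hj (trans (cong ℓ (sym (swapPos-word X i j hi hj))) l)
      same : ∀ v → colours P v ≡ colours V v
      same = same-colours R R'
      T″ : Represents τ (mulʳ P i j hi hj)
      T″ = transport-rep T′ (exchange blk-mono (Represents.atom R') hi hj i<j (cover-of V up-v)
          (Atom-cong (λ _ → refl) (λ _ → refl) (Represents.atom T′)) (atom′ R' R) same (cover-of P up))
        λ k → same (swapℕ i j k)

theorem3p11 : (n : ℕ) (μ : List ℕ) → IsComposition n μ →
    (π τ : List ℕ) → InvolMu n μ π → InvolMu n μ τ → CoversMu n μ π τ →
    (u : List ℕ) →
    InA n μ τ u ⇔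
    (Σ (List ℕ) λ w → Σ ℕ λ i → Σ ℕ λ j →
    i < j × j < n × InA n μ π w × TMu n μ i j π τ ×
    ℓ (swapPos i j w) ≡ suc (ℓ w) × u ≡ swapPos i j w)
theorem3p11 n μ (_ , refl) π τ _ _ cover u = mk⇔ forward backward
  where open Theorem μ {π} {τ} cover
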